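{- Let $K$ be a field of characteristic $0$. (1) For all $G(x,y)\in K[[x,y]]$, the number of positive roots (counted with multiplicity) of $G(x,y)$ that lie in $K^{\mathrm{fra}}[[x]]$ equals the order of $G(0,y)$ (the least exponent of $y$ occurring in $G(0,y)$). (2) For all $G(x,y)\in K[y][[x]]$, the number of roots (counted with multiplicity) of $G(x,y)$ that lie in $K^{\mathrm{fra}}[[x]]$ and have constant term $\alpha$ equals the multiplicity of $\alpha$ as a root of $G(0,y)$.
   Context: $K^{\mathrm{fra}}[[x]]=\bigcup_{N\ge1}K[[x^{1/N}]]$ is the ring of fractional power series. A root of $G(x,y)$ is a $Y=Y(x)$ with $G(x,Y(x))=0$; a positive root is a root $Y\in K^{\mathrm{fra}}[[x]]$ with zero constant term $Y(0)=0$ (for which the substitution is defined for every $G\in K[[x,y]]$; for $G\in K[y][[x]]$, the ring of power series in $x$ with coefficients in $K[y]$, substitution of any $Y\in K^{\mathrm{fra}}[[x]]$ is defined). The multiplicity of a positive root $Y$ of $G$ is the exponent of $y-Y$ in the factorization of $G$, i.e. the largest $k$ such that $G(x,y)=(y-Y)^kF(x,y)$ for some $N\ge1$ and some $F\in K[[x^{1/N},y]]$. The multiplicity of a root $Y$ with constant term $\alpha\in K$ of $G\in K[y][[x]]$ is the multiplicity of the positive root $Y-\alpha$ of $G(x,y+\alpha)$.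
   Formalization: K is additionally assumed algebraically closed, since over the rationals y²−2x² has G(0,y) of order 2 but no root in K^fra[[x]]; G(0,y) is taken nonzero, so that its order and the multiplicity of α are defined. -}

module Defs where

open import Level using (Level; _⊔_)
open import Algebra.Apartness.Bundles using (HeytingField; HeytingCommutativeRing)
open import Algebra.Bundles using (CommutativeRing)
open import Algebra.Bundles.Raw using (RawRing)
import Algebra.Definitions.RawSemiring as SemiringDefs
open import Data.Fin.Base using (toℕ)
open import Data.List.Base as List using (List)
open import Data.List.Relation.Unary.All using (All)
open import Data.List.Relation.Unary.AllPairs using (AllPairs)
open import Data.List.Relation.Unary.Any using (Any)
open import Data.Nat.Base as ℕ using (ℕ; zero; suc; _∸_; NonZero)
open import Data.Nat.Divisibility using (_∣?_; quotient)
import Data.Nat.ListAction as ListAction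
open import Data.Product.Base using (_×_; _,_; proj₁; proj₂; Σ-syntax; ∃-syntax)
open import Relation.Binary.PropositionalEquality.Core using (_≡_)
open import Relation.Nullary.Decidable.Core using (yes; no)
open import Relation.Nullary.Negation.Core using (¬_)

IsLargest : ∀ {p} → (ℕ → Set p) → ℕ → Set p
IsLargest P k = P k × (∀ l → P l → l ℕ.≤ k)

-- Only the operations of formal power series are needed to state things, so
-- the construction is on raw rings; it can be iterated.
module Series {a ℓ} (R : RawRing a ℓ) where
  open RawRing R
  open SemiringDefs rawSemiring using (sum)

  Coefficients : Set a
  Coefficients = ℕ → Carrier

  const : Carrier → Coefficients
  const c zero    = c
  const c (suc _) = 0#

  X : Coefficients
  X 1 = 1#
  X _ = 0#

  infixl 7 _⊛_
  _⊛_ : Coefficients → Coefficients → Coefficients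
  (f ⊛ g) n = sum {suc n} λ i → f (toℕ i) * g (n ∸ toℕ i)

  -- f(t) ↦ f(tᴺ), meant for N ≥ 1.
  dilate : ℕ → Coefficients → Coefficients
  dilate N f n with N ∣? n
  ... | yes N∣n = f (quotient N∣n)
  ... | no  _   = 0#

  series : RawRing a ℓ
  series = record
    { Carrier = Coefficients
    ; _≈_     = λ f g → ∀ n → f n ≈ g n
    ; _+_     = λ f g n → f n + g n
    ; _*_     = _⊛_
    ; -_      = λ f n → - f n
    ; 0#      = const 0#
    ; 1#      = const 1#
    }

module FractionalSeries {c ℓ₁ ℓ₂} (K : HeytingField c ℓ₁ ℓ₂) where

  -- Classically a Heyting field is the same thing as a field (x # y is then
  -- x ≉ y).
  K-ring : CommutativeRing c ℓ₁
  K-ring = HeytingCommutativeRing.commutativeRing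
             (HeytingField.heytingCommutativeRing K)

  open CommutativeRing K-ring public
    using (Carrier; _≈_; _≉_; _+_; _*_; -_; _-_; 0#; 1#)
    renaming (rawRing to K-raw)
  open SemiringDefs (RawRing.rawSemiring K-raw) public
    using (_^_; sum) renaming (_×_ to _·_)

  CharacteristicZero : Set ℓ₁
  CharacteristicZero = ∀ n → suc n · 1# ≉ 0#

  -- Every polynomial p₀ + p₁ x + ⋯ + p_d x^d of degree d ≥ 1 has a root in K.
  --
  -- Without this property the root counts fail: over ℚ, the polynomial
  -- y² - 2x² has no root in ℚ^fra[[x]], while y² has order 2.
  AlgebraicallyClosed : Set (c ⊔ ℓ₁)
  AlgebraicallyClosed =
    ∀ d (p : ℕ → Carrier) → 1 ℕ.≤ d → p d ≉ 0# →
    ∃[ x ] sum {suc d} (λ j → p (toℕ j) * x ^ toℕ j) ≈ 0#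

  -- One-variable series.
  module S₁ = Series K-raw
  module R₁ = RawRing S₁.series
  open SemiringDefs R₁.rawSemiring public
    using () renaming (_^_ to _^₁_; sum to sum₁)

  -- K[[x,y]], as power series in x over K[[y]]: G i j is the coefficient of
  -- xⁱyʲ, and G 0 is G(0,y).
  module S₂ = Series S₁.series
  module R₂ = RawRing S₂.series
  open SemiringDefs R₂.rawSemiring public
    using () renaming (_^_ to _^₂_)

  K⟦t⟧ K⟦x,y⟧ : Set c
  K⟦t⟧   = R₁.Carrier
  K⟦x,y⟧ = R₂.Carrier

  IsOrder : K⟦t⟧ → ℕ → Set ℓ₁
  IsOrder f d = f d ≉ 0# × (∀ j → j ℕ.< d → f j ≈ 0#)

  -- K[t] is the set of series with finitely many nonzero coefficients.
  IsPolynomial : K⟦t⟧ → Set ℓ₁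
  IsPolynomial p = ∃[ d ] (∀ j → d ℕ.≤ j → p j ≈ 0#)

  -- K[y][[x]] ⊆ K[[x,y]].
  IsPolynomialIn-y : K⟦x,y⟧ → Set ℓ₁
  IsPolynomialIn-y G = ∀ i → IsPolynomial (G i)

  -- p(s) for a polynomial p.
  evaluate : (p : K⟦t⟧) → IsPolynomial p → K⟦t⟧ → K⟦t⟧
  evaluate p (d , _) s = sum₁ {d} λ j → S₁.const (p (toℕ j)) R₁.* s ^₁ toℕ j

  -- h(s) for a series s with zero constant term; then sʲ does not contribute
  -- to the coefficient of tᵐ when j > m.
  compose : K⟦t⟧ → K⟦t⟧ → K⟦t⟧
  compose h s m = sum {suc m} λ j → h (toℕ j) * (s ^₁ toℕ j) m

  -- Σᵢ tⁱ fᵢ(t).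
  diagonal : (ℕ → K⟦t⟧) → K⟦t⟧
  diagonal f n = sum {suc n} λ i → f (toℕ i) (n ∸ toℕ i)

  -- The pair (N , f) represents f(x^(1/N)).
  record K^fra⟦x⟧ : Set c where
    constructor _⟨x^1/_⟩
    field
      coeff           : K⟦t⟧
      den             : ℕ
      {{den-nonZero}} : NonZero den

  open K^fra⟦x⟧ public

  -- Equality in the union over N: compare as series in x^(1/(den Y * den Z)).
  infix 4 _≈ᶠ_
  _≈ᶠ_ : K^fra⟦x⟧ → K^fra⟦x⟧ → Set ℓ₁
  Y ≈ᶠ Z = S₁.dilate (den Z) (coeff Y) R₁.≈ S₁.dilate (den Y) (coeff Z)

  HasConstantTerm : Carrier → K^fra⟦x⟧ → Set ℓ₁
  HasConstantTerm α Y = coeff Y 0 ≈ α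

  _-ᶠ_ : K^fra⟦x⟧ → Carrier → K^fra⟦x⟧
  Y -ᶠ α = record
    { coeff       = coeff Y R₁.+ R₁.- S₁.const α
    ; den         = den Y
    ; den-nonZero = den-nonZero Y
    }

  -- G(x,Y) as a series in t = x^(1/N), N = den Y: this is Σᵢ tᴺⁱ gᵢ(Y), where
  -- gᵢ(y) is the coefficient of xⁱ in G.
  substitute⁺ : K⟦x,y⟧ → K^fra⟦x⟧ → K⟦t⟧
  substitute⁺ G Y = diagonal (S₂.dilate (den Y) λ i → compose (G i) (coeff Y))

  substitute : (G : K⟦x,y⟧) → IsPolynomialIn-y G → K^fra⟦x⟧ → K⟦t⟧
  substitute G poly Y =
    diagonal (S₂.dilate (den Y) λ i → evaluate (G i) (poly i) (coeff Y))

  IsPositiveRoot : K⟦x,y⟧ → K^fra⟦x⟧ → Set ℓ₁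
  IsPositiveRoot G Y = HasConstantTerm 0# Y × substitute⁺ G Y R₁.≈ R₁.0#

  IsRootWithConstantTerm :
    (G : K⟦x,y⟧) → IsPolynomialIn-y G → Carrier → K^fra⟦x⟧ → Set ℓ₁
  IsRootWithConstantTerm G poly α Y =
    HasConstantTerm α Y × substitute G poly Y R₁.≈ R₁.0#

  -- y - s(x).
  y-_ : K⟦t⟧ → K⟦x,y⟧
  y- s = S₂.const S₁.X R₂.+ R₂.- (λ i → S₁.const (s i))

  -- G(x,y) = (y - Y)^k F(x,y) with F ∈ K[[x^(1/N),y]].  Since
  -- K[[x^(1/N),y]] ⊆ K[[x^(1/(N * den Y)),y]], only multiples N = den Y * m of
  -- den Y need be considered; G and Y are rewritten as series in x^(1/N).
  PowerDivides : K⟦x,y⟧ → K^fra⟦x⟧ → ℕ → Set (c ⊔ ℓ₁)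
  PowerDivides G Y k =
    ∃[ m ] NonZero m × Σ[ F ∈ K⟦x,y⟧ ]
      S₂.dilate (den Y ℕ.* m) G R₂.≈ (y- S₁.dilate m (coeff Y)) ^₂ k R₂.* F

  IsPositiveRootMultiplicity : K⟦x,y⟧ → K^fra⟦x⟧ → ℕ → Set (c ⊔ ℓ₁)
  IsPositiveRootMultiplicity G Y = IsLargest (PowerDivides G Y)

  -- G(x,y+α).
  translate : (G : K⟦x,y⟧) → IsPolynomialIn-y G → Carrier → K⟦x,y⟧
  translate G poly α i = evaluate (G i) (poly i) (S₁.X R₁.+ S₁.const α)

  IsRootMultiplicity :
    (G : K⟦x,y⟧) → IsPolynomialIn-y G → Carrier → K^fra⟦x⟧ → ℕ → Set (c ⊔ ℓ₁)
  IsRootMultiplicity G poly α Y =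
    IsPositiveRootMultiplicity (translate G poly α) (Y -ᶠ α)

  -- k is the multiplicity of α as a root of the polynomial p (k = 0 when α is
  -- not a root); the zero polynomial has no multiplicity.
  IsPolynomialRootMultiplicity : K⟦t⟧ → Carrier → ℕ → Set (c ⊔ ℓ₁)
  IsPolynomialRootMultiplicity p α = IsLargest λ k →
    Σ[ q ∈ K⟦t⟧ ] IsPolynomial q ×
      p R₁.≈ (S₁.X R₁.+ R₁.- S₁.const α) ^₁ k R₁.* q

  -- The elements of K^fra[[x]] satisfying Root are finitely many and, counted
  -- with the multiplicities given by Mult, there are d of them.  Listing them
  -- without repetition amounts to deciding equality of infinite series, which
  -- is where classical logic is needed.
  record CountWithMultiplicity
    {r m} (Root : K^fra⟦x⟧ → Set r) (Mult : K^fra⟦x⟧ → ℕ → Set m) (d : ℕ)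
    : Set (c ⊔ ℓ₁ ⊔ r ⊔ m) where
    field
      roots          : List (K^fra⟦x⟧ × ℕ)
      areRoots       : All (λ (Y , _) → Root Y) roots
      multiplicities : All (λ (Y , k) → Mult Y k) roots
      distinct       : AllPairs (λ (Y , _) (Z , _) → ¬ Y ≈ᶠ Z) roots
      complete       : ∀ Y → Root Y → Any (λ (Z , _) → Y ≈ᶠ Z) roots
      total          : ListAction.sum (List.map proj₂ roots) ≡ d

{-# OPTIONS --safe #-}

-- A positive root of G of order d ≥ 1 is found by induction on d.  Weierstrass
-- preparation makes G a monic polynomial of degree d in y over K[[x]], and y ↦ y + s(x)
-- removes its term of degree d - 1 (characteristic 0).  If the result is not yᵈ, the
-- substitution x ↦ x^q, y ↦ x^p y along its Newton polygon, of slope p / q, makes it,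
-- at x = 0, a polynomial which is neither yᵈ nor another d-th power (y - α)ᵈ.  Hence it has
-- a root α of multiplicity e with 1 ≤ e < d, and the induction hypothesis applies to its
-- translate by α.
--
-- Division by y - Y then splits off the roots one at a time, so that after a dilation
-- x ↦ x^N the series G is a product of d factors y - Yᵢ and a unit; as K[[x]] is a
-- domain, these are all the roots, even over K[[x^(1/M)]].  A root with constant term α is
-- a positive root of G(x, y + α).

module Submission where

open import Defs
open import Level using (Level; _⊔_; Lift; lift; lower)
open import Algebra.Apartness.Bundles using (HeytingField)
open import Algebra.Bundles using (CommutativeRing)
import Algebra.Morphism.Construct.Identity as Identity
open import Algebra.Morphism.Structures using (IsRingHomomorphism)
import Algebra.Properties.CommutativeSemigroup as CommutativeSemigroupProperties
import Algebra.Properties.Group as GroupProperties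
import Algebra.Properties.Ring as RingProperties
import Algebra.Properties.Semiring.Exp as RingExp
import Algebra.Properties.Semiring.Mult as RingMult
import Algebra.Properties.Semiring.Sum as RingSum
import Algebra.Solver.Ring.NaturalCoefficients.Default as NaturalSolver
open import Algebra.Structures using (IsCommutativeRing)
open import Axiom.ExcludedMiddle using (ExcludedMiddle)
open import Data.Fin.Base as Fin using (toℕ)
open import Data.List.Base as List using (List; []; _∷_)
open import Data.List.Properties using (map-∘)
open import Data.List.Relation.Unary.All as All using (All; []; _∷_)
import Data.List.Relation.Unary.All.Properties as All
open import Data.List.Relation.Unary.AllPairs as AllPairs using (AllPairs; []; _∷_)
import Data.List.Relation.Unary.AllPairs.Properties as AllPairs
open import Data.List.Relation.Unary.Any as Any using (Any; here; there; any?)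
import Data.List.Relation.Unary.Any.Properties as Any
open import Data.Nat.Base as ℕ using (ℕ; zero; suc; _∸_; _≤_; _<_; z≤n; s≤s; z<s; s<s; s<s⁻¹; NonZero)
open import Data.Nat.Divisibility using (_∣_; divides; _∣?_; ∣⇒≤; ∣m+n∣m⇒∣n; n∣m*n)
open import Data.Nat.Induction using (<-wellFounded)
import Data.Nat.ListAction as ListAction
import Data.Nat.Properties as ℕ
open import Data.Product.Base using (_×_; _,_; proj₁; proj₂; ∃-syntax; Σ-syntax)
open import Data.Sum.Base using (_⊎_; inj₁; inj₂)
open import Data.Vec.Base as Vec using (Vec; []; _∷_)
open import Data.Vec.Relation.Unary.All as VecAll using ([]; _∷_) renaming (All to VecAll)
import Data.Vec.Relation.Unary.All.Properties as VecAll
open import Function.Base using (id; _∘_)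
open import Induction.WellFounded using (Acc; acc)
open import Relation.Binary.PropositionalEquality.Core as ≡ using (_≡_)
import Relation.Binary.Reasoning.Setoid as SetoidReasoning
open import Relation.Nullary.Decidable.Core using (Dec; yes; no; map′)
open import Relation.Nullary.Negation.Core using (¬_; contradiction)

-- Substitutions are infinite sums, so their ring laws cannot be read off termwise. All of them, x ↦
-- x^N, y ↦ Y and the two together, satisfy one recursion Φ(f) = ι(f₀) + s Φ(tail f) with s of zero
-- constant term. Since multiplication by s gains one correct coefficient, the recursion determines
-- Φ, makes it a ring homomorphism, and identifies any two maps that obey it.
--
-- The induction for a root runs over the order of G(0, y) for arbitrary series G, not over a
-- degree. After the translation by α the polynomial still has degree d in y; only its order at x =
-- 0 has dropped to e, and Weierstrass preparation turns this order into a degree in the next round.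
--
-- The slope p / q is the least ratio of order to weight among the nonzero coefficients. A
-- coefficient that attains it has a nonzero constant term after rescaling, which excludes yᵈ; the
-- missing term of degree d - 1 excludes (y - α)ᵈ with α ≠ 0, whose coefficient there is -dα.

private variable
  a b c k ℓ m p : Level
  n : ℕ

-- Power series over a commutative ring

module PowerSeries (R : CommutativeRing a ℓ) where
  open CommutativeRing R
  open Series rawRing
  open SetoidReasoning setoid
  open NaturalSolver commutativeSemiring using (solve; _:+_; _:*_; _:=_; con)

  tail : Coefficients → Coefficients
  tail f n = f (suc n)

  infix 4 _≋_ _≈[_]_
  _≋_ : Coefficients → Coefficients → Set ℓ
  f ≋ g = ∀ n → f n ≈ g n

  _≈[_]_ : Coefficients → ℕ → Coefficients → Set ℓ
  f ≈[ n ] g = ∀ i → i < n → f i ≈ g i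

  ≈[]⇒≋ : ∀ {f g} → (∀ n → f ≈[ n ] g) → f ≋ g
  ≈[]⇒≋ p n = p (suc n) n ℕ.≤-refl

  -- The sum defining the product unfolds by computation to f 0 * g (suc n) + (tail f ⊛ g) n; the
  -- proofs about `_⊛_` are inductions along this recursion.
  ⊛-cong[] : ∀ {f f′ g g′} n → f ≈[ suc n ] f′ → g ≈[ suc n ] g′ →
             (f ⊛ g) n ≈ (f′ ⊛ g′) n
  ⊛-cong[] zero    p q = +-congʳ (*-cong (p 0 z<s) (q 0 z<s))
  ⊛-cong[] {f} {f′} {g} {g′} (suc n) p q = +-cong (*-cong (p 0 z<s) (q _ ℕ.≤-refl))
    (⊛-cong[] {tail f} {tail f′} {g} {g′} n (λ i i<n → p (suc i) (s<s i<n)) (λ i i<n → q i (ℕ.m<n⇒m<1+n i<n)))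

  ⊛-cong : ∀ {f f′ g g′} → f ≋ f′ → g ≋ g′ → f ⊛ g ≋ f′ ⊛ g′
  ⊛-cong {f} {f′} {g} {g′} p q n = ⊛-cong[] {f} {f′} {g} {g′} n (λ i _ → p i) (λ i _ → q i)

  -- The term s 0 * f i drops out, so coefficient i of the product sees f only below i. This
  -- contraction takes the place of convergence: it drives every induction on precision that
  -- follows.
  ⊛-raises-precision : ∀ {s f g} n → s 0 ≈ 0# → f ≈[ n ] g → s ⊛ f ≈[ suc n ] s ⊛ g
  ⊛-raises-precision {s} {f} {g} n s₀ p = λ where
      zero    _     → +-congʳ (vanish 0)
      (suc i) i+1<n → +-cong (vanish (suc i))
        (⊛-cong[] {tail s} {tail s} {f} {g} i (λ _ _ → refl) (λ j j<i → p j (ℕ.<-≤-trans j<i (s<s⁻¹ i+1<n))))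
    where
    vanish : ∀ i → s 0 * f i ≈ s 0 * g i
    vanish i = begin
      s 0 * f i  ≈⟨ *-congʳ s₀ ⟩
      0# * f i   ≈⟨ zeroˡ _ ⟩
      0#         ≈⟨ zeroˡ _ ⟨
      0# * g i   ≈⟨ *-congʳ s₀ ⟨
      s 0 * g i  ∎

  ⊛-zeroˡ : ∀ {f} g → (∀ n → f n ≈ 0#) → ∀ n → (f ⊛ g) n ≈ 0#
  ⊛-zeroˡ g f≈0 zero    = trans (+-identityʳ _) (trans (*-congʳ (f≈0 0)) (zeroˡ _))
  ⊛-zeroˡ g f≈0 (suc n) = trans
    (+-cong (trans (*-congʳ (f≈0 0)) (zeroˡ _)) (⊛-zeroˡ g (λ i → f≈0 (suc i)) n))
    (+-identityʳ 0#)

  const-⊛ : ∀ c f n → (const c ⊛ f) n ≈ c * f n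
  const-⊛ c f zero    = +-identityʳ _
  const-⊛ c f (suc n) = trans (+-congˡ (⊛-zeroˡ f (λ _ → refl) n)) (+-identityʳ _)

  ⊛-distribʳ : ∀ h f g n → ((λ i → f i + g i) ⊛ h) n ≈ (f ⊛ h) n + (g ⊛ h) n
  ⊛-distribʳ h f g zero    =
    solve 3 (λ h f g → (f :+ g) :* h :+ con 0 := (f :* h :+ con 0) :+ (g :* h :+ con 0))
      refl (h 0) (f 0) (g 0)
  ⊛-distribʳ h f g (suc n) = trans
    (+-congˡ (⊛-distribʳ h (tail f) (tail g) n))
    (solve 5 (λ h f g u v → (f :+ g) :* h :+ (u :+ v) := (f :* h :+ u) :+ (g :* h :+ v))
      refl (h (suc n)) (f 0) (g 0) ((tail f ⊛ h) n) ((tail g ⊛ h) n))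

  scale-⊛ : ∀ c g h n → ((λ i → c * g i) ⊛ h) n ≈ c * (g ⊛ h) n
  scale-⊛ c g h zero    = begin
    c * g 0 * h 0 + 0#    ≈⟨ +-identityʳ _ ⟩
    c * g 0 * h 0         ≈⟨ *-assoc _ _ _ ⟩
    c * (g 0 * h 0)       ≈⟨ *-congˡ (+-identityʳ _) ⟨
    c * (g 0 * h 0 + 0#)  ∎
  scale-⊛ c g h (suc n) = begin
    c * g 0 * h (suc n) + ((λ i → c * g (suc i)) ⊛ h) n  ≈⟨ +-cong (*-assoc _ _ _) (scale-⊛ c (tail g) h n) ⟩
    c * (g 0 * h (suc n)) + c * (tail g ⊛ h) n           ≈⟨ distribˡ _ _ _ ⟨
    c * (g 0 * h (suc n) + (tail g ⊛ h) n)               ∎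

  ⊛-assoc : ∀ f g h n → ((f ⊛ g) ⊛ h) n ≈ (f ⊛ (g ⊛ h)) n
  ⊛-assoc f g h zero    = +-congʳ (begin
    (f 0 * g 0 + 0#) * h 0    ≈⟨ *-congʳ (+-identityʳ _) ⟩
    f 0 * g 0 * h 0           ≈⟨ *-assoc _ _ _ ⟩
    f 0 * (g 0 * h 0)         ≈⟨ *-congˡ (+-identityʳ _) ⟨
    f 0 * (g 0 * h 0 + 0#)    ∎)
  ⊛-assoc f g h (suc n) = begin
    (f 0 * g 0 + 0#) * h (suc n) + (tail (f ⊛ g) ⊛ h) n
      ≈⟨ +-cong (*-congʳ (+-identityʳ _)) (⊛-distribʳ h (λ i → f 0 * g (suc i)) (tail f ⊛ g) n) ⟩
    f 0 * g 0 * h (suc n) + (((λ i → f 0 * g (suc i)) ⊛ h) n + ((tail f ⊛ g) ⊛ h) n)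
      ≈⟨ +-congˡ (+-cong (scale-⊛ (f 0) (tail g) h n) (⊛-assoc (tail f) g h n)) ⟩
    f 0 * g 0 * h (suc n) + (f 0 * (tail g ⊛ h) n + (tail f ⊛ (g ⊛ h)) n)
      ≈⟨ solve 5 (λ x y z u v → x :* y :* z :+ (x :* u :+ v) := x :* (y :* z :+ u) :+ v)
           refl (f 0) (g 0) (h (suc n)) ((tail g ⊛ h) n) ((tail f ⊛ (g ⊛ h)) n) ⟩
    f 0 * (g 0 * h (suc n) + (tail g ⊛ h) n) + (tail f ⊛ (g ⊛ h)) n
      ∎

  -- The recursion unfolds only the left factor. Unfolding both factors therefore costs two degrees,
  -- which explains the two base cases; the two sides meet in the product of the tails.
  ⊛-comm : ∀ f g n → (f ⊛ g) n ≈ (g ⊛ f) n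
  ⊛-comm f g zero          = +-congʳ (*-comm _ _)
  ⊛-comm f g (suc zero)    =
    solve 4 (λ x y u v → x :* v :+ (y :* u :+ con 0) := u :* y :+ (v :* x :+ con 0))
      refl (f 0) (f 1) (g 0) (g 1)
  ⊛-comm f g (suc (suc n)) = begin
    f 0 * g (2 ℕ.+ n) + (tail f ⊛ g) (suc n)
      ≈⟨ +-congˡ (⊛-comm (tail f) g (suc n)) ⟩
    f 0 * g (2 ℕ.+ n) + (g 0 * f (2 ℕ.+ n) + (tail g ⊛ tail f) n)
      ≈⟨ +-congˡ (+-congˡ (⊛-comm (tail g) (tail f) n)) ⟩
    f 0 * g (2 ℕ.+ n) + (g 0 * f (2 ℕ.+ n) + (tail f ⊛ tail g) n)
      ≈⟨ solve 3 (λ x y z → x :+ (y :+ z) := y :+ (x :+ z)) refl _ _ _ ⟩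
    g 0 * f (2 ℕ.+ n) + (f ⊛ tail g) (suc n)
      ≈⟨ +-congˡ (⊛-comm f (tail g) (suc n)) ⟩
    g 0 * f (2 ℕ.+ n) + (tail g ⊛ f) (suc n)
      ∎

  ⊛-distribˡ : ∀ f g h n → (f ⊛ (λ i → g i + h i)) n ≈ (f ⊛ g) n + (f ⊛ h) n
  ⊛-distribˡ f g h n = trans (⊛-comm f (λ i → g i + h i) n)
    (trans (⊛-distribʳ f g h n) (+-cong (⊛-comm g f n) (⊛-comm h f n)))

  const-0 : ∀ n → const 0# n ≈ 0#
  const-0 zero    = refl
  const-0 (suc n) = refl

  ⊛-identityˡ : ∀ f n → (const 1# ⊛ f) n ≈ f n
  ⊛-identityˡ f n = trans (const-⊛ 1# f n) (*-identityˡ _)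

  -- Kept opaque because unification cannot see through the sums in _⊛_.
  infixl 7 _⊙_
  opaque
    _⊙_ : Coefficients → Coefficients → Coefficients
    _⊙_ = _⊛_

    isCommutativeRing-⊙ :
      IsCommutativeRing _≋_ (λ f g n → f n + g n) _⊙_ (λ f n → - f n) (const 0#) (const 1#)
    isCommutativeRing-⊙ = record
      { isRing = record
        { +-isAbelianGroup = record
          { isGroup = record
            { isMonoid = record
              { isSemigroup = record
                { isMagma = record
                  { isEquivalence = record
                    { refl  = λ _ → refl
                    ; sym   = λ p n → sym (p n)
                    ; trans = λ p q n → trans (p n) (q n)
                    }
                  ; ∙-cong = λ p q n → +-cong (p n) (q n)
                  }
                ; assoc = λ f g h n → +-assoc (f n) (g n) (h n)
                }
              ; identity =
                  (λ f n → trans (+-congʳ (const-0 n)) (+-identityˡ (f n)))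
                , (λ f n → trans (+-congˡ (const-0 n)) (+-identityʳ (f n)))
              }
            ; inverse =
                (λ f n → trans (-‿inverseˡ (f n)) (sym (const-0 n)))
              , (λ f n → trans (-‿inverseʳ (f n)) (sym (const-0 n)))
            ; ⁻¹-cong = λ p n → -‿cong (p n)
            }
          ; comm = λ f g n → +-comm (f n) (g n)
          }
        ; *-cong     = λ {f} {f′} {g} {g′} → ⊛-cong {f} {f′} {g} {g′}
        ; *-assoc    = ⊛-assoc
        ; *-identity = ⊛-identityˡ , λ f n → trans (⊛-comm f (const 1#) n) (⊛-identityˡ f n)
        ; distrib    = ⊛-distribˡ , ⊛-distribʳ
        }
      ; *-comm = ⊛-comm
      }

    ⊙-head : ∀ f g → (f ⊙ g) 0 ≈ f 0 * g 0
    ⊙-head f g = +-identityʳ _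

    ⊙-tail : ∀ f g n → (f ⊙ g) (suc n) ≈ f 0 * g (suc n) + (tail f ⊙ g) n
    ⊙-tail f g n = refl

    const-⊙ : ∀ c f n → (const c ⊙ f) n ≈ c * f n
    const-⊙ = const-⊛

    ⊙-raises-precision : ∀ {s f g} n → s 0 ≈ 0# → f ≈[ n ] g → s ⊙ f ≈[ suc n ] s ⊙ g
    ⊙-raises-precision {s} {f} {g} = ⊛-raises-precision {s} {f} {g}

  powerSeriesRing : CommutativeRing a ℓ
  powerSeriesRing = record { isCommutativeRing = isCommutativeRing-⊙ }

  private module ⟦R⟧ = CommutativeRing powerSeriesRing
  open RingExp ⟦R⟧.semiring using (_^_)

  X-⊙-head : ∀ f → (X ⊙ f) 0 ≈ 0#
  X-⊙-head f = trans (⊙-head X f) (zeroˡ _)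

  X-⊙-suc : ∀ f n → (X ⊙ f) (suc n) ≈ f n
  X-⊙-suc f n = begin
    (X ⊙ f) (suc n)                   ≈⟨ ⊙-tail X f n ⟩
    0# * f (suc n) + (tail X ⊙ f) n   ≈⟨ +-cong (zeroˡ _) (⟦R⟧.*-congʳ {f} tail-X n) ⟩
    0# + (const 1# ⊙ f) n             ≈⟨ +-identityˡ _ ⟩
    (const 1# ⊙ f) n                  ≈⟨ ⟦R⟧.*-identityˡ f n ⟩
    f n                               ∎
    where
    tail-X : tail X ≋ const 1#
    tail-X zero    = refl
    tail-X (suc n) = refl

  head-tail : ∀ f → f ≋ (const (f 0) ⟦R⟧.+ X ⊙ tail f)
  head-tail f zero    = sym (trans (+-congˡ (X-⊙-head (tail f))) (+-identityʳ _))
  head-tail f (suc n) = sym (trans (+-identityˡ _) (X-⊙-suc (tail f) n))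

  X^-⊙-+ : ∀ k f n → (X ^ k ⊙ f) (k ℕ.+ n) ≈ f n
  X^-⊙-+ zero    f n = ⟦R⟧.*-identityˡ f n
  X^-⊙-+ (suc k) f n = trans (⟦R⟧.*-assoc X (X ^ k) f (suc (k ℕ.+ n)))
    (trans (X-⊙-suc _ (k ℕ.+ n)) (X^-⊙-+ k f n))

  X^-⊙-< : ∀ k f {n} → n < k → (X ^ k ⊙ f) n ≈ 0#
  X^-⊙-< (suc k) f {zero}  _   = trans (⟦R⟧.*-assoc X (X ^ k) f 0) (X-⊙-head _)
  X^-⊙-< (suc k) f {suc n} n<k = trans (⟦R⟧.*-assoc X (X ^ k) f (suc n))
    (trans (X-⊙-suc _ n) (X^-⊙-< k f (s<s⁻¹ n<k)))

  X^-factor : ∀ k f → (∀ j → j < k → f j ≈ 0#) → f ≋ X ^ k ⊙ (λ n → f (k ℕ.+ n))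
  X^-factor zero    f _     = ⟦R⟧.sym (⟦R⟧.*-identityˡ f)
  X^-factor (suc k) f small = ⟦R⟧.trans (head-tail f) (⟦R⟧.trans
    (⟦R⟧.+-cong (λ { zero → small 0 z<s ; (suc n) → refl })
                (⟦R⟧.*-congˡ (X^-factor k (tail f) (λ j j<k → small (suc j) (s<s j<k)))))
    (⟦R⟧.trans (⟦R⟧.+-identityˡ _) (⟦R⟧.sym (⟦R⟧.*-assoc X (X ^ k) _))))

-- Ring homomorphisms and the Horner recursion

module _ {A : CommutativeRing a ℓ} {B : CommutativeRing b m} where
  private
    module A = CommutativeRing A
    module B = CommutativeRing B
  open RingProperties B.ring using (x+x≈x⇒x≈0; +-inverseʳ-unique)

  ringHomomorphism : ∀ {φ : A.Carrier → B.Carrier} →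
    (∀ {x y} → x A.≈ y → φ x B.≈ φ y) →
    (∀ x y → φ (x A.+ y) B.≈ φ x B.+ φ y) →
    (∀ x y → φ (x A.* y) B.≈ φ x B.* φ y) →
    φ A.1# B.≈ B.1# →
    IsRingHomomorphism A.rawRing B.rawRing φ
  ringHomomorphism {φ} cong plus times one = record
    { isSemiringHomomorphism = record
      { isNearSemiringHomomorphism = record
        { +-isMonoidHomomorphism = record
          { isMagmaHomomorphism = record
            { isRelHomomorphism = record { cong = cong }
            ; homo              = plus
            }
          ; ε-homo = φ0
          }
        ; *-homo = times
        }
      ; 1#-homo = one
      }
    ; -‿homo = λ x → +-inverseʳ-unique (φ x) (φ (A.- x))
        (B.trans (B.sym (plus x (A.- x))) (B.trans (cong (A.-‿inverseʳ x)) φ0))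
    }
    where
    φ0 : φ A.0# B.≈ B.0#
    φ0 = x+x≈x⇒x≈0 _ (B.trans (B.sym (plus A.0# A.0#)) (cong (A.+-identityˡ A.0#)))

module _ (A : CommutativeRing a ℓ) (B : CommutativeRing b m) where
  IsHom : (CommutativeRing.Carrier A → CommutativeRing.Carrier B) → Set (a ⊔ ℓ ⊔ m)
  IsHom = IsRingHomomorphism (CommutativeRing.rawRing A) (CommutativeRing.rawRing B)

id-isHom : ∀ (A : CommutativeRing a ℓ) → IsHom A A id
id-isHom A = Identity.isRingHomomorphism (CommutativeRing.rawRing A) (CommutativeRing.refl A)

module _ (R : CommutativeRing a ℓ) where
  open CommutativeRing R
  open Series rawRing
  open PowerSeries R

  const-isHom : IsHom R powerSeriesRing const
  const-isHom = ringHomomorphism {A = R} {B = powerSeriesRing}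
    (λ { x≈y zero → x≈y ; x≈y (suc n) → refl })
    (λ { x y zero → refl ; x y (suc n) → sym (+-identityˡ 0#) })
    (λ { x y zero → sym (⊙-head (const x) (const y))
       ; x y (suc n) → sym (trans (const-⊙ x (const y) (suc n)) (zeroʳ x)) })
    (λ _ → refl)

  head-isHom : IsHom powerSeriesRing R (λ f → f 0)
  head-isHom = ringHomomorphism {A = powerSeriesRing} {B = R}
    (λ p → p 0) (λ _ _ → refl) ⊙-head refl

module Rearrangements (A : CommutativeRing a ℓ) where
  open CommutativeRing A
  open NaturalSolver commutativeSemiring using (solve; _:+_; _:*_; _:=_)

  horner-+ : ∀ x y s u v → (x + y) + s * (u + v) ≈ (x + s * u) + (y + s * v)
  horner-+ = solve 5 (λ x y s u v →
    (x :+ y) :+ s :* (u :+ v) := (x :+ s :* u) :+ (y :+ s :* v)) refl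

  horner-scale : ∀ c x s u → c * x + s * (c * u) ≈ c * (x + s * u)
  horner-scale = solve 4 (λ c x s u → c :* x :+ s :* (c :* u) := c :* (x :+ s :* u)) refl

  horner-* : ∀ x y s u v w →
    x * y + s * (x * v + u * w) ≈ x * (y + s * v) + s * u * w
  horner-* = solve 6 (λ x y s u v w →
    x :* y :+ s :* (x :* v :+ u :* w) := x :* (y :+ s :* v) :+ s :* u :* w) refl

  division-step : ∀ w c r x u v → w * c + (r + x * (w * u + v)) ≈ w * (c + x * u) + (r + x * v)
  division-step = solve 6 (λ w c r x u v →
    w :* c :+ (r :+ x :* (w :* u :+ v)) := w :* (c :+ x :* u) :+ (r :+ x :* v)) refl

module Horner {R : CommutativeRing a ℓ} {S : CommutativeRing b m} where
  private
    module R   = CommutativeRing R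
    module S   = CommutativeRing S
    module ⟦R⟧ = CommutativeRing (PowerSeries.powerSeriesRing R)
    module ⟦S⟧ = CommutativeRing (PowerSeries.powerSeriesRing S)
  open Series R.rawRing using (const; X)
  open PowerSeries R using (tail; const-⊙; ⊙-tail; ⊙-head)
  open PowerSeries S using (_≈[_]_; ⊙-raises-precision; ≈[]⇒≋)
  open Rearrangements (PowerSeries.powerSeriesRing S)

  -- The recursion satisfied by Φ(f) = Σⱼ ι(fⱼ) sʲ, which determines Φ when s has
  -- zero constant term; it avoids any mention of infinite sums.
  IsHorner : (R.Carrier → ⟦S⟧.Carrier) → ⟦S⟧.Carrier → (⟦R⟧.Carrier → ⟦S⟧.Carrier) → Set (a ⊔ m)
  IsHorner ι s Φ = ∀ f → Φ f ⟦S⟧.≈ ι (f 0) ⟦S⟧.+ s ⟦S⟧.* Φ (tail f)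

  -- If the values on the tails agree in n coefficients, the factor s makes the values agree in n +
  -- 1. Identities between composed substitutions are later proved by exhibiting the same recursion
  -- on both sides.
  horner-unique : ∀ {ι ι′ s s′ Φ Φ′} → IsHorner ι s Φ → IsHorner ι′ s′ Φ′ →
    (∀ {x y} → x R.≈ y → ι x ⟦S⟧.≈ ι′ y) → s 0 S.≈ S.0# → s ⟦S⟧.≈ s′ →
    ∀ {f g} → f ⟦R⟧.≈ g → Φ f ⟦S⟧.≈ Φ′ g
  horner-unique {ι} {ι′} {s} {s′} {Φ} {Φ′} Φ-horner Φ′-horner ι≈ι′ s₀ s≈s′ f≈g =
    ≈[]⇒≋ (λ n → go n f≈g)
    where
    go : ∀ n {f g} → f ⟦R⟧.≈ g → Φ f ≈[ n ] Φ′ g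
    go (suc n) {f} {g} f≈g i i<n = S.trans (Φ-horner f i) (S.trans
      (S.+-cong (ι≈ι′ (f≈g 0) i) (S.trans
        (⊙-raises-precision n s₀ (go n (λ j → f≈g (suc j))) i i<n)
        (⟦S⟧.*-congʳ {Φ′ (tail g)} s≈s′ i)))
      (S.sym (Φ′-horner g i)))

  module _ {ι s Φ} (ι-hom : IsHom R (PowerSeries.powerSeriesRing S) ι) (s₀ : s 0 S.≈ S.0#)
           (Φ-horner : IsHorner ι s Φ) where
    private
      module ι = IsRingHomomorphism ι-hom

      Φ-cong : ∀ {f g} → f ⟦R⟧.≈ g → Φ f ⟦S⟧.≈ Φ g
      Φ-cong = horner-unique {ι} {ι} Φ-horner Φ-horner ι.⟦⟧-cong s₀ ⟦S⟧.refl

      -- The induction step common to additivity, scaling and multiplicativity: an expression for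
      -- `Φ (tail f)` correct to n places yields one for `Φ f` correct to n + 1.
      refine : ∀ n f {v w} → Φ (tail f) ≈[ n ] v → ι (f 0) ⟦S⟧.+ s ⟦S⟧.* v ⟦S⟧.≈ w →
             Φ f ≈[ suc n ] w
      refine n f p q i i<n = S.trans (Φ-horner f i)
        (S.trans (S.+-congˡ (⊙-raises-precision n s₀ p i i<n)) (q i))

      Φ-+ : ∀ n f g → Φ (f ⟦R⟧.+ g) ≈[ n ] (Φ f ⟦S⟧.+ Φ g)
      Φ-+ (suc n) f g = refine n (f ⟦R⟧.+ g) (Φ-+ n (tail f) (tail g)) (⟦S⟧.trans
        (⟦S⟧.+-congʳ (ι.+-homo (f 0) (g 0))) (⟦S⟧.trans
        (horner-+ (ι (f 0)) (ι (g 0)) s (Φ (tail f)) (Φ (tail g)))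
        (⟦S⟧.sym (⟦S⟧.+-cong (Φ-horner f) (Φ-horner g)))))

      Φ-scale : ∀ n c f → Φ (const c ⟦R⟧.* f) ≈[ n ] (ι c ⟦S⟧.* Φ f)
      Φ-scale (suc n) c f = refine n (const c ⟦R⟧.* f)
        (λ i i<n → S.trans (Φ-cong tail-scale i) (Φ-scale n c (tail f) i i<n)) (⟦S⟧.trans
        (⟦S⟧.+-congʳ (⟦S⟧.trans (ι.⟦⟧-cong (const-⊙ c f 0)) (ι.*-homo c (f 0)))) (⟦S⟧.trans
        (horner-scale (ι c) (ι (f 0)) s (Φ (tail f)))
        (⟦S⟧.*-congˡ (⟦S⟧.sym (Φ-horner f)))))
        where
        tail-scale : tail (const c ⟦R⟧.* f) ⟦R⟧.≈ const c ⟦R⟧.* tail f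
        tail-scale i = R.trans (const-⊙ c f (suc i)) (R.sym (const-⊙ c (tail f) i))

      -- The tail of a product is f 0 * tail g + tail f * g. The first summand is covered exactly by
      -- scaling, so the induction hypothesis is spent only on the second.
      Φ-* : ∀ n f g → Φ (f ⟦R⟧.* g) ≈[ n ] (Φ f ⟦S⟧.* Φ g)
      Φ-* (suc n) f g = refine n (f ⟦R⟧.* g)
        (λ i i<n → S.trans (Φ-cong tail-* i) (S.trans
          (≈[]⇒≋ (λ k → Φ-+ k (const (f 0) ⟦R⟧.* tail g) (tail f ⟦R⟧.* g)) i)
          (S.+-cong (≈[]⇒≋ (λ k → Φ-scale k (f 0) (tail g)) i) (Φ-* n (tail f) g i i<n))))
        (⟦S⟧.trans
        (⟦S⟧.+-congʳ (⟦S⟧.trans (ι.⟦⟧-cong (⊙-head f g)) (ι.*-homo (f 0) (g 0)))) (⟦S⟧.trans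
        (horner-* (ι (f 0)) (ι (g 0)) s (Φ (tail f)) (Φ (tail g)) (Φ g)) (⟦S⟧.trans
        (⟦S⟧.+-congʳ (⟦S⟧.*-congˡ (⟦S⟧.sym (Φ-horner g)))) (⟦S⟧.trans
        (⟦S⟧.sym (⟦S⟧.distribʳ (Φ g) (ι (f 0)) (s ⟦S⟧.* Φ (tail f))))
        (⟦S⟧.*-congʳ (⟦S⟧.sym (Φ-horner f)))))))
        where
        tail-* : tail (f ⟦R⟧.* g) ⟦R⟧.≈ const (f 0) ⟦R⟧.* tail g ⟦R⟧.+ tail f ⟦R⟧.* g
        tail-* i = R.trans (⊙-tail f g i) (R.+-congʳ (R.sym (const-⊙ (f 0) (tail g) i)))

      Φ-zero : ∀ {f} → f ⟦R⟧.≈ ⟦R⟧.0# → Φ f ⟦S⟧.≈ ⟦S⟧.0#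
      Φ-zero {f} f≈0 = x+x≈x⇒x≈0 (Φ f) (⟦S⟧.trans
        (⟦S⟧.sym (≈[]⇒≋ (λ n → Φ-+ n f f)))
        (Φ-cong (⟦R⟧.trans (⟦R⟧.+-congʳ f≈0) (⟦R⟧.+-identityˡ f))))
        where open RingProperties ⟦S⟧.ring using (x+x≈x⇒x≈0)

    horner-const : ∀ c → Φ (const c) ⟦S⟧.≈ ι c
    horner-const c = ⟦S⟧.trans (Φ-horner (const c)) (⟦S⟧.trans
      (⟦S⟧.+-congˡ (⟦S⟧.trans (⟦S⟧.*-congˡ (Φ-zero tail-const)) (⟦S⟧.zeroʳ s)))
      (⟦S⟧.+-identityʳ (ι c)))
      where
      tail-const : tail (const c) ⟦R⟧.≈ ⟦R⟧.0#
      tail-const zero    = R.refl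
      tail-const (suc n) = R.refl

    horner-isHom : IsHom (PowerSeries.powerSeriesRing R) (PowerSeries.powerSeriesRing S) Φ
    horner-isHom = ringHomomorphism
      {A = PowerSeries.powerSeriesRing R} {B = PowerSeries.powerSeriesRing S} Φ-cong
      (λ f g → ≈[]⇒≋ (λ n → Φ-+ n f g)) (λ f g → ≈[]⇒≋ (λ n → Φ-* n f g))
      (⟦S⟧.trans (horner-const R.1#) ι.1#-homo)

    horner-X : Φ X ⟦S⟧.≈ s
    horner-X = ⟦S⟧.trans (Φ-horner X) (⟦S⟧.trans
      (⟦S⟧.+-cong ι.0#-homo (⟦S⟧.trans (⟦S⟧.*-congˡ (⟦S⟧.trans
        (Φ-cong {tail X} {const R.1#} λ { zero → R.refl ; (suc n) → R.refl })
        (⟦S⟧.trans (horner-const R.1#) ι.1#-homo))) (⟦S⟧.*-identityʳ s)))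
      (⟦S⟧.+-identityˡ s))

module _ {A : CommutativeRing a ℓ} {B : CommutativeRing b m} {φ} (φ-hom : IsHom A B φ) where
  private
    module A = CommutativeRing A
    module B = CommutativeRing B
  open IsRingHomomorphism φ-hom
  open RingExp A.semiring using () renaming (_^_ to _^ᴬ_)
  open RingExp B.semiring using () renaming (_^_ to _^ᴮ_)

  ^-homo : ∀ x n → φ (x ^ᴬ n) B.≈ φ x ^ᴮ n
  ^-homo x zero    = 1#-homo
  ^-homo x (suc n) = B.trans (*-homo x (x ^ᴬ n)) (B.*-congˡ (^-homo x n))

-- The substitution of a power of the variable

module Dilation (R : CommutativeRing a ℓ) where
  open CommutativeRing R
  open Series rawRing
  open PowerSeries R
  open RingExp (CommutativeRing.semiring powerSeriesRing) using (_^_; ^-assocʳ)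
  private module ⟦R⟧ = CommutativeRing powerSeriesRing

  dilate-∣ : ∀ N .{{_ : NonZero N}} f k → dilate N f (k ℕ.* N) ≡ f k
  dilate-∣ N f k with N ∣? k ℕ.* N
  ... | yes (divides q kN≡qN) = ≡.cong f (ℕ.*-cancelʳ-≡ q k N (≡.sym kN≡qN))
  ... | no  N∤kN              = contradiction (n∣m*n k) N∤kN

  dilate-∤ : ∀ N f {n} → ¬ N ∣ n → dilate N f n ≡ 0#
  dilate-∤ N f {n} N∤n with N ∣? n
  ... | yes N∣n = contradiction N∣n N∤n
  ... | no  _   = ≡.refl

  X^-head : ∀ N .{{_ : NonZero N}} → (X ^ N) 0 ≈ 0#
  X^-head (suc N) = X-⊙-head _

  open Horner {R = R} {S = R}

  -- Below N only the constant coefficient survives, and from N on N divides N + n exactly when it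
  -- divides n. This recognises `dilate N` as the substitution of X^N, so that its ring laws come
  -- from `horner-isHom`.
  dilate-isHorner : ∀ N .{{_ : NonZero N}} → IsHorner const (X ^ N) (dilate N)
  dilate-isHorner N f n with n ℕ.<? N
  dilate-isHorner N f zero    | yes 0<N = sym (trans (+-congˡ (X^-⊙-< N _ 0<N))
    (trans (+-identityʳ _) (reflexive (≡.sym (dilate-∣ N f 0)))))
  dilate-isHorner N f (suc n) | yes n<N = trans
    (reflexive (dilate-∤ N f (λ N∣n → ℕ.<⇒≱ n<N (∣⇒≤ N∣n))))
    (sym (trans (+-identityˡ _) (X^-⊙-< N _ n<N)))
  dilate-isHorner N f n       | no n≮N = ≡.subst Goal (ℕ.m+[n∸m]≡n (ℕ.≮⇒≥ n≮N)) (at-sum N f (n ∸ N))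
    where
    Goal : ℕ → Set _
    Goal n = dilate N f n ≈ const (f 0) n + (X ^ N ⟦R⟧.* dilate N (tail f)) n

    dilate-+ : ∀ N .{{_ : NonZero N}} f n → dilate N f (N ℕ.+ n) ≈ dilate N (tail f) n
    dilate-+ N f n with N ∣? n
    ... | yes (divides k ≡.refl) = reflexive (dilate-∣ N f (suc k))
    ... | no  N∤n = reflexive (dilate-∤ N f (λ N∣N+n → N∤n (∣m+n∣m⇒∣n N∣N+n (divides 1 (≡.sym (ℕ.+-identityʳ N))))))

    at-sum : ∀ N .{{_ : NonZero N}} f n →
             dilate N f (N ℕ.+ n) ≈ const (f 0) (N ℕ.+ n) + (X ^ N ⟦R⟧.* dilate N (tail f)) (N ℕ.+ n)
    at-sum N@(suc _) f n = trans (dilate-+ N f n)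
      (sym (trans (+-identityˡ _) (X^-⊙-+ N (dilate N (tail f)) n)))

  dilate-isHom : ∀ N .{{_ : NonZero N}} → IsHom powerSeriesRing powerSeriesRing (dilate N)
  dilate-isHom N = horner-isHom (const-isHom R) (X^-head N) (dilate-isHorner N)

  dilate-cong : ∀ N .{{_ : NonZero N}} {f g} → f ⟦R⟧.≈ g → dilate N f ⟦R⟧.≈ dilate N g
  dilate-cong N = IsRingHomomorphism.⟦⟧-cong (dilate-isHom N)

  dilate-X^ : ∀ M .{{_ : NonZero M}} N → dilate M (X ^ N) ⟦R⟧.≈ X ^ (M ℕ.* N)
  dilate-X^ M N = ⟦R⟧.trans (^-homo {A = powerSeriesRing} {B = powerSeriesRing} (dilate-isHom M) X N) (⟦R⟧.trans
    (RingExp.^-congˡ ⟦R⟧.semiring N (horner-X (const-isHom R) (X^-head M) (dilate-isHorner M)))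
    (^-assocʳ X M N))

  dilate-const : ∀ N .{{_ : NonZero N}} c → dilate N (const c) ⟦R⟧.≈ const c
  dilate-const N = horner-const (const-isHom R) (X^-head N) (dilate-isHorner N)

  dilate-dilate : ∀ M N .{{_ : NonZero M}} .{{_ : NonZero N}} .{{_ : NonZero (M ℕ.* N)}} f →
    dilate M (dilate N f) ⟦R⟧.≈ dilate (M ℕ.* N) f
  dilate-dilate M N f = horner-unique {const} {const} {Φ = λ g → dilate M (dilate N g)} {Φ′ = dilate (M ℕ.* N)}
    (λ g → ⟦R⟧.trans (dilate-cong M (dilate-isHorner N g))
      (⟦R⟧.trans (+-homo _ _) (⟦R⟧.+-cong (dilate-const M (g 0)) (*-homo _ _))))
    (dilate-isHorner (M ℕ.* N))
    (λ { x≈y zero → x≈y ; x≈y (suc n) → refl })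
    (trans (dilate-X^ M N 0) (X^-head (M ℕ.* N)))
    (dilate-X^ M N)
    {f} ⟦R⟧.refl
    where open IsRingHomomorphism (dilate-isHom M)

  dilate-1 : ∀ f → dilate 1 f ⟦R⟧.≈ f
  dilate-1 f n = reflexive (≡.trans (≡.cong (dilate 1 f) (≡.sym (ℕ.*-identityʳ n))) (dilate-∣ 1 f n))

  dilate-injective : ∀ N .{{_ : NonZero N}} {f g} → dilate N f ⟦R⟧.≈ dilate N g → f ⟦R⟧.≈ g
  dilate-injective N {f} {g} p n = trans (reflexive (≡.sym (dilate-∣ N f n)))
    (trans (p (n ℕ.* N)) (reflexive (dilate-∣ N g n)))

  dilate-head : ∀ N .{{_ : NonZero N}} f → dilate N f 0 ≈ f 0
  dilate-head N f = reflexive (dilate-∣ N f 0)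

-- Values of polynomials

module PolynomialSum (R : CommutativeRing a ℓ) (S : CommutativeRing b m) where
  private module R = CommutativeRing R
  open CommutativeRing S
  open SetoidReasoning setoid
  open RingSum semiring using (sum; sum-cong-≋; *-distribˡ-sum)
  open RingExp semiring using (_^_)
  open PowerSeries R using (tail)
  open CommutativeSemigroupProperties *-commutativeSemigroup using (x∙yz≈y∙xz)
  open Rearrangements S

  -- The coefficient map φ lets one formula serve for `evaluate`, for the truncations of `compose`
  -- and for values in K itself.
  polySum : (R.Carrier → Carrier) → ℕ → (ℕ → R.Carrier) → Carrier → Carrier
  polySum φ d p s = sum {d} λ j → φ (p (toℕ j)) * s ^ toℕ j

  VanishesFrom : ℕ → (ℕ → R.Carrier) → Set ℓ
  VanishesFrom d p = ∀ j → d ≤ j → p j R.≈ R.0#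

  polySum-suc : ∀ φ d p s → polySum φ (suc d) p s ≈ φ (p 0) + s * polySum φ d (tail p) s
  polySum-suc φ d p s = +-cong (*-identityʳ _) (begin
    sum {d} (λ j → φ (tail p (toℕ j)) * (s * s ^ toℕ j))
      ≈⟨ sum-cong-≋ {d} (λ j → x∙yz≈y∙xz (φ (tail p (toℕ j))) s (s ^ toℕ j)) ⟩
    sum {d} (λ j → s * (φ (tail p (toℕ j)) * s ^ toℕ j))
      ≈⟨ *-distribˡ-sum {d} s (λ j → φ (tail p (toℕ j)) * s ^ toℕ j) ⟨
    s * polySum φ d (tail p) s ∎)

  polySum-cong : ∀ {φ ψ} → (∀ {x y} → x R.≈ y → φ x ≈ ψ y) → ∀ d {p q s t} →
    (∀ j → p j R.≈ q j) → s ≈ t → polySum φ d p s ≈ polySum ψ d q t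
  polySum-cong         φ≈ψ zero    p≈q s≈t = refl
  polySum-cong {φ} {ψ} φ≈ψ (suc d) {p} {q} {s} {t} p≈q s≈t = begin
    polySum φ (suc d) p s                ≈⟨ polySum-suc φ d p s ⟩
    φ (p 0) + s * polySum φ d (tail p) s
      ≈⟨ +-cong (φ≈ψ (p≈q 0)) (*-cong s≈t (polySum-cong φ≈ψ d (λ j → p≈q (suc j)) s≈t)) ⟩
    ψ (q 0) + t * polySum ψ d (tail q) t ≈⟨ polySum-suc ψ d q t ⟨
    polySum ψ (suc d) q t                ∎

  module _ {φ} (φ-hom : IsHom R S φ) where
    private module φ = IsRingHomomorphism φ-hom

    polySum-zero : ∀ d p s → VanishesFrom 0 p → polySum φ d p s ≈ 0#
    polySum-zero zero    p s p≈0 = refl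
    polySum-zero (suc d) p s p≈0 = begin
      polySum φ (suc d) p s                 ≈⟨ polySum-suc φ d p s ⟩
      φ (p 0) + s * polySum φ d (tail p) s  ≈⟨ +-cong (trans (φ.⟦⟧-cong (p≈0 0 z≤n)) φ.0#-homo)
                                                 (*-congˡ (polySum-zero d (tail p) s (λ j _ → p≈0 (suc j) z≤n))) ⟩
      0# + s * 0#                           ≈⟨ +-identityˡ _ ⟩
      s * 0#                                ≈⟨ zeroʳ s ⟩
      0#                                    ∎

    -- The bound that witnesses a polynomial is any bound on its degree, so sums of different
    -- lengths for the same polynomial have to be compared.
    polySum-bound : ∀ {d e} p s → VanishesFrom d p → d ≤ e → polySum φ e p s ≈ polySum φ d p s
    polySum-bound {e = e} p s small z≤n = polySum-zero e p s small
    polySum-bound {suc d} {suc e} p s small (s≤s d≤e) = begin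
      polySum φ (suc e) p s                 ≈⟨ polySum-suc φ e p s ⟩
      φ (p 0) + s * polySum φ e (tail p) s
        ≈⟨ +-congˡ (*-congˡ (polySum-bound (tail p) s (λ j d≤j → small (suc j) (s≤s d≤j)) d≤e)) ⟩
      φ (p 0) + s * polySum φ d (tail p) s  ≈⟨ polySum-suc φ d p s ⟨
      polySum φ (suc d) p s                 ∎

    polySum-horner : ∀ d p s → VanishesFrom d p → polySum φ d p s ≈ φ (p 0) + s * polySum φ d (tail p) s
    polySum-horner d p s small = trans (sym (polySum-bound p s small (ℕ.n≤1+n d))) (polySum-suc φ d p s)

    polySum-+ : ∀ d p q s → polySum φ d (λ j → p j R.+ q j) s ≈ polySum φ d p s + polySum φ d q s
    polySum-+ zero    p q s = sym (+-identityˡ 0#)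
    polySum-+ (suc d) p q s = begin
      polySum φ (suc d) (λ j → p j R.+ q j) s
        ≈⟨ polySum-suc φ d (λ j → p j R.+ q j) s ⟩
      φ (p 0 R.+ q 0) + s * polySum φ d (λ j → tail p j R.+ tail q j) s
        ≈⟨ +-cong (φ.+-homo (p 0) (q 0)) (*-congˡ (polySum-+ d (tail p) (tail q) s)) ⟩
      φ (p 0) + φ (q 0) + s * (polySum φ d (tail p) s + polySum φ d (tail q) s)
        ≈⟨ horner-+ _ _ _ _ _ ⟩
      (φ (p 0) + s * polySum φ d (tail p) s) + (φ (q 0) + s * polySum φ d (tail q) s)
        ≈⟨ +-cong (polySum-suc φ d p s) (polySum-suc φ d q s) ⟨
      polySum φ (suc d) p s + polySum φ (suc d) q s ∎

    polySum-scale : ∀ d c p s → polySum φ d (λ j → c R.* p j) s ≈ φ c * polySum φ d p s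
    polySum-scale zero    c p s = sym (zeroʳ (φ c))
    polySum-scale (suc d) c p s = begin
      polySum φ (suc d) (λ j → c R.* p j) s
        ≈⟨ polySum-suc φ d (λ j → c R.* p j) s ⟩
      φ (c R.* p 0) + s * polySum φ d (λ j → c R.* tail p j) s
        ≈⟨ +-cong (φ.*-homo c (p 0)) (*-congˡ (polySum-scale d c (tail p) s)) ⟩
      φ c * φ (p 0) + s * (φ c * polySum φ d (tail p) s)
        ≈⟨ horner-scale _ _ _ _ ⟩
      φ c * (φ (p 0) + s * polySum φ d (tail p) s)
        ≈⟨ *-congˡ (polySum-suc φ d p s) ⟨
      φ c * polySum φ (suc d) p s ∎

module _ {Q : CommutativeRing a ℓ} {R : CommutativeRing b m} {S : CommutativeRing c k}
         {ψ} (ψ-hom : IsHom R S ψ) where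
  private module S = CommutativeRing S
  open IsRingHomomorphism ψ-hom
  open PolynomialSum

  polySum-hom : ∀ φ d p s → ψ (polySum Q R φ d p s) S.≈ polySum Q S (λ x → ψ (φ x)) d p (ψ s)
  polySum-hom φ zero    p s = 0#-homo
  polySum-hom φ (suc d) p s = S.trans (⟦⟧-cong (polySum-suc Q R φ d p s)) (S.trans (+-homo _ _)
    (S.trans (S.+-congˡ (S.trans (*-homo s _) (S.*-congˡ (polySum-hom φ d (PowerSeries.tail Q p) s))))
    (S.sym (polySum-suc Q S (λ x → ψ (φ x)) d p (ψ s)))))

-- Division in power series rings

module Division (R : CommutativeRing a ℓ) where
  open CommutativeRing R
  open Series rawRing using (const; X)
  open PowerSeries R
  private module ⟦R⟧ = CommutativeRing powerSeriesRing

  module _ (w : ⟦R⟧.Carrier) (q r : Carrier → Carrier)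
           (division : ∀ g → g ≈ w 0 * q g + r g) where

    private
      next : ⟦R⟧.Carrier → ⟦R⟧.Carrier
      next g = tail (g ⟦R⟧.- w ⟦R⟧.* const (q (g 0)))

    -- Long division by w from the lowest coefficient upwards: the constant term is divided by w 0,
    -- the multiple of w is subtracted, and `next` drops the constant term of what is left. Over R =
    -- K[[y]] this becomes Weierstrass division; with r = 0 it inverts a unit.
    quotient remainder : ⟦R⟧.Carrier → ⟦R⟧.Carrier
    quotient g zero    = q (g 0)
    quotient g (suc n) = quotient (next g) n
    remainder g zero    = r (g 0)
    remainder g (suc n) = remainder (next g) n

    remainder-elim : ∀ {P : Carrier → Set p} → (∀ g → P (r g)) → ∀ g n → P (remainder g n)
    remainder-elim         Pr g zero    = Pr (g 0)
    remainder-elim {P = P} Pr g (suc n) = remainder-elim {P = P} Pr (next g) n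

    -- Subtracting w times the constant quotient leaves r (g 0) + X * next g. The factor X turns n
    -- correct coefficients for `next g` into n + 1 for g.
    ⟦division⟧ : ∀ g → g ⟦R⟧.≈ w ⟦R⟧.* quotient g ⟦R⟧.+ remainder g
    ⟦division⟧ g = ≈[]⇒≋ (λ n → go n g)
      where
      module S = SetoidReasoning ⟦R⟧.setoid

      go : ∀ n g → g ≈[ n ] (w ⟦R⟧.* quotient g ⟦R⟧.+ remainder g)
      go (suc n) g i i<n = trans (split i) (trans (+-congˡ (+-congˡ
        (⊙-raises-precision n refl (go n (next g)) i i<n))) (merge i))
        where
        q₀ = const (q (g 0))

        cancel : ∀ x y → x ≈ y + (x - y)
        cancel x y = sym (trans (+-congˡ (+-comm x (- y))) (trans (sym (+-assoc y (- y) x))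
          (trans (+-congʳ (-‿inverseʳ y)) (+-identityˡ x))))

        head : (g ⟦R⟧.- w ⟦R⟧.* q₀) 0 ≈ r (g 0)
        head = +-cancelˡ ((w ⟦R⟧.* q₀) 0) _ _ (trans (sym (cancel (g 0) ((w ⟦R⟧.* q₀) 0)))
          (trans (division (g 0)) (+-congʳ (sym (⊙-head w q₀)))))
          where open RingProperties ring using (+-cancelˡ)

        split : g ⟦R⟧.≈ w ⟦R⟧.* q₀ ⟦R⟧.+ (const (r (g 0)) ⟦R⟧.+ X ⟦R⟧.* next g)
        split = ⟦R⟧.trans (λ i → cancel (g i) ((w ⟦R⟧.* q₀) i))
          (⟦R⟧.+-congˡ (⟦R⟧.trans (head-tail (g ⟦R⟧.- w ⟦R⟧.* q₀))
            (⟦R⟧.+-congʳ λ { zero → head ; (suc _) → refl })))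

        merge : w ⟦R⟧.* q₀ ⟦R⟧.+ (const (r (g 0)) ⟦R⟧.+
                  X ⟦R⟧.* (w ⟦R⟧.* quotient (next g) ⟦R⟧.+ remainder (next g)))
                ⟦R⟧.≈ w ⟦R⟧.* quotient g ⟦R⟧.+ remainder g
        merge = ⟦R⟧.trans
          (division-step w q₀ (const (r (g 0))) X (quotient (next g)) (remainder (next g)))
          (⟦R⟧.sym (⟦R⟧.+-cong (⟦R⟧.*-congˡ (head-tail (quotient g))) (head-tail (remainder g))))
          where open Rearrangements powerSeriesRing

  IsNonZeroDivisor : Carrier → Set _
  IsNonZeroDivisor x = ∀ y → x * y ≈ 0# → y ≈ 0#

  X-nonZeroDivisor : ∀ f → X ⟦R⟧.* f ⟦R⟧.≈ ⟦R⟧.0# → f ⟦R⟧.≈ ⟦R⟧.0#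
  X-nonZeroDivisor f Xf≈0 n = trans (sym (X-⊙-suc f n)) (trans (Xf≈0 (suc n)) (sym (const-0 n)))

  -- The constant term of w f = 0 gives f 0 = 0, hence f = X * tail f; cancelling X gives w * tail f
  -- = 0, and the argument repeats.
  head-nonZeroDivisor : ∀ w → IsNonZeroDivisor (w 0) →
    ∀ f → w ⟦R⟧.* f ⟦R⟧.≈ ⟦R⟧.0# → f ⟦R⟧.≈ ⟦R⟧.0#
  head-nonZeroDivisor w w₀ f wf≈0 n = trans (go n f wf≈0) (sym (const-0 n))
    where
    open CommutativeSemigroupProperties ⟦R⟧.*-commutativeSemigroup using (x∙yz≈y∙xz)

    go : ∀ n f → w ⟦R⟧.* f ⟦R⟧.≈ ⟦R⟧.0# → f n ≈ 0#
    go zero    f wf≈0 = w₀ (f 0) (trans (sym (⊙-head w f)) (wf≈0 0))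
    go (suc n) f wf≈0 = go n (tail f) (X-nonZeroDivisor (w ⟦R⟧.* tail f) (⟦R⟧.trans
      (x∙yz≈y∙xz X w (tail f)) (⟦R⟧.trans
      (⟦R⟧.*-congˡ (⟦R⟧.sym (⟦R⟧.trans (head-tail f) (⟦R⟧.trans
        (⟦R⟧.+-congʳ λ { zero → go 0 f wf≈0 ; (suc _) → refl })
        (⟦R⟧.+-identityˡ _)))))
      wf≈0)))

  invert : ∀ u v → u 0 * v ≈ 1# → ∃[ u⁻¹ ] u ⟦R⟧.* u⁻¹ ⟦R⟧.≈ ⟦R⟧.1#
  invert u v u₀v≈1 = quotient u q r division ⟦R⟧.1# , ⟦R⟧.sym (⟦R⟧.trans
    (⟦division⟧ u q r division ⟦R⟧.1#) (⟦R⟧.trans (⟦R⟧.+-congˡ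
      {u ⟦R⟧.* quotient u q r division ⟦R⟧.1#}
      (λ n → trans (remainder-elim u q r division {P = _≈ 0#} (λ _ → refl) ⟦R⟧.1# n) (sym (const-0 n))))
      (⟦R⟧.+-identityʳ _)))
    where
    q r : Carrier → Carrier
    q g = v * g
    r _ = 0#

    division : ∀ g → g ≈ u 0 * q g + r g
    division g = sym (trans (+-identityʳ _) (trans (sym (*-assoc _ _ _))
      (trans (*-congʳ u₀v≈1) (*-identityˡ g))))

  open RingExp ⟦R⟧.semiring using (_^_)

  truncate : ℕ → ⟦R⟧.Carrier → ⟦R⟧.Carrier
  truncate zero    g n       = 0#
  truncate (suc d) g zero    = g 0
  truncate (suc d) g (suc n) = truncate d (tail g) n

  truncate-≥ : ∀ d g j → d ≤ j → truncate d g j ≈ 0#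
  truncate-≥ zero    g j       _         = refl
  truncate-≥ (suc d) g (suc j) (s≤s d≤j) = truncate-≥ d (tail g) j d≤j

  X^-division : ∀ d g → g ⟦R⟧.≈ X ^ d ⟦R⟧.* (λ n → g (d ℕ.+ n)) ⟦R⟧.+ truncate d g
  X^-division zero    g n       = sym (trans (+-identityʳ _) (⟦R⟧.*-identityˡ g n))
  X^-division (suc d) g zero    = sym (trans (+-congʳ (X^-⊙-< (suc d) _ z<s)) (+-identityˡ _))
  X^-division (suc d) g (suc n) = trans (X^-division d (tail g) n)
    (+-congʳ (sym (trans (⟦R⟧.*-assoc X (X ^ d) _ (suc n)) (X-⊙-suc _ n))))

module WeierstrassDivision (R : CommutativeRing a ℓ) where
  private
    ⟦R⟧-ring = PowerSeries.powerSeriesRing R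
    module R     = CommutativeRing R
    module ⟦R⟧   = CommutativeRing ⟦R⟧-ring
    module ⟦⟦R⟧⟧ = CommutativeRing (PowerSeries.powerSeriesRing ⟦R⟧-ring)
  open Series R.rawRing using (X)
  open RingExp ⟦R⟧.semiring using (_^_)
  open Division R using (truncate; truncate-≥; X^-division)
  open Division ⟦R⟧-ring using (quotient; remainder; remainder-elim; ⟦division⟧)

  -- The inner variable is y, the outer one x. Dividing by w at x = 0, that is by y^d times a unit,
  -- amounts to cutting off the d lowest coefficients; the general long division lifts this to all
  -- powers of x.
  weierstrassDivision : ∀ d w e e⁻¹ → w 0 ⟦R⟧.≈ X ^ d ⟦R⟧.* e → e ⟦R⟧.* e⁻¹ ⟦R⟧.≈ ⟦R⟧.1# →
    ∀ g → ∃[ q ] ∃[ r ] g ⟦⟦R⟧⟧.≈ w ⟦⟦R⟧⟧.* q ⟦⟦R⟧⟧.+ r × (∀ i j → d ≤ j → r i j R.≈ R.0#)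
  weierstrassDivision d w e e⁻¹ w₀≈Xᵈe ee⁻¹≈1 g =
      quotient w q r division g
    , remainder w q r division g
    , ⟦division⟧ w q r division g
    , remainder-elim w q r division {P = λ f → ∀ j → d ≤ j → f j R.≈ R.0#} (truncate-≥ d) g
    where
    q r : ⟦R⟧.Carrier → ⟦R⟧.Carrier
    q f = e⁻¹ ⟦R⟧.* (λ n → f (d ℕ.+ n))
    r   = truncate d

    division : ∀ f → f ⟦R⟧.≈ w 0 ⟦R⟧.* q f ⟦R⟧.+ r f
    division f = ⟦R⟧.trans (X^-division d f) (⟦R⟧.+-congʳ (⟦R⟧.sym (⟦R⟧.trans
      (⟦R⟧.*-congʳ w₀≈Xᵈe) (⟦R⟧.trans
      (⟦R⟧.*-assoc (X ^ d) e (q f)) (⟦R⟧.*-congˡ (⟦R⟧.trans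
      (⟦R⟧.sym (⟦R⟧.*-assoc e e⁻¹ _)) (⟦R⟧.trans
      (⟦R⟧.*-congʳ ee⁻¹≈1) (⟦R⟧.*-identityˡ _))))))))

-- Monic polynomials of degree n, represented by their coefficients of degree < n,
-- lowest first.
module Monic (R : CommutativeRing a ℓ) where
  open CommutativeRing R
  open RingMult semiring using () renaming (_×_ to _·_)

  addConstant : Carrier → Vec Carrier (suc n) → Vec Carrier (suc n)
  addConstant x (y ∷ p) = x + y ∷ p

  mulLinear : Carrier → Vec Carrier n → Vec Carrier (suc n)
  -- The empty vector is the polynomial 1, so the product is y + s, with its leading coefficient
  -- left implicit.
  mulLinear s []      = s ∷ []
  mulLinear s (x ∷ p) = s * x ∷ addConstant x (mulLinear s p)

  -- The low coefficients of p(y + s), by Horner's rule at y + s.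
  shift : Carrier → Vec Carrier n → Vec Carrier n
  shift s []      = []
  shift s (x ∷ p) = addConstant x (mulLinear s (shift s p))

  subleading : Vec Carrier (suc n) → Carrier
  subleading (x ∷ [])    = x
  subleading (_ ∷ y ∷ p) = subleading (y ∷ p)

  subleading-addConstant : ∀ x (p : Vec Carrier (suc (suc n))) →
    subleading (addConstant x p) ≈ subleading p
  subleading-addConstant x (_ ∷ _ ∷ _) = refl

  subleading-mulLinear : ∀ s (p : Vec Carrier (suc n)) → subleading (mulLinear s p) ≈ subleading p + s
  subleading-mulLinear s (x ∷ [])     = refl
  subleading-mulLinear s (x ∷ p@(_ ∷ _)) = trans (lemma (addConstant x (mulLinear s p)))
    (trans (subleading-addConstant x (mulLinear s p)) (subleading-mulLinear s p))
    where
    lemma : ∀ (p : Vec Carrier (suc n)) → subleading (s * x ∷ p) ≈ subleading p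
    lemma (_ ∷ _) = refl

  -- Each Horner step multiplies by a linear factor and thereby adds one s. This serves twice: to
  -- choose s so that the subleading coefficient vanishes, and to see that no α ≠ 0 preserves its
  -- vanishing.
  subleading-shift : ∀ s (p : Vec Carrier (suc n)) → subleading (shift s p) ≈ subleading p + suc n · s
  subleading-shift s (x ∷ [])        = +-congˡ (sym (+-identityʳ s))
  subleading-shift {n = suc n} s (x ∷ p@(_ ∷ _)) = trans
    (subleading-addConstant x (mulLinear s (shift s p))) (trans
    (subleading-mulLinear s (shift s p)) (trans
    (+-congʳ (subleading-shift s p)) (trans (+-assoc _ _ _) (+-congˡ (+-comm _ _)))))

  AllZero : Vec Carrier n → Set _
  AllZero = VecAll (_≈ 0#)

module Evaluation (R : CommutativeRing a ℓ) (S : CommutativeRing b m) where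
  private module R = CommutativeRing R
  open CommutativeRing S
  open SetoidReasoning setoid
  open RingExp semiring using (_^_)
  open Monic R
  open NaturalSolver commutativeSemiring using (solve; _:+_; _:*_; _:=_; con)

  evaluateMonic : (R.Carrier → Carrier) → Vec R.Carrier n → Carrier → Carrier
  evaluateMonic φ []      z = 1#
  evaluateMonic φ (x ∷ p) z = φ x + z * evaluateMonic φ p z

  evaluateMonic-cong : ∀ {φ ψ z w} → (∀ x → φ x ≈ ψ x) → z ≈ w →
    ∀ (p : Vec R.Carrier n) → evaluateMonic φ p z ≈ evaluateMonic ψ p w
  evaluateMonic-cong φ≈ψ z≈w []      = refl
  evaluateMonic-cong φ≈ψ z≈w (x ∷ p) = +-cong (φ≈ψ x) (*-cong z≈w (evaluateMonic-cong φ≈ψ z≈w p))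

  evaluateMonic-allZero : ∀ {φ} (p : Vec R.Carrier n) z → VecAll (λ x → φ x ≈ 0#) p →
    evaluateMonic φ p z ≈ z ^ n
  evaluateMonic-allZero []      z []            = refl
  evaluateMonic-allZero (x ∷ p) z (φx≈0 ∷ φp≈0) = trans
    (+-cong φx≈0 (*-congˡ (evaluateMonic-allZero p z φp≈0))) (+-identityˡ _)

  module _ {φ} (φ-hom : IsHom R S φ) where
    open IsRingHomomorphism φ-hom

    evaluateMonic-addConstant : ∀ x (p : Vec R.Carrier (suc n)) z →
      evaluateMonic φ (addConstant x p) z ≈ φ x + evaluateMonic φ p z
    evaluateMonic-addConstant x (y ∷ p) z = trans (+-congʳ (+-homo x y)) (+-assoc _ _ _)

    evaluateMonic-mulLinear : ∀ s (p : Vec R.Carrier n) z →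
      evaluateMonic φ (mulLinear s p) z ≈ (z + φ s) * evaluateMonic φ p z
    evaluateMonic-mulLinear s [] z =
      solve 2 (λ s z → s :+ z :* con 1 := (z :+ s) :* con 1) refl (φ s) z
    evaluateMonic-mulLinear s (x ∷ p) z = begin
      φ (s R.* x) + z * evaluateMonic φ (addConstant x (mulLinear s p)) z
        ≈⟨ +-cong (*-homo s x) (*-congˡ (trans (evaluateMonic-addConstant x (mulLinear s p) z)
             (+-congˡ (evaluateMonic-mulLinear s p z)))) ⟩
      φ s * φ x + z * (φ x + (z + φ s) * evaluateMonic φ p z)
        ≈⟨ solve 4 (λ s x z e → s :* x :+ z :* (x :+ (z :+ s) :* e) := (z :+ s) :* (x :+ z :* e))
             refl (φ s) (φ x) z (evaluateMonic φ p z) ⟩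
      (z + φ s) * (φ x + z * evaluateMonic φ p z) ∎

    evaluateMonic-shift : ∀ s (p : Vec R.Carrier n) z →
      evaluateMonic φ (shift s p) z ≈ evaluateMonic φ p (z + φ s)
    evaluateMonic-shift s []      z = refl
    evaluateMonic-shift s (x ∷ p) z = begin
      evaluateMonic φ (addConstant x (mulLinear s (shift s p))) z
        ≈⟨ evaluateMonic-addConstant x (mulLinear s (shift s p)) z ⟩
      φ x + evaluateMonic φ (mulLinear s (shift s p)) z
        ≈⟨ +-congˡ (evaluateMonic-mulLinear s (shift s p) z) ⟩
      φ x + (z + φ s) * evaluateMonic φ (shift s p) z
        ≈⟨ +-congˡ (*-congˡ (evaluateMonic-shift s p z)) ⟩
      φ x + (z + φ s) * evaluateMonic φ p (z + φ s) ∎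

module _ {Q : CommutativeRing a ℓ} {R : CommutativeRing b m} {S : CommutativeRing c p}
         {ψ} (ψ-hom : IsHom R S ψ) where
  private
    module Q = CommutativeRing Q
    module R = CommutativeRing R
    module S = CommutativeRing S
  open IsRingHomomorphism ψ-hom
  open Evaluation

  evaluateMonic-hom : ∀ φ (p : Vec Q.Carrier n) z →
    ψ (evaluateMonic Q R φ p z) S.≈ evaluateMonic Q S (ψ ∘ φ) p (ψ z)
  evaluateMonic-hom φ []      z = 1#-homo
  evaluateMonic-hom φ (x ∷ p) z = S.trans (+-homo _ _)
    (S.+-congˡ (S.trans (*-homo _ _) (S.*-congˡ (evaluateMonic-hom φ p z))))

-- Substitution of a series for y

module Substitution {c ℓ₁ ℓ₂} (K : HeytingField c ℓ₁ ℓ₂) where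
  open FractionalSeries K hiding (_^_; module S₂)

  A-ring : CommutativeRing c ℓ₁
  A-ring = PowerSeries.powerSeriesRing K-ring

  B-ring : CommutativeRing c ℓ₁
  B-ring = PowerSeries.powerSeriesRing A-ring

  module K = CommutativeRing K-ring
  module A = CommutativeRing A-ring
  module B = CommutativeRing B-ring
  module S₂ = Series A.rawRing
  module KD = Dilation K-ring
  module AD = Dilation A-ring
  open PowerSeries K-ring using (_≈[_]_; tail; const-⊙; ⊙-raises-precision)
  open RingSum A.semiring using () renaming (sum to sumᴬ)
  open RingSum K.semiring using (sum-cong-≋)
  open RingExp A.semiring using (_^_)
  open PolynomialSum K-ring A-ring using (polySum; polySum-suc)

  private
    sum-pointwise : ∀ {d} t n → sumᴬ {d} t n ≈ sum (λ j → t j n)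
    sum-pointwise {zero}  t n = PowerSeries.const-0 K-ring n
    sum-pointwise {suc d} t n = K.+-congˡ (sum-pointwise {d} (λ j → t (Fin.suc j)) n)

    opaque
      unfolding PowerSeries._⊙_
      compose-def : ∀ h s n → compose h s n ≡ sum {suc n} (λ j → h (toℕ j) * (s ^ toℕ j) n)
      compose-def h s n = ≡.refl

    compose-polySum-exact : ∀ h s n → compose h s n ≈ polySum S₁.const (suc n) h s n
    compose-polySum-exact h s n = K.trans (K.reflexive (compose-def h s n)) (K.sym (K.trans
      (sum-pointwise {suc n} (λ j → S₁.const (h (toℕ j)) A.* s ^ toℕ j) n)
      (sum-cong-≋ {suc n} (λ j → const-⊙ (h (toℕ j)) (s ^ toℕ j) n))))

    polySum-precision : ∀ {d e s} → s 0 ≈ 0# → d ≤ e → ∀ h →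
      polySum S₁.const e h s ≈[ d ] polySum S₁.const d h s
    polySum-precision s₀ z≤n h i ()
    polySum-precision {suc d} {suc e} {s} s₀ (s≤s d≤e) h i i<d =
      K.trans (polySum-suc S₁.const e h s i) (K.trans
        (K.+-congˡ (⊙-raises-precision d s₀ (polySum-precision s₀ d≤e (tail h)) i i<d))
        (K.sym (polySum-suc S₁.const d h s i)))

    compose-polySum : ∀ {s} → s 0 ≈ 0# → ∀ d h → compose h s ≈[ d ] polySum S₁.const d h s
    compose-polySum {s} s₀ d h i i<d = K.trans (compose-polySum-exact h s i)
      (K.sym (polySum-precision s₀ i<d h i ℕ.≤-refl))

  -- `compose` cuts its sum at a length that depends on the coefficient, so the recursion is not
  -- literal. Sums of fixed length satisfy it, and they agree with `compose` up to that length
  -- because s^j starts in degree j.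
  compose-isHorner : ∀ s → s 0 ≈ 0# → Horner.IsHorner {R = K-ring} {S = K-ring} S₁.const s (λ h → compose h s)
  compose-isHorner s s₀ h n = K.trans (compose-polySum-exact h s n) (K.trans
    (polySum-suc S₁.const n h s n) (K.+-congˡ (⊙-raises-precision n s₀
      (λ i i<n → K.sym (compose-polySum s₀ n (tail h) i i<n)) n ℕ.≤-refl)))

  compose-isHom : ∀ s → s 0 ≈ 0# → IsHom A-ring A-ring (λ h → compose h s)
  compose-isHom s s₀ = Horner.horner-isHom (const-isHom K-ring) s₀ (compose-isHorner s s₀)

  -- Setting the outer variable equal to the inner one is again a substitution, with identity
  -- coefficient map and s = t.
  diagonal-isHorner : Horner.IsHorner {R = A-ring} {S = K-ring} id S₁.X diagonal
  diagonal-isHorner f zero    = K.+-congˡ (K.sym (PowerSeries.X-⊙-head K-ring _))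
  diagonal-isHorner f (suc n) = K.+-congˡ (K.sym (PowerSeries.X-⊙-suc K-ring _ n))

  diagonal-isHom : IsHom B-ring A-ring diagonal
  diagonal-isHom = Horner.horner-isHom (id-isHom A-ring) K.refl diagonal-isHorner

  private
    diagonal-dilate : ∀ N .{{_ : NonZero N}} (f : ℕ → K⟦t⟧) →
      diagonal (S₂.dilate N f) A.≈ f 0 A.+ S₁.X ^ N A.* diagonal (S₂.dilate N (λ i → f (suc i)))
    diagonal-dilate N f = A.trans
      (⟦⟧-cong (Dilation.dilate-isHorner A-ring N f)) (A.trans
      (+-homo (S₂.const (f 0)) (Xᴺ B.* f′)) (A.+-cong
      {diagonal (S₂.const (f 0))} {f 0} {diagonal (Xᴺ B.* f′)} {S₁.X ^ N A.* diagonal f′}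
      (Horner.horner-const {R = A-ring} {S = K-ring} (id-isHom A-ring) K.refl diagonal-isHorner (f 0)) (A.trans
      (*-homo Xᴺ f′) (A.*-congʳ {diagonal f′} {diagonal Xᴺ} {S₁.X ^ N}
        (A.trans (^-homo {A = B-ring} {B = A-ring} diagonal-isHom S₂.X N)
        (RingExp.^-congˡ A.semiring N {diagonal S₂.X} {S₁.X}
          (Horner.horner-X {R = A-ring} {S = K-ring} (id-isHom A-ring) K.refl diagonal-isHorner)))))))
      where
      open IsRingHomomorphism diagonal-isHom
      Xᴺ f′ : K⟦x,y⟧
      Xᴺ = RingExp._^_ B.semiring S₂.X N
      f′ = S₂.dilate N (λ i → f (suc i))

  opaque
    -- The substitution x ↦ t^N, y ↦ Y. Keeping N apart from Y allows the same series to be read at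
    -- different levels x^(1/N).
    substituteᵗ : ℕ → K⟦t⟧ → K⟦x,y⟧ → K⟦t⟧
    substituteᵗ N Y G = diagonal (S₂.dilate N λ i → compose (G i) Y)

  module _ (N : ℕ) .{{_ : NonZero N}} (Y : K⟦t⟧) (Y₀ : Y 0 ≈ 0#) where

    opaque
      unfolding substituteᵗ
      substituteᵗ-isHorner : Horner.IsHorner {R = A-ring} {S = K-ring} (λ g → compose g Y) (S₁.X ^ N) (substituteᵗ N Y)
      substituteᵗ-isHorner G = diagonal-dilate N (λ i → compose (G i) Y)

    substituteᵗ-isHom : IsHom B-ring A-ring (substituteᵗ N Y)
    substituteᵗ-isHom = Horner.horner-isHom {R = A-ring} {S = K-ring} {ι = λ g → compose g Y}
      (compose-isHom Y Y₀) (Dilation.X^-head K-ring N) substituteᵗ-isHorner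

    substituteᵗ-const : ∀ g → substituteᵗ N Y (S₂.const g) A.≈ compose g Y
    substituteᵗ-const = Horner.horner-const {R = A-ring} {S = K-ring} {ι = λ g → compose g Y}
      (compose-isHom Y Y₀) (Dilation.X^-head K-ring N) substituteᵗ-isHorner

    substituteᵗ-X : substituteᵗ N Y S₂.X A.≈ S₁.X ^ N
    substituteᵗ-X = Horner.horner-X {R = A-ring} {S = K-ring} {ι = λ g → compose g Y}
      (compose-isHom Y Y₀) (Dilation.X^-head K-ring N) substituteᵗ-isHorner

    substituteᵗ-y : substituteᵗ N Y (S₂.const S₁.X) A.≈ Y
    substituteᵗ-y = A.trans (substituteᵗ-const S₁.X)
      (Horner.horner-X {R = K-ring} {S = K-ring} {ι = S₁.const} (const-isHom K-ring) Y₀ (compose-isHorner Y Y₀))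

-- Change of the level x^(1/N), and the factor theorem

module Roots {c ℓ₁ ℓ₂} (K : HeytingField c ℓ₁ ℓ₂) where
  open Substitution K
  open FractionalSeries K using (module S₁; K⟦t⟧; K⟦x,y⟧; _≈_; 0#; 1#; _+_; _*_; -_; compose; K-ring)
  open PowerSeries K-ring using (tail)
  open RingExp A.semiring using (_^_; ^-assocʳ)
  open RingProperties A.ring using (-0#≈0#)
  private
    module H = Horner {R = K-ring} {S = K-ring}
    module H₂ = Horner {R = A-ring} {S = K-ring}

  substituteᵗ-cong : ∀ N .{{_ : NonZero N}} Y Z → Y 0 ≈ 0# → Y A.≈ Z →
    ∀ {G H} → G B.≈ H → substituteᵗ N Y G A.≈ substituteᵗ N Z H
  substituteᵗ-cong N Y Z Y₀ Y≈Z = H₂.horner-unique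
    {λ g → compose g Y} {λ g → compose g Z}
    (substituteᵗ-isHorner N Y Y₀) (substituteᵗ-isHorner N Z (K.trans (K.sym (Y≈Z 0)) Y₀))
    (H.horner-unique {S₁.const} {S₁.const} (compose-isHorner Y Y₀) (compose-isHorner Z (K.trans (K.sym (Y≈Z 0)) Y₀))
      (IsRingHomomorphism.⟦⟧-cong (const-isHom K-ring)) Y₀ Y≈Z)
    (Dilation.X^-head K-ring N) A.refl

  compose-dilate : ∀ M .{{_ : NonZero M}} Y → Y 0 ≈ 0# → ∀ {g h} → g A.≈ h →
    S₁.dilate M (compose g Y) A.≈ compose h (S₁.dilate M Y)
  compose-dilate M Y Y₀ = H.horner-unique {S₁.const} {S₁.const} {S₁.dilate M Y} {S₁.dilate M Y}
    {λ g → S₁.dilate M (compose g Y)} {λ g → compose g (S₁.dilate M Y)}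
    (λ g → A.trans (KD.dilate-cong M (compose-isHorner Y Y₀ g)) (A.trans (+-homo _ _)
      (A.+-cong (KD.dilate-const M (g 0)) (*-homo Y (compose (tail g) Y)))))
    (compose-isHorner (S₁.dilate M Y) MY₀)
    (IsRingHomomorphism.⟦⟧-cong (const-isHom K-ring)) MY₀ A.refl
    where
    open IsRingHomomorphism (Dilation.dilate-isHom K-ring M)
    MY₀ : S₁.dilate M Y 0 ≈ 0#
    MY₀ = K.trans (KD.dilate-head M Y) Y₀

  dilate-substituteᵗ : ∀ M N .{{_ : NonZero M}} .{{_ : NonZero N}} .{{_ : NonZero (M ℕ.* N)}} Y → Y 0 ≈ 0# →
    ∀ G → S₁.dilate M (substituteᵗ N Y G) A.≈ substituteᵗ (M ℕ.* N) (S₁.dilate M Y) G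
  dilate-substituteᵗ M N Y Y₀ G = H₂.horner-unique
    {λ g → S₁.dilate M (compose g Y)} {λ g → compose g (S₁.dilate M Y)} {S₁.dilate M (S₁.X ^ N)}
    {Φ = λ G → S₁.dilate M (substituteᵗ N Y G)} {Φ′ = substituteᵗ (M ℕ.* N) (S₁.dilate M Y)}
    (λ G → A.trans (KD.dilate-cong M (substituteᵗ-isHorner N Y Y₀ G)) (A.trans (+-homo _ _)
      (A.+-congˡ (*-homo _ _))))
    (substituteᵗ-isHorner (M ℕ.* N) (S₁.dilate M Y) (K.trans (KD.dilate-head M Y) Y₀))
    (compose-dilate M Y Y₀)
    (K.trans (KD.dilate-head M (S₁.X ^ N)) (Dilation.X^-head K-ring N))
    (KD.dilate-X^ M N) {G} B.refl
    where open IsRingHomomorphism (Dilation.dilate-isHom K-ring M)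

  -- This turns a root of G in x^(1/N) into an ordinary power series root of G(x^N, y), to which
  -- division by y - Y applies.
  substituteᵗ-dilate : ∀ M N .{{_ : NonZero M}} .{{_ : NonZero N}} .{{_ : NonZero (M ℕ.* N)}} Y → Y 0 ≈ 0# →
    ∀ G → substituteᵗ M Y (S₂.dilate N G) A.≈ substituteᵗ (M ℕ.* N) Y G
  substituteᵗ-dilate M N Y Y₀ G = H₂.horner-unique
    {λ g → substituteᵗ M Y (S₂.const g)} {λ g → compose g Y} {substituteᵗ M Y (RingExp._^_ B.semiring S₂.X N)}
    {Φ = λ G → substituteᵗ M Y (S₂.dilate N G)} {Φ′ = substituteᵗ (M ℕ.* N) Y}
    (λ G → A.trans (⟦⟧-cong (Dilation.dilate-isHorner A-ring N G)) (A.trans (+-homo _ _)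
      (A.+-congˡ (*-homo _ _))))
    (substituteᵗ-isHorner (M ℕ.* N) Y Y₀)
    (λ {g} g≈h → A.trans (substituteᵗ-const M Y Y₀ g) (IsRingHomomorphism.⟦⟧-cong (compose-isHom Y Y₀) g≈h))
    (K.trans (power 0) (Dilation.X^-head K-ring (M ℕ.* N)))
    power {G} B.refl
    where
    open IsRingHomomorphism (substituteᵗ-isHom M Y Y₀)
    power : substituteᵗ M Y (RingExp._^_ B.semiring S₂.X N) A.≈ S₁.X ^ (M ℕ.* N)
    power = A.trans (^-homo {A = B-ring} {B = A-ring} (substituteᵗ-isHom M Y Y₀) S₂.X N) (A.trans
      (RingExp.^-congˡ A.semiring N (substituteᵗ-X M Y Y₀)) (^-assocʳ S₁.X M N))

  inX : K⟦t⟧ → K⟦x,y⟧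
  inX f i = S₁.const (f i)

  y : K⟦x,y⟧
  y = S₂.const S₁.X

  infix 8 y-_
  y-_ : K⟦t⟧ → K⟦x,y⟧
  y- s = y B.- inX s

  substituteᵗ-inX : ∀ N .{{_ : NonZero N}} Y → Y 0 ≈ 0# → ∀ f → substituteᵗ N Y (inX f) A.≈ S₁.dilate N f
  substituteᵗ-inX N Y Y₀ f = H.horner-unique {S₁.const} {S₁.const} {S₁.X ^ N} {S₁.X ^ N}
    {λ f → substituteᵗ N Y (inX f)} {S₁.dilate N}
    (λ f → A.trans (substituteᵗ-isHorner N Y Y₀ (inX f))
      (A.+-congʳ (H.horner-const (const-isHom K-ring) Y₀ (compose-isHorner Y Y₀) (f 0))))
    (Dilation.dilate-isHorner K-ring N)
    (IsRingHomomorphism.⟦⟧-cong (const-isHom K-ring)) (Dilation.X^-head K-ring N) A.refl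
    {f} A.refl

  substituteᵗ-head : ∀ N .{{_ : NonZero N}} Y → Y 0 ≈ 0# → ∀ G → substituteᵗ N Y G 0 ≈ G 0 0
  substituteᵗ-head N Y Y₀ G = K.trans (substituteᵗ-isHorner N Y Y₀ G 0) (K.trans (K.+-cong
    (K.trans (compose-isHorner Y Y₀ (G 0) 0) (K.trans (K.+-congˡ (vanish Y₀)) (K.+-identityʳ _)))
    (vanish (Dilation.X^-head K-ring N))) (K.+-identityʳ _))
    where
    vanish : ∀ {s f} → s 0 ≈ 0# → (s A.* f) 0 ≈ 0#
    vanish {s} {f} s₀ = K.trans (PowerSeries.⊙-head K-ring s f) (K.trans (K.*-congʳ s₀) (K.zeroˡ _))

  substituteᵗ-y- : ∀ N .{{_ : NonZero N}} Y → Y 0 ≈ 0# → ∀ s →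
    substituteᵗ N Y (y- s) A.≈ Y A.- S₁.dilate N s
  substituteᵗ-y- N Y Y₀ s = A.trans (+-homo y (B.- inX s)) (A.+-cong (substituteᵗ-y N Y Y₀)
    (A.trans (-‿homo (inX s)) (A.-‿cong (substituteᵗ-inX N Y Y₀ s))))
    where open IsRingHomomorphism (substituteᵗ-isHom N Y Y₀)

  substituteᵗ-self : ∀ Y → Y 0 ≈ 0# → substituteᵗ 1 Y (y- Y) A.≈ A.0#
  substituteᵗ-self Y Y₀ = A.trans (substituteᵗ-y- 1 Y Y₀ Y)
    (A.trans (A.+-congˡ {Y} (A.-‿cong (KD.dilate-1 Y))) (A.-‿inverseʳ Y))

  const-cong : ∀ {x z} → x ≈ z → S₁.const x A.≈ S₁.const z
  const-cong = IsRingHomomorphism.⟦⟧-cong (const-isHom K-ring)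

  const-zero : ∀ {x} → x ≈ 0# → S₁.const x A.≈ A.0#
  const-zero = const-cong

  y--head : ∀ Y → Y 0 ≈ 0# → (y- Y) 0 A.≈ S₁.X
  y--head Y Y₀ = A.trans (A.+-congˡ {S₁.X} (A.trans (A.-‿cong (const-zero Y₀)) -0#≈0#)) (A.+-identityʳ S₁.X)

  -- At x = 0 the factor is y, which cancels in K[[y]], and cancellation lifts from the constant
  -- term in x.
  y--cancel : ∀ Y → Y 0 ≈ 0# → ∀ {F} → y- Y B.* F B.≈ B.0# → F B.≈ B.0#
  y--cancel Y Y₀ {F} = Division.head-nonZeroDivisor A-ring (y- Y)
    (λ f p → Division.X-nonZeroDivisor K-ring f (A.trans (A.*-congʳ {f} (A.sym (y--head Y Y₀))) p)) F

  y--cong : ∀ {Y Z} → Y A.≈ Z → y- Y B.≈ y- Z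
  y--cong {Y} {Z} p = B.+-congˡ {y} (B.-‿cong (λ i → const-cong (p i)))

  dilate-y- : ∀ M .{{_ : NonZero M}} s → S₂.dilate M (y- s) B.≈ y- S₁.dilate M s
  dilate-y- M s = B.trans (+-homo y (B.- inX s)) (B.+-cong (AD.dilate-const M S₁.X)
    (B.trans (-‿homo (inX s)) (B.-‿cong dilate-inX)))
    where
    open IsRingHomomorphism (Dilation.dilate-isHom A-ring M)
    dilate-inX : S₂.dilate M (inX s) B.≈ inX (S₁.dilate M s)
    dilate-inX n with M ∣? n
    ... | yes _ = A.refl
    ... | no  _ = A.refl

  y--division : ∀ Y → Y 0 ≈ 0# → ∀ G →
    ∃[ F ] ∃[ r ] G B.≈ y- Y B.* F B.+ r × (∀ i j → 1 ≤ j → r i j ≈ 0#)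
  y--division Y Y₀ = WeierstrassDivision.weierstrassDivision K-ring 1 (y- Y) A.1# A.1#
    (A.trans (y--head Y Y₀) (A.sym (A.trans (A.*-identityʳ (S₁.X ^ 1)) (A.*-identityʳ S₁.X))))
    (A.*-identityʳ A.1#)

  -- A remainder free of y is its own value at y = Y, while the multiple of y - Y contributes 0.
  -- This is the core of the factor theorem in K[[x,y]].
  remainder-zero : ∀ Y → Y 0 ≈ 0# → ∀ F r → (∀ i j → 1 ≤ j → r i j ≈ 0#) →
    substituteᵗ 1 Y (y- Y B.* F B.+ r) A.≈ A.0# → r B.≈ B.0#
  remainder-zero Y Y₀ F r small root = B.trans r≈ λ where
      zero    → const-zero (v≈0 0)
      (suc i) → const-zero (K.trans (v≈0 (suc i)) K.refl)
    where
    open IsRingHomomorphism (substituteᵗ-isHom 1 Y Y₀)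
    v : K⟦t⟧
    v i = r i 0
    r≈ : r B.≈ inX v
    r≈ i zero    = K.refl
    r≈ i (suc j) = small i (suc j) (s≤s z≤n)
    multiple≈0 : substituteᵗ 1 Y (y- Y B.* F) A.≈ A.0#
    multiple≈0 = A.trans (*-homo (y- Y) F)
      (A.trans (A.*-congʳ (substituteᵗ-self Y Y₀)) (A.zeroˡ (substituteᵗ 1 Y F)))
    r↦v : substituteᵗ 1 Y r A.≈ v
    r↦v = A.trans (⟦⟧-cong r≈) (A.trans (substituteᵗ-inX 1 Y Y₀ v) (KD.dilate-1 v))
    v≈0 : ∀ i → v i ≈ 0#
    v≈0 i = K.trans (A.sym (A.trans (A.sym root) (A.trans (+-homo (y- Y B.* F) r)
      (A.trans (A.+-cong multiple≈0 r↦v) (A.+-identityˡ v)))) i) (PowerSeries.const-0 K-ring i)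

  root⇒divisible : ∀ Y → Y 0 ≈ 0# → ∀ G → substituteᵗ 1 Y G A.≈ A.0# → ∃[ F ] G B.≈ y- Y B.* F
  root⇒divisible Y Y₀ G root = conclude (y--division Y Y₀ G)
    where
    open IsRingHomomorphism (substituteᵗ-isHom 1 Y Y₀)
    conclude : ∃[ F ] ∃[ r ] G B.≈ y- Y B.* F B.+ r × (∀ i j → 1 ≤ j → r i j ≈ 0#) →
               ∃[ F ] G B.≈ y- Y B.* F
    conclude (F , r , G≈ , small) = F , B.trans G≈ (B.trans
      (B.+-congˡ {y- Y B.* F} (remainder-zero Y Y₀ F r small (A.trans (⟦⟧-cong (B.sym G≈)) root)))
      (B.+-identityʳ (y- Y B.* F)))

-- Power series over a field, with excluded middle

module ClassicalField {c ℓ₁ ℓ₂} (em : ExcludedMiddle (c ⊔ ℓ₁ ⊔ ℓ₂)) (K : HeytingField c ℓ₁ ℓ₂) where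
  open Substitution K using (module A; module K)
  open FractionalSeries K
    using (module S₁; K⟦t⟧; _≈_; _≉_; 0#; 1#; _+_; _*_; _-_; -_; K-ring; _·_; IsOrder
        ; CharacteristicZero)
  open PowerSeries K-ring using (tail; X^-factor; X^-⊙-+; const-0)
  open RingExp A.semiring using (_^_)
  open Division K-ring using (IsNonZeroDivisor)

  decide : (P : Set ℓ₁) → Dec P
  decide P = map′ lower lift (em {Lift (c ⊔ ℓ₂) P})

  decideEquality : (f g : K⟦t⟧) → Dec (f A.≈ g)
  decideEquality f g = decide (f A.≈ g)

  -- A Heyting field inverts what is apart from 0. Tightness shows that x ≉ 0 refutes the negation
  -- of x # 0, and excluded middle removes the double negation.
  inverse : ∀ x → x ≉ 0# → ∃[ x⁻¹ ] x * x⁻¹ ≈ 1#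
  inverse x x≉0 with em {Lift (c ⊔ ℓ₁) (HeytingField._#_ K x 0#)}
  ... | no ¬x#0 = contradiction (proj₁ (HeytingField.tight K x 0#) (λ x#0 → ¬x#0 (lift x#0))) x≉0
  ... | yes (lift x#0) with HeytingField.#⇒invertible K x#0
  ...   | x⁻¹ , _ , [x-0]x⁻¹≈1 = x⁻¹ , K.trans (K.*-congʳ (K.sym x-0≈x)) [x-0]x⁻¹≈1
    where
    open RingProperties K.ring using (-0#≈0#)
    x-0≈x : x - 0# ≈ x
    x-0≈x = K.trans (K.+-congˡ -0#≈0#) (K.+-identityʳ x)

  nonZeroDivisor : ∀ {x} → x ≉ 0# → IsNonZeroDivisor x
  nonZeroDivisor {x} x≉0 z xz≈0 with inverse x x≉0
  ... | x⁻¹ , xx⁻¹≈1 = begin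
    z              ≈⟨ K.*-identityˡ z ⟨
    1# * z         ≈⟨ K.*-congʳ xx⁻¹≈1 ⟨
    x * x⁻¹ * z    ≈⟨ K.*-congʳ (K.*-comm x x⁻¹) ⟩
    x⁻¹ * x * z    ≈⟨ K.*-assoc x⁻¹ x z ⟩
    x⁻¹ * (x * z)  ≈⟨ K.*-congˡ xz≈0 ⟩
    x⁻¹ * 0#       ≈⟨ K.zeroʳ x⁻¹ ⟩
    0#             ∎
    where open SetoidReasoning K.setoid

  order : ∀ n (f : K⟦t⟧) → f n ≉ 0# → ∃[ d ] IsOrder f d
  order n f fₙ≉0 with decide (f 0 ≈ 0#)
  order n       f fₙ≉0 | no  f₀≉0 = 0 , f₀≉0 , λ _ ()
  order zero    f fₙ≉0 | yes f₀≈0 = contradiction f₀≈0 fₙ≉0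
  order (suc n) f fₙ≉0 | yes f₀≈0 with order n (tail f) fₙ≉0
  ... | d , f_d≉0 , small = suc d , f_d≉0 , λ where
    zero    _         → f₀≈0
    (suc j) (s≤s j<d) → small j j<d

  zeroOrOrder : ∀ f → f A.≈ A.0# ⊎ ∃[ d ] IsOrder f d
  zeroOrOrder f with decide (∃[ n ] f n ≉ 0#)
  ... | yes (n , fₙ≉0) = inj₂ (order n f fₙ≉0)
  ... | no  ∄n         = inj₁ λ n → K.trans (zero-at n) (K.sym (const-0 n))
    where
    zero-at : ∀ n → f n ≈ 0#
    zero-at n with decide (f n ≈ 0#)
    ... | yes fₙ≈0 = fₙ≈0
    ... | no  fₙ≉0 = contradiction (n , fₙ≉0) ∄n

  order-cong : ∀ {f g d} → f A.≈ g → IsOrder f d → IsOrder g d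
  order-cong {d = d} f≈g (f_d≉0 , small) =
    (λ g_d≈0 → f_d≉0 (K.trans (f≈g d) g_d≈0)) , λ j j<d → K.trans (K.sym (f≈g j)) (small j j<d)

  at-order : ∀ (f : K⟦t⟧) d → f d ≉ 0# → f (d ℕ.+ 0) ≉ 0#
  at-order f d = ≡.subst (λ n → f n ≉ 0#) (≡.sym (ℕ.+-identityʳ d))

  -- By its order f is t^d u with u 0 ≠ 0; t^d cancels by shifting coefficients and u by its
  -- constant term. That K[[t]] is a domain keeps a product of linear factors from acquiring further
  -- roots.
  series-nonZeroDivisor : ∀ {f} → ¬ f A.≈ A.0# → ∀ g → f A.* g A.≈ A.0# → g A.≈ A.0#
  series-nonZeroDivisor {f} f≉0 g fg≈0 = lemma (zeroOrOrder f)
    where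
    lemma : f A.≈ A.0# ⊎ ∃[ d ] IsOrder f d → g A.≈ A.0#
    lemma (inj₁ f≈0)                 = contradiction f≈0 f≉0
    lemma (inj₂ (d , f_d≉0 , small)) = Division.head-nonZeroDivisor K-ring u
      (nonZeroDivisor (at-order f d f_d≉0)) g λ n →
        K.trans (K.sym (X^-⊙-+ d (u A.* g) n)) (K.trans (factored (d ℕ.+ n)) (K.trans (const-0 (d ℕ.+ n)) (K.sym (const-0 n))))
      where
      u : K⟦t⟧
      u n = f (d ℕ.+ n)
      factored : S₁.X ^ d A.* (u A.* g) A.≈ A.0#
      factored = A.trans (A.sym (A.*-assoc (S₁.X ^ d) u g))
        (A.trans (A.*-congʳ (A.sym (X^-factor d f small))) fg≈0)

  head-nonZero : ∀ {f : K⟦t⟧} → f 0 ≉ 0# → ¬ f A.≈ A.0#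
  head-nonZero f₀≉0 f≈0 = f₀≉0 (f≈0 0)

  module _ (char0 : CharacteristicZero) where

    1≉0 : 1# ≉ 0#
    1≉0 1≈0 = char0 0 (K.trans (K.+-identityʳ 1#) 1≈0)

    ·-as-* : ∀ n x → n · x ≈ n · 1# * x
    ·-as-* zero    x = K.sym (K.zeroˡ x)
    ·-as-* (suc n) x = K.trans (K.+-cong (K.sym (K.*-identityˡ x)) (·-as-* n x)) (K.sym (K.distribʳ x 1# (n · 1#)))

    ·-nonZero : ∀ n {x} → suc n · x ≈ 0# → x ≈ 0#
    ·-nonZero n {x} nx≈0 = nonZeroDivisor (char0 n) x (K.trans (K.sym (·-as-* (suc n) x)) nx≈0)

    divideBy : ∀ n (f : K⟦t⟧) → ∃[ g ] f A.+ RingMult._×_ A.semiring (suc n) g A.≈ A.0#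
    divideBy n f with inverse (suc n · 1#) (char0 n)
    ... | u , nu≈1 = g , λ i → K.trans
        (K.+-congˡ (K.trans (pointwise (suc n) i) (cancel i)))
        (K.trans (K.-‿inverseʳ (f i)) (K.sym (const-0 i)))
      where
      g : K⟦t⟧
      g i = u * - f i
      pointwise : ∀ n i → RingMult._×_ A.semiring n g i ≈ n · g i
      pointwise zero    i = const-0 i
      pointwise (suc n) i = K.+-congˡ (pointwise n i)
      cancel : ∀ i → suc n · g i ≈ - f i
      cancel i = K.trans (·-as-* (suc n) (g i)) (K.trans (K.sym (K.*-assoc _ u (- f i)))
        (K.trans (K.*-congʳ nu≈1) (K.*-identityˡ (- f i))))

-- Existence of a root

module Preparation {c ℓ₁ ℓ₂} (em : ExcludedMiddle (c ⊔ ℓ₁ ⊔ ℓ₂)) (K : HeytingField c ℓ₁ ℓ₂) where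
  open Substitution K using (module A; module B; module K; A-ring; B-ring)
  open Roots K using (inX; y)
  open FractionalSeries K
    using (module S₁; K⟦t⟧; K⟦x,y⟧; _≈_; _≉_; 0#; 1#; _+_; _*_; -_; K-ring; IsOrder
        ; CharacteristicZero)
  open ClassicalField em K
  open PowerSeries K-ring using (X^-factor; X^-⊙-+; X^-⊙-<; ⊙-head; const-0; head-tail)
  open RingExp A.semiring using (_^_)
  open RingExp B.semiring using () renaming (_^_ to _^ᴮ_)
  open Evaluation A-ring B-ring using (evaluateMonic)
  open RingProperties K.ring using (-0#≈0#)

  -- A transposition: R i j is indexed by the power of x first, whereas a monic polynomial in y
  -- stores series in x.
  lowCoefficients : ∀ d → K⟦x,y⟧ → Vec K⟦t⟧ d
  lowCoefficients zero    R = []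
  lowCoefficients (suc d) R = (λ i → R i 0) ∷ lowCoefficients d (λ i j → R i (suc j))

  lowCoefficients-heads : ∀ d R → (∀ j → j < d → R 0 j ≈ 0#) →
    VecAll (λ f → f 0 ≈ 0#) (lowCoefficients d R)
  lowCoefficients-heads zero    R small = []
  lowCoefficients-heads (suc d) R small = small 0 z<s
    ∷ lowCoefficients-heads d (λ i j → R i (suc j)) (λ j j<d → small (suc j) (s<s j<d))

  evaluate-lowCoefficients : ∀ d R → (∀ i j → d ≤ j → R i j ≈ 0#) →
    evaluateMonic inX (lowCoefficients d R) y B.≈ y ^ᴮ d B.+ R
  evaluate-lowCoefficients zero R small = B.sym (B.trans (B.+-congˡ R≈0) (B.+-identityʳ B.1#))
    where
    R≈0 : R B.≈ B.0#
    R≈0 zero    j = K.trans (small 0 j z≤n) (K.sym (const-0 j))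
    R≈0 (suc i) j = K.trans (small (suc i) j z≤n) (K.sym (const-0 j))
  evaluate-lowCoefficients (suc d) R small = B.trans
    (B.+-congˡ {inX R₀} (B.trans (B.*-congˡ {y} (evaluate-lowCoefficients d R′ (λ i j d≤j → small i (suc j) (s≤s d≤j))))
      (B.distribˡ y (y ^ᴮ d) R′))) (B.trans
    (x∙yz≈y∙xz (inX R₀) (y B.* y ^ᴮ d) (y B.* R′))
    (B.+-congˡ {y B.* y ^ᴮ d} (B.sym split)))
    where
    open CommutativeSemigroupProperties (CommutativeRing.+-commutativeSemigroup B-ring) using (x∙yz≈y∙xz)
    R₀ : K⟦t⟧
    R₀ i = R i 0
    R′ : K⟦x,y⟧
    R′ i j = R i (suc j)
    split : R B.≈ inX R₀ B.+ y B.* R′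
    split i = A.trans (head-tail (R i)) (A.+-congˡ {S₁.const (R₀ i)}
      (A.sym (PowerSeries.const-⊙ A-ring S₁.X R′ i)))

  module _ (char0 : CharacteristicZero) where

    -- Dividing y^d by G gives y^d = G U + r, and P = y^d - r. At x = 0 the coefficients below d
    -- force r to vanish there, so P has the required heads; coefficient d then reads e 0 * U 0 0 =
    -- 1, so U is a unit.
    weierstrassPreparation : ∀ G d → IsOrder (G 0) d →
      ∃[ P ] ∃[ U ] VecAll (λ f → f 0 ≈ 0#) P × U 0 0 ≉ 0# × G B.* U B.≈ evaluateMonic {n = d} inX P y
    weierstrassPreparation G d (G₀d≉0 , small) = conclude
      (WeierstrassDivision.weierstrassDivision K-ring d G e (proj₁ e-inverse) G₀-factor (proj₂ e-inverse) (y ^ᴮ d))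
      where
      e : K⟦t⟧
      e n = G 0 (d ℕ.+ n)
      G₀-factor : G 0 A.≈ S₁.X ^ d A.* e
      G₀-factor = X^-factor d (G 0) small
      e-inverse : ∃[ e⁻¹ ] e A.* e⁻¹ A.≈ A.1#
      e-inverse = let v , e₀v≈1 = inverse (e 0) (at-order (G 0) d G₀d≉0) in Division.invert K-ring e v e₀v≈1

      yᵈ-head : (y ^ᴮ d) 0 A.≈ S₁.X ^ d A.* A.1#
      yᵈ-head = A.trans (^-homo {A = B-ring} {B = A-ring} (head-isHom A-ring) y d) (A.sym (A.*-identityʳ (S₁.X ^ d)))

      conclude : ∃[ U ] ∃[ r ] y ^ᴮ d B.≈ G B.* U B.+ r × (∀ i j → d ≤ j → r i j ≈ 0#) →
        ∃[ P ] ∃[ U ] VecAll (λ f → f 0 ≈ 0#) P × U 0 0 ≉ 0# × G B.* U B.≈ evaluateMonic {n = d} inX P y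
      conclude (U , r , yᵈ≈ , r-small) =
          lowCoefficients d (B.- r) , U
        , lowCoefficients-heads d (B.- r) (λ j j<d → K.trans (K.-‿cong (r₀≈0 j j<d)) -0#≈0#)
        , U₀₀≉0
        , B.sym (B.trans (evaluate-lowCoefficients d (B.- r) (λ i j d≤j → K.trans (K.-‿cong (r-small i j d≤j)) -0#≈0#))
            (B.trans (B.+-congʳ yᵈ≈) (B.trans (B.+-assoc (G B.* U) r (B.- r))
              (B.trans (B.+-congˡ {G B.* U} (B.-‿inverseʳ r)) (B.+-identityʳ (G B.* U))))))
        where
        GU₀ : (G B.* U) 0 A.≈ S₁.X ^ d A.* (e A.* U 0)
        GU₀ = A.trans (PowerSeries.⊙-head A-ring G U) (A.trans (A.*-congʳ G₀-factor) (A.*-assoc (S₁.X ^ d) e (U 0)))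

        heads : S₁.X ^ d A.* A.1# A.≈ S₁.X ^ d A.* (e A.* U 0) A.+ r 0
        heads = A.trans (A.sym yᵈ-head) (A.trans (yᵈ≈ 0) (A.+-congʳ GU₀))

        r₀≈0 : ∀ j → j < d → r 0 j ≈ 0#
        r₀≈0 j j<d = begin
          r 0 j                                        ≈⟨ K.+-identityˡ _ ⟨
          0# + r 0 j                                   ≈⟨ K.+-congʳ (X^-⊙-< d (e A.* U 0) j<d) ⟨
          (S₁.X ^ d A.* (e A.* U 0)) j + r 0 j         ≈⟨ heads j ⟨
          (S₁.X ^ d A.* A.1#) j                        ≈⟨ X^-⊙-< d A.1# j<d ⟩
          0#                                           ∎
          where open SetoidReasoning K.setoid

        e₀U₀₀≈1 : e 0 * U 0 0 ≈ 1#
        e₀U₀₀≈1 = begin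
          e 0 * U 0 0                                                ≈⟨ ⊙-head e (U 0) ⟨
          (e A.* U 0) 0                                              ≈⟨ X^-⊙-+ d (e A.* U 0) 0 ⟨
          (S₁.X ^ d A.* (e A.* U 0)) (d ℕ.+ 0)                       ≈⟨ K.+-identityʳ _ ⟨
          (S₁.X ^ d A.* (e A.* U 0)) (d ℕ.+ 0) + 0#
            ≈⟨ K.+-congˡ (r-small 0 (d ℕ.+ 0) (ℕ.m≤m+n d 0)) ⟨
          (S₁.X ^ d A.* (e A.* U 0)) (d ℕ.+ 0) + r 0 (d ℕ.+ 0)       ≈⟨ heads (d ℕ.+ 0) ⟨
          (S₁.X ^ d A.* A.1#) (d ℕ.+ 0)                              ≈⟨ X^-⊙-+ d A.1# 0 ⟩
          1#                                                         ∎
          where open SetoidReasoning K.setoid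

        U₀₀≉0 : U 0 0 ≉ 0#
        U₀₀≉0 U₀₀≈0 = 1≉0 char0 (K.trans (K.sym e₀U₀₀≈1) (K.trans (K.*-congˡ U₀₀≈0) (K.zeroʳ (e 0))))

-- Newton polygons

module NewtonPolygon {c ℓ₁ ℓ₂} (em : ExcludedMiddle (c ⊔ ℓ₁ ⊔ ℓ₂)) (K : HeytingField c ℓ₁ ℓ₂) where
  open Substitution K using (module A; module K; module KD; A-ring)
  open FractionalSeries K using (module S₁; K⟦t⟧; _≈_; _≉_; 0#; K-ring)
  open ClassicalField em K
  open Dilation K-ring using (dilate-∣)
  open PowerSeries K-ring using (X^-factor; const-0)
  open RingExp A.semiring using (_^_; ^-homo-*)
  open Evaluation A-ring A-ring using (evaluateMonic)
  open Monic A-ring using (AllZero; subleading)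

  -- The coefficient of degree d - w of a monic polynomial of degree d has weight w.
  -- The Newton polygon lies above the line of slope p / q through (d , 0).
  data Above (p q : ℕ) : Vec K⟦t⟧ n → Set (c ⊔ ℓ₁) where
    []  : Above p q []
    _∷_ : ∀ {f} {Q : Vec K⟦t⟧ n} → (∀ k → k ℕ.* q < p ℕ.* suc n → f k ≈ 0#) → Above p q Q → Above p q (f ∷ Q)

  data Touches (p q : ℕ) : Vec K⟦t⟧ n → Set (c ⊔ ℓ₁) where
    here  : ∀ {f} {Q : Vec K⟦t⟧ n} k → k ℕ.* q ≡ p ℕ.* suc n → f k ≉ 0# → Touches p q (f ∷ Q)
    there : ∀ {f} {Q : Vec K⟦t⟧ n} → Touches p q Q → Touches p q (f ∷ Q)

  above-allZero : ∀ {p q} {Q : Vec K⟦t⟧ n} → AllZero Q → Above p q Q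
  above-allZero []          = []
  above-allZero (f≈0 ∷ Q≈0) = (λ k _ → K.trans (f≈0 k) (const-0 k)) ∷ above-allZero Q≈0

  -- Slopes are compared by cross-multiplication: v / w ≤ p / q, so whatever lies below the line of
  -- slope v / w lies below that of slope p / q.
  above-lower : ∀ {p q v w} .{{_ : NonZero q}} .{{_ : NonZero w}} {Q : Vec K⟦t⟧ n} → v ℕ.* q ≤ p ℕ.* w →
    Above p q Q → Above v w Q
  above-lower                   vq≤pw []        = []
  above-lower {suc n} {p} {q} {v} {w} vq≤pw (f ∷ Q) =
    (λ k kw<vn → f k (ℕ.*-cancelʳ-< w (k ℕ.* q) (p ℕ.* suc n) (lemma k kw<vn))) ∷ above-lower vq≤pw Q
    where
    lemma : ∀ k → k ℕ.* w < v ℕ.* suc n → k ℕ.* q ℕ.* w < p ℕ.* suc n ℕ.* w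
    lemma k kw<vn = begin-strict
      k ℕ.* q ℕ.* w       ≡⟨ xy∙z≈xz∙y k q w ⟩
      k ℕ.* w ℕ.* q       <⟨ ℕ.*-monoˡ-< q kw<vn ⟩
      v ℕ.* suc n ℕ.* q   ≡⟨ xy∙z≈xz∙y v (suc n) q ⟩
      v ℕ.* q ℕ.* suc n   ≤⟨ ℕ.*-monoˡ-≤ (suc n) vq≤pw ⟩
      p ℕ.* w ℕ.* suc n   ≡⟨ xy∙z≈xz∙y p w (suc n) ⟩
      p ℕ.* suc n ℕ.* w   ∎
      where
      open ℕ.≤-Reasoning
      open CommutativeSemigroupProperties ℕ.*-commutativeSemigroup using (xy∙z≈xz∙y)

  -- The least ratio of order to weight among the nonzero coefficients; it is attained, whence
  -- `Touches`. The head of a vector of length n + 1 has weight n + 1 and the weights in its tail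
  -- are unaffected by it, so the minimum is built up entry by entry, each entry proposing its order
  -- over its weight.
  slope : (Q : Vec K⟦t⟧ n) → AllZero Q ⊎ ∃[ p ] ∃[ q-1 ] Above p (suc q-1) Q × Touches p (suc q-1) Q
  slope []      = inj₁ []
  slope {suc n} (f ∷ Q) with zeroOrOrder f | slope Q
  ... | inj₁ f≈0 | inj₁ Q≈0 = inj₁ (f≈0 ∷ Q≈0)
  ... | inj₁ f≈0 | inj₂ (p , q-1 , above , touches) =
    inj₂ (p , q-1 , (λ k _ → K.trans (f≈0 k) (const-0 k)) ∷ above , there touches)
  ... | inj₂ (v , f_v≉0 , small) | inj₁ Q≈0 =
    inj₂ (v , n , (λ k kn<vn → small k (ℕ.*-cancelʳ-< (suc n) k v kn<vn)) ∷ above-allZero Q≈0 , here v ≡.refl f_v≉0)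
  ... | inj₂ (v , f_v≉0 , small) | inj₂ (p , q-1 , above , touches) with v ℕ.* suc q-1 ℕ.≤? p ℕ.* suc n
  ...   | yes vq≤pn = inj₂ (v , n , (λ k kn<vn → small k (ℕ.*-cancelʳ-< (suc n) k v kn<vn)) ∷ above-lower vq≤pn above
                      , here v ≡.refl f_v≉0)
  ...   | no  vq≰pn = inj₂ (p , q-1
                      , (λ k kq<pn → small k (ℕ.*-cancelʳ-< (suc q-1) k v (ℕ.<-trans kq<pn (ℕ.≰⇒> vq≰pn)))) ∷ above
                      , there touches)

  -- A coefficient f of weight w becomes f(x^q) / x^(p w). The division is a shift of indices, which
  -- loses nothing when the polynomial is `Above` the line.
  rescale : ℕ → ℕ → Vec K⟦t⟧ n → Vec K⟦t⟧ n
  rescale p q []                  = []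
  rescale {suc n} p q (f ∷ Q) = (λ k → S₁.dilate q f (p ℕ.* suc n ℕ.+ k)) ∷ rescale p q Q

  module _ (p q : ℕ) .{{_ : NonZero q}} where

    -- A coefficient of x^k on the line, k q = p w, is moved to the constant term.
    rescale-touches : (Q : Vec K⟦t⟧ n) → Touches p q Q → ¬ VecAll (λ f → f 0 ≈ 0#) (rescale p q Q)
    rescale-touches (f ∷ Q) (there touches)       (_ ∷ Q₀≈0) = rescale-touches Q touches Q₀≈0
    rescale-touches {suc n} (f ∷ Q) (here k kq≡pn f_k≉0) (f₀≈0 ∷ _) = f_k≉0 (K.trans
      (K.reflexive (≡.sym (≡.trans
        (≡.cong (S₁.dilate q f) (≡.trans (ℕ.+-identityʳ _) (≡.sym kq≡pn))) (dilate-∣ q f k)))) f₀≈0)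

    subleading-rescale : (Q : Vec K⟦t⟧ (suc n)) → subleading Q A.≈ A.0# → subleading (rescale p q Q) A.≈ A.0#
    subleading-rescale (f ∷ [])    f≈0 k = K.trans (KD.dilate-cong q {f} {A.0#} f≈0 (p ℕ.* 1 ℕ.+ k))
      (K.trans (KD.dilate-const q 0# (p ℕ.* 1 ℕ.+ k)) (K.trans (const-0 (p ℕ.* 1 ℕ.+ k)) (K.sym (const-0 k))))
    subleading-rescale (_ ∷ g ∷ Q) eq    = subleading-rescale (g ∷ Q) eq

    module _ {ψ} (ψ-hom : IsHom A-ring A-ring ψ) where
      open IsRingHomomorphism ψ-hom

      -- With ψ the identity this is Q(x^q, x^p z) = x^(p n) H(x, z) for the rescaled polynomial H.
      -- The homomorphism ψ leaves room for the further dilation that a root of H brings along.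
      evaluate-rescale : ∀ (Q : Vec K⟦t⟧ n) z → Above p q Q →
        evaluateMonic (ψ ∘ S₁.dilate q) Q (ψ (S₁.X ^ p) A.* z) A.≈ ψ (S₁.X ^ (p ℕ.* n)) A.* evaluateMonic ψ (rescale p q Q) z
      evaluate-rescale []      z []              = A.sym (A.trans (A.*-identityʳ _)
        (A.trans (⟦⟧-cong (A.reflexive (≡.cong (S₁.X ^_) (ℕ.*-zeroʳ p)))) 1#-homo))
      evaluate-rescale {suc n} (f ∷ Q) z (f-small ∷ above) = A.trans
        (A.+-cong f-factor (A.trans (A.*-congˡ {ψ (S₁.X ^ p) A.* z} (evaluate-rescale Q z above)) (A.trans
          (interchange (ψ (S₁.X ^ p)) z (ψ (S₁.X ^ (p ℕ.* n))) E)
          (A.*-congʳ powers))))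
        (A.sym (A.distribˡ (ψ (S₁.X ^ (p ℕ.* suc n))) (ψ g) (z A.* E)))
        where
        open CommutativeSemigroupProperties A.*-commutativeSemigroup using (interchange)
        E : K⟦t⟧
        E = evaluateMonic ψ (rescale p q Q) z
        g : K⟦t⟧
        g k = S₁.dilate q f (p ℕ.* suc n ℕ.+ k)
        powers : ψ (S₁.X ^ p) A.* ψ (S₁.X ^ (p ℕ.* n)) A.≈ ψ (S₁.X ^ (p ℕ.* suc n))
        powers = A.trans (A.sym (*-homo (S₁.X ^ p) (S₁.X ^ (p ℕ.* n)))) (⟦⟧-cong (A.trans
          (A.sym (^-homo-* S₁.X p (p ℕ.* n))) (A.reflexive (≡.cong (S₁.X ^_) (≡.sym (ℕ.*-suc p n))))))
        dilate-small : ∀ j → j < p ℕ.* suc n → S₁.dilate q f j ≈ 0#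
        dilate-small j j<pn with q ∣? j
        ... | yes (divides k j≡kq) = f-small k (≡.subst (_< p ℕ.* suc n) j≡kq j<pn)
        ... | no  _ = K.refl
        f-factor : ψ (S₁.dilate q f) A.≈ ψ (S₁.X ^ (p ℕ.* suc n)) A.* ψ g
        f-factor = A.trans (⟦⟧-cong (X^-factor (p ℕ.* suc n) (S₁.dilate q f) dilate-small))
          (*-homo (S₁.X ^ (p ℕ.* suc n)) g)

-- Descent along the Newton polygon

module RootExistence {c ℓ₁ ℓ₂} (em : ExcludedMiddle (c ⊔ ℓ₁ ⊔ ℓ₂)) (K : HeytingField c ℓ₁ ℓ₂)
    (char0 : FractionalSeries.CharacteristicZero K) (closed : FractionalSeries.AlgebraicallyClosed K) where
  open Substitution K
  open Roots K
  open FractionalSeries K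
    using (module S₁; K⟦t⟧; K⟦x,y⟧; Carrier; _≈_; _≉_; 0#; 1#; _+_; _*_; -_; K-ring; IsOrder)
  open ClassicalField em K
  open Preparation em K using (weierstrassPreparation)
  open NewtonPolygon em K
  open PowerSeries K-ring using (X^-⊙-<; X-⊙-head; X-⊙-suc)
  open RingExp A.semiring using (_^_)
  open Evaluation
  open Monic using (shift; subleading; subleading-shift)
  open Monic K-ring using (AllZero)

  coefficients : Vec Carrier n → ℕ → Carrier
  coefficients []      = S₁.const 1#
  coefficients (x ∷ h) zero    = x
  coefficients (x ∷ h) (suc j) = coefficients h j

  coefficients-leading : (h : Vec Carrier n) → coefficients h n ≈ 1#
  coefficients-leading []      = K.refl
  coefficients-leading (x ∷ h) = coefficients-leading h

  open PolynomialSum K-ring K-ring using (polySum; polySum-suc)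

  polySum-coefficients : ∀ (h : Vec Carrier n) x →
    polySum id (suc n) (coefficients h) x ≈ evaluateMonic K-ring K-ring id h x
  polySum-coefficients []      x = K.trans (K.+-identityʳ _) (K.*-identityʳ 1#)
  polySum-coefficients {suc n} (a ∷ h) x = K.trans (polySum-suc id (suc n) (coefficients (a ∷ h)) x)
    (K.+-congˡ (K.*-congˡ (polySum-coefficients h x)))

  monicRoot-K : (h : Vec Carrier (suc n)) → ∃[ x ] evaluateMonic K-ring K-ring id h x ≈ 0#
  monicRoot-K {n} h = let x , root = closed (suc n) (coefficients h) (s≤s z≤n)
                                       (λ eq → 1≉0 char0 (K.trans (K.sym (coefficients-leading h)) eq))
    in x , K.trans (K.sym (polySum-coefficients h x)) root

  -- The vector holds only the coefficients below the leading one, so a nonzero entry bounds the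
  -- order strictly by the degree, and `AllZero h` is the case y^n.
  lowOrder : (h : Vec Carrier n) →
    AllZero h ⊎ ∃[ e ] e < n × IsOrder (evaluateMonic K-ring A-ring S₁.const h S₁.X) e
  lowOrder []      = inj₁ []
  lowOrder (a ∷ h) with decide (a ≈ 0#) | lowOrder h
  ... | no a≉0  | _ = inj₂ (0 , z<s , (λ p → a≉0 (K.trans (K.sym (K.trans (K.+-congˡ (X-⊙-head _)) (K.+-identityʳ a))) p)) , λ _ ())
  ... | yes a≈0 | inj₁ h≈0 = inj₁ (a≈0 ∷ h≈0)
  ... | yes a≈0 | inj₂ (e , e<n , h_e≉0 , small) = inj₂ (suc e , s<s e<n
      , (λ p → h_e≉0 (K.trans (K.sym (at-suc e)) p)) , λ where
          zero    _         → K.trans (K.+-congˡ (X-⊙-head _)) (K.trans (K.+-identityʳ a) a≈0)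
          (suc j) (s≤s j<e) → K.trans (at-suc j) (small j j<e))
    where
    g : K⟦t⟧
    g = evaluateMonic K-ring A-ring S₁.const h S₁.X
    at-suc : ∀ j → 0# + (S₁.X A.* g) (suc j) ≈ g j
    at-suc j = K.trans (K.+-identityˡ _) (X-⊙-suc g j)

  -- A monic polynomial with vanishing subleading coefficient, other than yᵈ, is not
  -- of the form (y - α)ᵈ: this uses characteristic 0.
  translatedOrder : (h : Vec Carrier (suc n)) → subleading K-ring h ≈ 0# → ¬ AllZero h →
    ∀ α → evaluateMonic K-ring K-ring id h α ≈ 0# →
    ∃[ e ] 1 ≤ e × e < suc n × IsOrder (evaluateMonic K-ring A-ring S₁.const h (S₁.X A.+ S₁.const α)) e
  translatedOrder {n} h trace h≉0 α root = conclude (lowOrder h′)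
    where
    h′ : Vec Carrier (suc n)
    h′ = shift K-ring α h
    shifted : evaluateMonic K-ring A-ring S₁.const h′ S₁.X A.≈ evaluateMonic K-ring A-ring S₁.const h (S₁.X A.+ S₁.const α)
    shifted = evaluateMonic-shift K-ring A-ring (const-isHom K-ring) α h S₁.X
    head≈0 : evaluateMonic K-ring A-ring S₁.const h (S₁.X A.+ S₁.const α) 0 ≈ 0#
    head≈0 = K.trans (evaluateMonic-hom {Q = K-ring} {R = A-ring} {S = K-ring} (head-isHom K-ring) S₁.const h (S₁.X A.+ S₁.const α))
      (K.trans (evaluateMonic-cong K-ring K-ring (λ _ → K.refl) (K.+-identityˡ α) h) root)

    subleading≈0 : ∀ {m} (p : Vec Carrier (suc m)) → AllZero p → subleading K-ring p ≈ 0#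
    subleading≈0 (x ∷ [])    (x≈0 ∷ _)  = x≈0
    subleading≈0 (_ ∷ z ∷ p) (_ ∷ p≈0) = subleading≈0 (z ∷ p) p≈0

    not-power : ¬ AllZero h′
    not-power h′≈0 = contradict (lowOrder h)
      where
      -- The subleading coefficients of h and h′ both vanish, and they differ by (n + 1) α.
      α≈0 : α ≈ 0#
      α≈0 = ·-nonZero char0 n (K.trans (K.sym (K.trans (subleading-shift K-ring α h)
        (K.trans (K.+-congʳ trace) (K.+-identityˡ _)))) (subleading≈0 h′ h′≈0))
      power : evaluateMonic K-ring A-ring S₁.const h S₁.X A.≈ S₁.X ^ suc n
      power = A.trans (evaluateMonic-cong K-ring A-ring (λ _ → A.refl)
          (A.sym (A.trans (A.+-congˡ {S₁.X} (const-zero α≈0)) (A.+-identityʳ S₁.X))) h)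
        (A.trans (A.sym shifted) (evaluateMonic-allZero K-ring A-ring h′ S₁.X (VecAll.map const-zero h′≈0)))
      contradict : AllZero h ⊎ ∃[ e ] e < suc n × IsOrder (evaluateMonic K-ring A-ring S₁.const h S₁.X) e → _
      contradict (inj₁ h≈0) = h≉0 h≈0
      contradict (inj₂ (e , e<n , h_e≉0 , _)) = h_e≉0 (K.trans (power e)
        (K.trans (A.sym (A.*-identityʳ (S₁.X ^ suc n)) e) (X^-⊙-< (suc n) A.1# e<n)))

    conclude : AllZero h′ ⊎ ∃[ e ] e < suc n × IsOrder (evaluateMonic K-ring A-ring S₁.const h′ S₁.X) e →
      ∃[ e ] 1 ≤ e × e < suc n × IsOrder (evaluateMonic K-ring A-ring S₁.const h (S₁.X A.+ S₁.const α)) e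
    conclude (inj₁ h′≈0)                = contradiction h′≈0 not-power
    conclude (inj₂ (zero , _ , order))  = contradiction head≈0 (proj₁ (order-cong shifted order))
    conclude (inj₂ (suc e , e<n , order)) = suc e , s≤s z≤n , e<n , order-cong shifted order

  record PositiveRoot (G : K⟦x,y⟧) : Set (c ⊔ ℓ₁) where
    field
      N            : ℕ
      {{N-nonZero}} : NonZero N
      Y            : K⟦t⟧
      Y₀           : Y 0 ≈ 0#
      isRoot       : substituteᵗ N Y G A.≈ A.0#

  -- The constant term of Y is free, since a polynomial can be evaluated at any series;
  -- `positiveRoot` recovers its vanishing afterwards.
  record MonicRoot (P : Vec K⟦t⟧ n) : Set (c ⊔ ℓ₁) where
    field
      N            : ℕ
      {{N-nonZero}} : NonZero N
      Y            : K⟦t⟧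
      isRoot       : evaluateMonic A-ring A-ring (S₁.dilate N) P Y A.≈ A.0#

  substituteᵗ-evaluate : ∀ N .{{_ : NonZero N}} Y → Y 0 ≈ 0# → ∀ (P : Vec K⟦t⟧ n) z →
    substituteᵗ N Y (evaluateMonic A-ring B-ring inX P z) A.≈
    evaluateMonic A-ring A-ring (S₁.dilate N) P (substituteᵗ N Y z)
  substituteᵗ-evaluate N Y Y₀ P z = A.trans
    (evaluateMonic-hom {Q = A-ring} {R = B-ring} {S = A-ring} (substituteᵗ-isHom N Y Y₀) inX P z)
    (evaluateMonic-cong A-ring A-ring (substituteᵗ-inX N Y Y₀) A.refl P)

  evaluateMonic-mapHead : ∀ (P : Vec K⟦t⟧ n) z →
    evaluateMonic A-ring A-ring (λ f → S₁.const (f 0)) P z A.≈ evaluateMonic K-ring A-ring S₁.const (Vec.map (λ f → f 0) P) z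
  evaluateMonic-mapHead []      z = A.refl
  evaluateMonic-mapHead (f ∷ P) z = A.+-congˡ {S₁.const (f 0)} (A.*-congˡ {z} (evaluateMonic-mapHead P z))

  subleading-mapHead : ∀ (P : Vec K⟦t⟧ (suc n)) → subleading A-ring P A.≈ A.0# →
    subleading K-ring (Vec.map (λ f → f 0) P) ≈ 0#
  subleading-mapHead (f ∷ [])    p = p 0
  subleading-mapHead (_ ∷ g ∷ P) p = subleading-mapHead (g ∷ P) p

  -- The induction hypothesis is asked for arbitrary series because `G′` still has degree n + 1 in y
  -- and is small only in its order at x = 0.
  monicRoot : (P : Vec K⟦t⟧ (suc n)) →
    (∀ {e} G → 1 ≤ e → e < suc n → IsOrder (G 0) e → PositiveRoot G) → MonicRoot P
  monicRoot {n} P ih = tschirnhaus (divideBy char0 n (subleading A-ring P))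
    where
    tschirnhaus : ∃[ s ] subleading A-ring P A.+ RingMult._×_ A.semiring (suc n) s A.≈ A.0# → MonicRoot P
    tschirnhaus (s , eq) = newton (slope Q)
      where
      Q : Vec K⟦t⟧ (suc n)
      Q = shift A-ring s P
      subleading-Q : subleading A-ring Q A.≈ A.0#
      subleading-Q = A.trans (subleading-shift A-ring s P) eq

      unshift : ∀ N .{{_ : NonZero N}} z → evaluateMonic A-ring A-ring (S₁.dilate N) Q z A.≈ A.0# →
        evaluateMonic A-ring A-ring (S₁.dilate N) P (z A.+ S₁.dilate N s) A.≈ A.0#
      unshift N z p = A.trans (A.sym (evaluateMonic-shift A-ring A-ring (Dilation.dilate-isHom K-ring N) s P z)) p

      newton : Monic.AllZero A-ring Q ⊎ ∃[ p ] ∃[ q-1 ] Above p (suc q-1) Q × Touches p (suc q-1) Q →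
        MonicRoot P
      newton (inj₁ Q≈0) = record
        { N = 1 ; Y = A.0# A.+ S₁.dilate 1 s
        ; isRoot = unshift 1 A.0# (A.trans
            (evaluateMonic-allZero A-ring A-ring Q A.0# (VecAll.map (λ {f} f≈0 → A.trans (KD.dilate-1 f) f≈0) Q≈0))
            (A.zeroˡ (A.0# ^ n)))
        }
      newton (inj₂ (p , q-1 , above , touches)) = translate
          (monicRoot-K h)
        where
        q : ℕ
        q = suc q-1
        H : Vec K⟦t⟧ (suc n)
        H = rescale p q Q
        h : Vec Carrier (suc n)
        h = Vec.map (λ f → f 0) H
        translate : ∃[ α ] evaluateMonic K-ring K-ring id h α ≈ 0# → MonicRoot P
        translate (α , h[α]≈0) = descend (translatedOrder h
            (subleading-mapHead H (subleading-rescale p q Q subleading-Q))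
            (λ h≈0 → rescale-touches p q Q touches (VecAll.map⁻ h≈0)) α h[α]≈0)
          where
          α-series : K⟦x,y⟧
          α-series = S₂.const (S₁.const α)
          G′ : K⟦x,y⟧
          G′ = evaluateMonic A-ring B-ring inX H (y B.+ α-series)
          G′₀ : evaluateMonic K-ring A-ring S₁.const h (S₁.X A.+ S₁.const α) A.≈ G′ 0
          G′₀ = A.sym (A.trans
            (evaluateMonic-hom {Q = A-ring} {R = B-ring} {S = A-ring} (head-isHom A-ring) inX H (y B.+ α-series))
            (evaluateMonic-mapHead H (S₁.X A.+ S₁.const α)))
          descend : ∃[ e ] 1 ≤ e × e < suc n × IsOrder (evaluateMonic K-ring A-ring S₁.const h (S₁.X A.+ S₁.const α)) e → MonicRoot P
          descend (e , 1≤e , e<n , order) = ascend (ih G′ 1≤e e<n (order-cong G′₀ order))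
            where
            ascend : PositiveRoot G′ → MonicRoot P
            ascend r = record
              { N = M ℕ.* q ; N-nonZero = ℕ.m*n≢0 M q
              -- The substitutions undone, with x = t^(M q): z = Z + α solves the rescaled
              -- polynomial at level M, t^(M p) z solves Q, and adding s(x) returns to P.
              ; Y = ψ (S₁.X ^ p) A.* z A.+ S₁.dilate (M ℕ.* q) s
              ; isRoot = unshift (M ℕ.* q) {{ℕ.m*n≢0 M q}} (ψ (S₁.X ^ p) A.* z) (begin
                  evaluateMonic A-ring A-ring (S₁.dilate (M ℕ.* q)) Q (ψ (S₁.X ^ p) A.* z)
                    ≈⟨ evaluateMonic-cong A-ring A-ring (KD.dilate-dilate M q {{N-nonZero}} {{_}} {{ℕ.m*n≢0 M q}}) A.refl Q ⟨
                  evaluateMonic A-ring A-ring (ψ ∘ S₁.dilate q) Q (ψ (S₁.X ^ p) A.* z)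
                    ≈⟨ evaluate-rescale p q (Dilation.dilate-isHom K-ring M) Q z above ⟩
                  ψ (S₁.X ^ (p ℕ.* suc n)) A.* evaluateMonic A-ring A-ring ψ H z
                    ≈⟨ A.*-congˡ H[z]≈0 ⟩
                  ψ (S₁.X ^ (p ℕ.* suc n)) A.* A.0#
                    ≈⟨ A.zeroʳ (ψ (S₁.X ^ (p ℕ.* suc n))) ⟩
                  A.0# ∎)
              }
              where
              open PositiveRoot r renaming (N to M; Y to Z; Y₀ to Z₀)
              open SetoidReasoning A.setoid
              ψ : K⟦t⟧ → K⟦t⟧
              ψ = S₁.dilate M
              z : K⟦t⟧
              z = Z A.+ S₁.const α
              substitute-z : substituteᵗ M Z (y B.+ α-series) A.≈ z
              substitute-z = A.trans (+-homo y α-series) (A.+-cong (substituteᵗ-y M Z Z₀) (A.trans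
                (substituteᵗ-const M Z Z₀ (S₁.const α))
                (Horner.horner-const {R = K-ring} {S = K-ring} {ι = S₁.const} (const-isHom K-ring) Z₀ (compose-isHorner Z Z₀) α)))
                where open IsRingHomomorphism (substituteᵗ-isHom M Z Z₀)
              H[z]≈0 : evaluateMonic A-ring A-ring ψ H z A.≈ A.0#
              H[z]≈0 = begin
                evaluateMonic A-ring A-ring ψ H z
                  ≈⟨ evaluateMonic-cong A-ring A-ring (λ _ → A.refl) substitute-z H ⟨
                evaluateMonic A-ring A-ring ψ H (substituteᵗ M Z (y B.+ α-series))
                  ≈⟨ substituteᵗ-evaluate M Z Z₀ H (y B.+ α-series) ⟨
                substituteᵗ M Z G′                                                   ≈⟨ isRoot ⟩
                A.0#                                                                 ∎

  xⁿ≈0⇒x≈0 : ∀ n x → RingExp._^_ K.semiring x n ≈ 0# → x ≈ 0#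
  xⁿ≈0⇒x≈0 zero    x 1≈0 = contradiction 1≈0 (1≉0 char0)
  xⁿ≈0⇒x≈0 (suc n) x xxⁿ≈0 with decide (x ≈ 0#)
  ... | yes x≈0 = x≈0
  ... | no  x≉0 = xⁿ≈0⇒x≈0 n x (nonZeroDivisor x≉0 _ xxⁿ≈0)

  positiveRoot : ∀ {d} → Acc _<_ d → ∀ G → 1 ≤ d → IsOrder (G 0) d → PositiveRoot G
  positiveRoot {suc d} (acc rec) G 1≤d order = prepared (weierstrassPreparation char0 G (suc d) order)
    where
    prepared : ∃[ P ] ∃[ U ] VecAll (λ f → f 0 ≈ 0#) P × U 0 0 ≉ 0# × G B.* U B.≈ evaluateMonic A-ring B-ring {n = suc d} inX P y →
               PositiveRoot G
    prepared (P , U , P₀≈0 , U₀₀≉0 , GU≈P) = conclude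
        (monicRoot P (λ G′ 1≤e e<d order → positiveRoot (rec e<d) G′ 1≤e order))
      where
      conclude : MonicRoot P → PositiveRoot G
      conclude r = record { N = N ; Y = Y ; Y₀ = Y₀ ; isRoot = G[Y]≈0 }
        where
        open MonicRoot r
        open SetoidReasoning A.setoid
        -- At x = 0 the polynomial P is y^(d + 1), so a power of Y 0 vanishes.
        Y₀ : Y 0 ≈ 0#
        Y₀ = xⁿ≈0⇒x≈0 (suc d) (Y 0) (K.trans (K.sym (K.trans
          (evaluateMonic-hom {Q = A-ring} {R = A-ring} {S = K-ring} (head-isHom K-ring) (S₁.dilate N) P Y)
          (evaluateMonic-allZero A-ring K-ring {φ = λ f → S₁.dilate N f 0} P (Y 0)
            (VecAll.map (λ {f} f₀≈0 → K.trans (KD.dilate-head N f) f₀≈0) P₀≈0))))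
          (isRoot 0))
        open IsRingHomomorphism (substituteᵗ-isHom N Y Y₀)
        product≈0 : substituteᵗ N Y U A.* substituteᵗ N Y G A.≈ A.0#
        product≈0 = begin
          substituteᵗ N Y U A.* substituteᵗ N Y G                          ≈⟨ A.*-comm _ _ ⟩
          substituteᵗ N Y G A.* substituteᵗ N Y U                          ≈⟨ *-homo G U ⟨
          substituteᵗ N Y (G B.* U)                                        ≈⟨ ⟦⟧-cong GU≈P ⟩
          substituteᵗ N Y (evaluateMonic A-ring B-ring inX P y)            ≈⟨ substituteᵗ-evaluate N Y Y₀ P y ⟩
          evaluateMonic A-ring A-ring (S₁.dilate N) P (substituteᵗ N Y y)
            ≈⟨ evaluateMonic-cong A-ring A-ring (λ _ → A.refl) (substituteᵗ-y N Y Y₀) P ⟩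
          evaluateMonic A-ring A-ring (S₁.dilate N) P Y                    ≈⟨ isRoot ⟩
          A.0#                                                             ∎
        G[Y]≈0 : substituteᵗ N Y G A.≈ A.0#
        G[Y]≈0 = series-nonZeroDivisor
          (head-nonZero (λ p → U₀₀≉0 (K.trans (K.sym (substituteᵗ-head N Y Y₀ U)) p))) (substituteᵗ N Y G) product≈0

module _ (R : CommutativeRing a ℓ) where
  open CommutativeRing R
  open RingProperties ring using (-‿distribʳ-*; x∙y⁻¹≈ε⇒x≈y)

  nonZeroDivisor-cancel : ∀ x → (∀ z → x * z ≈ 0# → z ≈ 0#) → ∀ y z → x * y ≈ x * z → y ≈ z
  nonZeroDivisor-cancel x x-nzd y z xy≈xz = x∙y⁻¹≈ε⇒x≈y y z (x-nzd (y - z)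
    (trans (distribˡ x y (- z)) (trans (+-cong xy≈xz (sym (-‿distribʳ-* x z))) (-‿inverseʳ (x * z)))))

  x-y≈0⇒x≈y : ∀ x y → x - y ≈ 0# → x ≈ y
  x-y≈0⇒x≈y = x∙y⁻¹≈ε⇒x≈y

-- Multiplicities

module Splitting {c ℓ₁ ℓ₂} (em : ExcludedMiddle (c ⊔ ℓ₁ ⊔ ℓ₂)) (K : HeytingField c ℓ₁ ℓ₂) where
  open Substitution K
  open Roots K
  open FractionalSeries K using (module S₁; K⟦t⟧; K⟦x,y⟧; _≈_; _≉_; 0#)
  open ClassicalField em K
  open RingExp B.semiring using (_^_)
  open CommutativeSemigroupProperties B.*-commutativeSemigroup using (x∙yz≈y∙xz)

  infix 4 _∈_
  _∈_ : K⟦t⟧ → List (K⟦t⟧ × ℕ) → Set (c ⊔ ℓ₁)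
  Y ∈ roots = Any (λ (Z , _) → Y A.≈ Z) roots

  Distinct : List (K⟦t⟧ × ℕ) → Set (c ⊔ ℓ₁)
  Distinct = AllPairs (λ (Z , _) (W , _) → ¬ Z A.≈ W)

  -- Nonvanishing of the cofactor H at Z fixes k and is easy to maintain while linear factors are
  -- added. Maximality of k over all denominators is derived from it in `exactRoot-multiplicity`.
  ExactRoot : K⟦x,y⟧ → K⟦t⟧ → ℕ → Set (c ⊔ ℓ₁)
  ExactRoot P Z k = Z 0 ≈ 0# × 1 ≤ k ×
    ∃[ H ] P B.≈ (y- Z) ^ k B.* H × ¬ substituteᵗ 1 Z H A.≈ A.0#

  -- All roots of P lie in K[[x]] already: `complete` also covers the candidates
  -- in K[[x^(1/M)]].
  record Splits (P : K⟦x,y⟧) (d : ℕ) : Set (c ⊔ ℓ₁) where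
    field
      roots    : List (K⟦t⟧ × ℕ)
      exact    : All (λ (Z , k) → ExactRoot P Z k) roots
      distinct : Distinct roots
      complete : ∀ M .{{_ : NonZero M}} V → V 0 ≈ 0# → substituteᵗ M V P A.≈ A.0# →
                 Any (λ (Z , _) → V A.≈ S₁.dilate M Z) roots
      total    : ListAction.sum (List.map proj₂ roots) ≡ d

  splits-unit : ∀ {U} → U 0 0 ≉ 0# → Splits U 0
  splits-unit {U} U₀₀≉0 = record
    { roots = [] ; exact = [] ; distinct = [] ; total = ≡.refl
    ; complete = λ M V V₀ root → contradiction (K.trans (K.sym (substituteᵗ-head M V V₀ U)) (root 0)) U₀₀≉0
    }

  exactRoot-cong : ∀ {P Q Z k} → P B.≈ Q → ExactRoot P Z k → ExactRoot Q Z k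
  exactRoot-cong P≈Q (Z₀ , 1≤k , H , P≈ , H≉0) = Z₀ , 1≤k , H , B.trans (B.sym P≈Q) P≈ , H≉0

  splits-cong : ∀ {P Q d} → P B.≈ Q → Splits P d → Splits Q d
  splits-cong {P} {Q} P≈Q s = record
    { Splits s
    ; exact    = All.map (exactRoot-cong P≈Q) (Splits.exact s)
    ; complete = λ M V V₀ root → Splits.complete s M V V₀
        (A.trans (IsRingHomomorphism.⟦⟧-cong (substituteᵗ-isHom M V V₀) P≈Q) root)
    }

  module _ (P : K⟦x,y⟧) (Y : K⟦t⟧) (Y₀ : Y 0 ≈ 0#) where

    -- The new factor goes into the cofactor. Its value at Z is Z - Y ≠ 0, and in a domain the
    -- product with the old nonzero value is nonzero.
    exactRoot-keep : ∀ {Z k} → ¬ Y A.≈ Z → ExactRoot P Z k → ExactRoot (y- Y B.* P) Z k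
    exactRoot-keep {Z} {k} Y≉Z (Z₀ , 1≤k , H , P≈ , H≉0) = Z₀ , 1≤k , y- Y B.* H
      , B.trans (B.*-congˡ {y- Y} P≈) (x∙yz≈y∙xz (y- Y) ((y- Z) ^ k) H)
      , λ p → H≉0 (series-nonZeroDivisor Z-Y≉0 (substituteᵗ 1 Z H) (A.trans (A.sym (*-homo (y- Y) H)) p))
      where
      open IsRingHomomorphism (substituteᵗ-isHom 1 Z Z₀)
      Z-Y≉0 : ¬ substituteᵗ 1 Z (y- Y) A.≈ A.0#
      Z-Y≉0 p = Y≉Z (A.sym (A.trans (x-y≈0⇒x≈y A-ring Z (S₁.dilate 1 Y)
        (A.trans (A.sym (substituteᵗ-y- 1 Z Z₀ Y)) p)) (KD.dilate-1 Y)))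

    exactRoot-raise : ∀ {Z k} → Y A.≈ Z → ExactRoot P Z k → ExactRoot (y- Y B.* P) Z (suc k)
    exactRoot-raise {Z} {k} Y≈Z (Z₀ , 1≤k , H , P≈ , H≉0) = Z₀ , s≤s z≤n , H
      , B.trans (B.*-cong (y--cong Y≈Z) P≈) (B.sym (B.*-assoc (y- Z) ((y- Z) ^ k) H)) , H≉0

    increment : ∀ {roots} → Y ∈ roots → List (K⟦t⟧ × ℕ)
    increment {(Z , k) ∷ roots} (here _)  = (Z , suc k) ∷ roots
    increment {r ∷ roots}       (there i) = r ∷ increment i

    increment-total : ∀ {roots} (i : Y ∈ roots) →
      ListAction.sum (List.map proj₂ (increment i)) ≡ suc (ListAction.sum (List.map proj₂ roots))
    increment-total {r ∷ roots} (here _)  = ≡.refl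
    increment-total {(_ , k) ∷ roots} (there i) = ≡.trans (≡.cong (k ℕ.+_) (increment-total i)) (ℕ.+-suc k _)

    module _ {p} {Q : K⟦t⟧ → Set p} where
      increment-All : ∀ {roots} (i : Y ∈ roots) →
        All (λ (Z , _) → Q Z) roots → All (λ (Z , _) → Q Z) (increment i)
      increment-All (here _)  (q ∷ qs) = q ∷ qs
      increment-All (there i) (q ∷ qs) = q ∷ increment-All i qs

      increment-Any : ∀ {roots} (i : Y ∈ roots) →
        Any (λ (Z , _) → Q Z) roots → Any (λ (Z , _) → Q Z) (increment i)
      increment-Any (here _)  (here q)  = here q
      increment-Any (here _)  (there q) = there q
      increment-Any (there i) (here q)  = here q
      increment-Any (there i) (there q) = there (increment-Any i q)

    increment-distinct : ∀ {roots} (i : Y ∈ roots) →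
      Distinct roots → Distinct (increment i)
    increment-distinct (here _)  (d ∷ ds) = d ∷ ds
    increment-distinct {(Z , _) ∷ _} (there i) (d ∷ ds) = increment-All {Q = λ W → ¬ Z A.≈ W} i d ∷ increment-distinct i ds

    -- Distinctness ensures that Y equals no other entry, so their multiplicities stay as they are.
    increment-exact : ∀ {roots} (i : Y ∈ roots) →
      Distinct roots →
      All (λ (Z , k) → ExactRoot P Z k) roots → All (λ (Z , k) → ExactRoot (y- Y B.* P) Z k) (increment i)
    increment-exact {(Z , _) ∷ _} (here Y≈Z) (d ∷ _) (e ∷ es) = exactRoot-raise Y≈Z e
      ∷ All.zipWith (λ (Z≉W , e) → exactRoot-keep (λ Y≈W → Z≉W (A.trans (A.sym Y≈Z) Y≈W)) e) (d , es)
    increment-exact {(Z , _) ∷ _} (there i) (d ∷ ds) (e ∷ es) =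
      exactRoot-keep (λ Y≈Z → let Z≉W , Y≈W = All.lookupAny d i in Z≉W (A.trans (A.sym Y≈Z) Y≈W)) e ∷ increment-exact i ds es

    vanishing : ∀ M .{{_ : NonZero M}} V (V₀ : V 0 ≈ 0#) → substituteᵗ M V (y- Y B.* P) A.≈ A.0# →
      V A.≈ S₁.dilate M Y ⊎ substituteᵗ M V P A.≈ A.0#
    vanishing M V V₀ root with decideEquality V (S₁.dilate M Y)
    ... | yes V≈Y = inj₁ V≈Y
    ... | no  V≉Y = inj₂ (series-nonZeroDivisor
        (λ p → V≉Y (x-y≈0⇒x≈y A-ring V (S₁.dilate M Y) (A.trans (A.sym (substituteᵗ-y- M V V₀ Y)) p)))
        (substituteᵗ M V P) (A.trans (A.sym (*-homo (y- Y) P)) root))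
      where open IsRingHomomorphism (substituteᵗ-isHom M V V₀)

    -- Excluded middle decides whether Y is already listed: if so its multiplicity rises by one,
    -- otherwise it enters as a simple root.
    splits-extend : ∀ {d} → Splits P d → Splits (y- Y B.* P) (suc d)
    splits-extend s with any? (λ (Z , _) → decideEquality Y Z) (Splits.roots s)
    ... | yes i = record
      { roots    = increment i
      ; exact    = increment-exact i distinct exact
      ; distinct = increment-distinct i distinct
      ; complete = λ M V V₀ root → increment-Any {Q = λ Z → V A.≈ S₁.dilate M Z} i (found M V V₀ (vanishing M V V₀ root))
      ; total    = ≡.trans (increment-total i) (≡.cong suc total)
      }
      where
      open Splits s
      found : ∀ M .{{_ : NonZero M}} V (V₀ : V 0 ≈ 0#) → V A.≈ S₁.dilate M Y ⊎ substituteᵗ M V P A.≈ A.0# →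
        Any (λ (Z , _) → V A.≈ S₁.dilate M Z) roots
      found M V V₀ (inj₁ V≈Y)  = Any.map (λ {(Z , _)} Y≈Z → A.trans V≈Y (KD.dilate-cong M Y≈Z)) i
      found M V V₀ (inj₂ root) = complete M V V₀ root
    ... | no  ∄i = record
      { roots    = (Y , 1) ∷ roots
      ; exact    = (Y₀ , s≤s z≤n , P , B.*-congʳ {P} (B.sym (B.*-identityʳ (y- Y))) , P[Y]≉0)
                   ∷ All.zipWith (λ (Y≉Z , e) → exactRoot-keep Y≉Z e) (new , exact)
      ; distinct = new ∷ distinct
      ; complete = λ M V V₀ root → found M V V₀ (vanishing M V V₀ root)
      ; total    = ≡.cong suc total
      }
      where
      open Splits s
      new : All (λ (Z , _) → ¬ Y A.≈ Z) roots
      new = All.¬Any⇒All¬ roots ∄i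
      -- Were Y a root of P, completeness for P at M = 1 would have listed it.
      P[Y]≉0 : ¬ substituteᵗ 1 Y P A.≈ A.0#
      P[Y]≉0 root = ∄i (Any.map (λ {(Z , _)} Y≈Z → A.trans Y≈Z (KD.dilate-1 Z)) (complete 1 Y Y₀ root))
      found : ∀ M .{{_ : NonZero M}} V (V₀ : V 0 ≈ 0#) → V A.≈ S₁.dilate M Y ⊎ substituteᵗ M V P A.≈ A.0# →
        Any (λ (Z , _) → V A.≈ S₁.dilate M Z) ((Y , 1) ∷ roots)
      found M V V₀ (inj₁ V≈Y)  = here V≈Y
      found M V V₀ (inj₂ root) = there (complete M V V₀ root)

  -- Cancelling y - W on both sides leads to k = 0, where a factor left over on the other side would
  -- make H vanish at W.
  multiplicity-bound : ∀ {W} → W 0 ≈ 0# → ∀ k l {F H} → (y- W) ^ l B.* F B.≈ (y- W) ^ k B.* H →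
    ¬ substituteᵗ 1 W H A.≈ A.0# → l ≤ k
  multiplicity-bound W₀ k       zero    _  _   = z≤n
  multiplicity-bound {W} W₀ zero (suc l) {F} {H} eq H≉0 = contradiction (begin
    substituteᵗ 1 W H
      ≈⟨ ⟦⟧-cong (B.trans (B.sym (B.*-identityˡ H)) (B.sym eq)) ⟩
    substituteᵗ 1 W ((y- W) ^ suc l B.* F)                             ≈⟨ ⟦⟧-cong (B.*-assoc (y- W) ((y- W) ^ l) F) ⟩
    substituteᵗ 1 W (y- W B.* ((y- W) ^ l B.* F))                      ≈⟨ *-homo (y- W) ((y- W) ^ l B.* F) ⟩
    substituteᵗ 1 W (y- W) A.* substituteᵗ 1 W ((y- W) ^ l B.* F)      ≈⟨ A.*-congʳ (substituteᵗ-self W W₀) ⟩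
    A.0# A.* substituteᵗ 1 W ((y- W) ^ l B.* F)                        ≈⟨ A.zeroˡ _ ⟩
    A.0#                                                               ∎) H≉0
    where
    open SetoidReasoning A.setoid
    open IsRingHomomorphism (substituteᵗ-isHom 1 W W₀)
  multiplicity-bound {W} W₀ (suc k) (suc l) {F} {H} eq H≉0 = s≤s (multiplicity-bound W₀ k l {F} {H}
    (nonZeroDivisor-cancel B-ring (y- W) (λ _ → y--cancel W W₀) ((y- W) ^ l B.* F) ((y- W) ^ k B.* H)
      (B.trans (B.sym (B.*-assoc (y- W) ((y- W) ^ l) F)) (B.trans eq (B.*-assoc (y- W) ((y- W) ^ k) H)))) H≉0)

  -- The competing cofactor F may involve a further denominator m. Dilating the exact factorisation
  -- by m brings both to one level, and since dilation is injective, the dilated H still does not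
  -- vanish at the dilated Z.
  exactRoot-multiplicity : ∀ {P Z k} → ExactRoot P Z k → ∀ m .{{_ : NonZero m}} l F →
    S₂.dilate m P B.≈ (y- S₁.dilate m Z) ^ l B.* F → l ≤ k
  exactRoot-multiplicity {P} {Z} {k} (Z₀ , _ , H , P≈ , H≉0) m {{m≢0}} l F eq =
    multiplicity-bound W₀ k l (B.trans (B.sym eq) (B.trans (⟦⟧-cong P≈) (B.trans
      (*-homo ((y- Z) ^ k) H) (B.*-congʳ {S₂.dilate m H} (B.trans
        (^-homo {A = B-ring} {B = B-ring} (Dilation.dilate-isHom A-ring m) (y- Z) k)
        (RingExp.^-congˡ B.semiring k (dilate-y- m Z)))))))
      (λ p → H≉0 (KD.dilate-injective m {substituteᵗ 1 Z H} {A.0#} (A.trans (dilated p) (A.sym (KD.dilate-const m 0#)))))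
    where
    open IsRingHomomorphism (Dilation.dilate-isHom A-ring m)
    W₀ : S₁.dilate m Z 0 ≈ 0#
    W₀ = K.trans (KD.dilate-head m Z) Z₀
    dilated : substituteᵗ 1 (S₁.dilate m Z) (S₂.dilate m H) A.≈ A.0# →
      S₁.dilate m (substituteᵗ 1 Z H) A.≈ A.0#
    dilated p = A.trans (dilate-substituteᵗ m 1 {{m≢0}} {{_}} {{ℕ.m*n≢0 m 1 {{m≢0}}}} Z Z₀ H) (A.trans
      (A.reflexive (≡.cong (λ N → substituteᵗ N (S₁.dilate m Z) H) (≡.trans (ℕ.*-identityʳ m) (≡.sym (ℕ.*-identityˡ m))))) (A.trans
      (A.sym (substituteᵗ-dilate 1 m {{_}} {{m≢0}} {{ℕ.m*n≢0 1 m {{_}} {{m≢0}}}} (S₁.dilate m Z) W₀ H)) p))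

-- Splitting into linear factors

module Factorisation {c ℓ₁ ℓ₂} (em : ExcludedMiddle (c ⊔ ℓ₁ ⊔ ℓ₂)) (K : HeytingField c ℓ₁ ℓ₂)
    (char0 : FractionalSeries.CharacteristicZero K) (closed : FractionalSeries.AlgebraicallyClosed K) where
  open Substitution K
  open Roots K
  open FractionalSeries K using (module S₁; K⟦x,y⟧; _≈_; K-ring; IsOrder)
  open ClassicalField em K
  open Splitting em K
  open RootExistence em K char0 closed using (PositiveRoot; positiveRoot)

  record SplitsAfterDilation (G : K⟦x,y⟧) (d : ℕ) : Set (c ⊔ ℓ₁) where
    field
      N             : ℕ
      {{N-nonZero}} : NonZero N
      splits        : Splits (S₂.dilate N G) d

  -- At x = 0 the factor y - Y is y, so the quotient F has order one less there and the recursion is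
  -- on d. If F splits after x ↦ x^M, the root Y is dilated by M as well and the denominators
  -- multiply.
  splitsAfterDilation : ∀ d G → IsOrder (G 0) d → SplitsAfterDilation G d
  splitsAfterDilation zero    G (G₀₀≉0 , _) = record
    { N = 1 ; splits = splits-cong (B.sym (AD.dilate-1 G)) (splits-unit G₀₀≉0) }
  splitsAfterDilation (suc d) G order = factor (positiveRoot (<-wellFounded (suc d)) G (s≤s z≤n) order)
    where
    factor : PositiveRoot G → SplitsAfterDilation G (suc d)
    factor r = divide (root⇒divisible Y Y₀ (S₂.dilate N G) (A.trans
        (substituteᵗ-dilate 1 N {{_}} {{N-nonZero}} {{ℕ.m*n≢0 1 N}} Y Y₀ G)
        (A.trans (A.reflexive (≡.cong (λ M → substituteᵗ M Y G) (ℕ.*-identityˡ N))) isRoot)))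
      where
      open PositiveRoot r
      divide : ∃[ F ] S₂.dilate N G B.≈ y- Y B.* F → SplitsAfterDilation G (suc d)
      divide (F , G≈) = combine (splitsAfterDilation d F (order-F order))
        where
        G₀≈ : G 0 A.≈ S₁.X A.* F 0
        G₀≈ = A.trans (A.sym (AD.dilate-head N G)) (A.trans (G≈ 0)
          (A.trans (PowerSeries.⊙-head A-ring (y- Y) F) (A.*-congʳ {F 0} (y--head Y Y₀))))
        coefficient : ∀ j → G 0 (suc j) ≈ F 0 j
        coefficient j = K.trans (G₀≈ (suc j)) (PowerSeries.X-⊙-suc K-ring (F 0) j)
        order-F : IsOrder (G 0) (suc d) → IsOrder (F 0) d
        order-F (G_d≉0 , small) = (λ p → G_d≉0 (K.trans (coefficient d) p))
          , λ j j<d → K.trans (K.sym (coefficient j)) (small (suc j) (s<s j<d))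
        combine : SplitsAfterDilation F d → SplitsAfterDilation G (suc d)
        combine s = record
          { N = M ℕ.* N ; N-nonZero = ℕ.m*n≢0 M N
          ; splits = splits-cong
              (B.trans (B.sym (B.trans (⟦⟧-cong G≈) (B.trans (*-homo (y- Y) F)
                (B.*-congʳ {S₂.dilate M F} (dilate-y- M Y)))))
              (AD.dilate-dilate M N {{M-nonZero}} {{N-nonZero}} {{ℕ.m*n≢0 M N}} G))
              (splits-extend (S₂.dilate M F) (S₁.dilate M Y) (K.trans (KD.dilate-head M Y) Y₀) splits)
          }
          where
          open SplitsAfterDilation s renaming (N to M; N-nonZero to M-nonZero)
          open IsRingHomomorphism (Dilation.dilate-isHom A-ring M)

-- Comparison with the notions of the statement

module FractionalRoots {c ℓ₁ ℓ₂} (K : HeytingField c ℓ₁ ℓ₂) where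
  open Substitution K
  open Roots K hiding (y-_)
  open FractionalSeries K hiding (_^_; module S₂; y-_)
  open RingExp A.semiring using (_^_)
  open RingExp B.semiring using () renaming (_^_ to _^ᴮ_)
  open PolynomialSum K-ring A-ring using (polySum)

  opaque
    unfolding PowerSeries._⊙_ Substitution.substituteᵗ

    -- Once the opaque product and `substituteᵗ` are unfolded, the notions of the statement agree
    -- with their ring versions by computation. Recording this as equalities lets everything else
    -- keep them folded.
    substitute⁺-def : ∀ G Y → substitute⁺ G Y ≡ substituteᵗ (den Y) (coeff Y) G
    substitute⁺-def G Y = ≡.refl

    substitute⁺-diagonal : ∀ G Y →
      substitute⁺ G Y ≡ diagonal (S₂.dilate (den Y) λ i → compose (G i) (coeff Y))
    substitute⁺-diagonal G Y = ≡.refl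

    substitute-def : ∀ G poly Y → substitute G poly Y ≡
      diagonal (S₂.dilate (den Y) λ i → polySum S₁.const (proj₁ (poly i)) (G i) (coeff Y))
    substitute-def G poly Y = ≡.refl

    translate-def : ∀ G poly α i → translate G poly α i ≡
      polySum S₁.const (proj₁ (poly i)) (G i) (S₁.X A.+ S₁.const α)
    translate-def G poly α i = ≡.refl

    powerDivides-def : ∀ G Y k → PowerDivides G Y k ≡
      (∃[ m ] NonZero m × Σ[ F ∈ K⟦x,y⟧ ]
        S₂.dilate (den Y ℕ.* m) G B.≈ (Roots.y-_ K (S₁.dilate m (coeff Y))) ^ᴮ k B.* F)
    powerDivides-def G Y k = ≡.refl

    polynomialRootMultiplicity-def : ∀ p α k → IsPolynomialRootMultiplicity p α k ≡
      IsLargest (λ k → Σ[ q ∈ K⟦t⟧ ] IsPolynomial q × p A.≈ (S₁.X A.- S₁.const α) ^ k A.* q) k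
    polynomialRootMultiplicity-def p α k = ≡.refl

  powerDivides-cong : ∀ G Y g k → coeff Y A.≈ g →
    PowerDivides G Y k → PowerDivides G (record Y { coeff = g }) k
  powerDivides-cong G Y g k Y≈g power∣G =
    ≡.subst id (≡.sym (powerDivides-def G (record Y { coeff = g }) k))
      (transport (≡.subst id (powerDivides-def G Y k) power∣G))
    where
    transport : (∃[ m ] NonZero m × Σ[ F ∈ K⟦x,y⟧ ]
        S₂.dilate (den Y ℕ.* m) G B.≈ Roots.y-_ K (S₁.dilate m (coeff Y)) ^ᴮ k B.* F) →
      (∃[ m ] NonZero m × Σ[ F ∈ K⟦x,y⟧ ]
        S₂.dilate (den Y ℕ.* m) G B.≈ Roots.y-_ K (S₁.dilate m g) ^ᴮ k B.* F)
    transport (m , m≢0 , F , eq) = m , m≢0 , F , B.trans eq (B.*-congʳ {F}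
      (RingExp.^-congˡ B.semiring k (y--cong (KD.dilate-cong m {{m≢0}} Y≈g))))

-- Counting positive roots

module PositiveRootCount {c ℓ₁ ℓ₂} (em : ExcludedMiddle (c ⊔ ℓ₁ ⊔ ℓ₂)) (K : HeytingField c ℓ₁ ℓ₂)
    (char0 : FractionalSeries.CharacteristicZero K) (closed : FractionalSeries.AlgebraicallyClosed K) where
  open Substitution K
  open Roots K
  open FractionalSeries K hiding (_^_; module S₂; y-_)
  open FractionalRoots K
  open Splitting em K
  open Factorisation em K char0 closed
  open RingExp B.semiring using (_^_)

  exactRoot⇒root : ∀ {P Z k} → ExactRoot P Z k → substituteᵗ 1 Z P A.≈ A.0#
  exactRoot⇒root {P} {Z} {suc k} (Z₀ , _ , H , P≈ , _) = A.trans (⟦⟧-cong (B.trans P≈ (B.*-assoc (y- Z) ((y- Z) ^ k) H)))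
    (A.trans (*-homo (y- Z) ((y- Z) ^ k B.* H)) (A.trans (A.*-congʳ (substituteᵗ-self Z Z₀)) (A.zeroˡ (substituteᵗ 1 Z ((y- Z) ^ k B.* H)))))
    where open IsRingHomomorphism (substituteᵗ-isHom 1 Z Z₀)

  module _ (G : K⟦x,y⟧) (N : ℕ) {{N≢0 : NonZero N}} where

    substituteᵗ-level : ∀ M {{M≢0 : NonZero M}} V → V 0 ≈ 0# →
      substituteᵗ M V (S₂.dilate N G) A.≈ substituteᵗ (M ℕ.* N) V G
    substituteᵗ-level M {{M≢0}} V V₀ = substituteᵗ-dilate M N {{M≢0}} {{N≢0}} {{ℕ.m*n≢0 M N}} V V₀ G

    isPositiveRoot : ∀ {Z k} → ExactRoot (S₂.dilate N G) Z k → IsPositiveRoot G (Z ⟨x^1/ N ⟩)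
    isPositiveRoot {Z} e@(Z₀ , _) = Z₀ , A.trans (A.reflexive (substitute⁺-def G (Z ⟨x^1/ N ⟩))) (A.trans
      (A.reflexive (≡.cong (λ M → substituteᵗ M Z G) (≡.sym (ℕ.*-identityˡ N)))) (A.trans
      (A.sym (substituteᵗ-level 1 Z Z₀)) (exactRoot⇒root e)))

    multiplicity : ∀ {Z k} → ExactRoot (S₂.dilate N G) Z k → IsPositiveRootMultiplicity G (Z ⟨x^1/ N ⟩) k
    multiplicity {Z} {k} e@(Z₀ , _ , H , G≈ , _) =
        -- The exact factorisation lives at level N already, so m = 1 suffices for divisibility.
        ≡.subst id (≡.sym (powerDivides-def G (Z ⟨x^1/ N ⟩) k)) (1 , _ , H , B.trans
          (B.reflexive (≡.cong (λ M → S₂.dilate M G) (ℕ.*-identityʳ N)))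
          (B.trans G≈ (B.*-congʳ {H} (RingExp.^-congˡ B.semiring k (y--cong (A.sym (KD.dilate-1 Z)))))))
      , λ l power∣G → bound l (≡.subst id (powerDivides-def G (Z ⟨x^1/ N ⟩) l) power∣G)
      where
      bound : ∀ l →
        (∃[ m ] NonZero m × Σ[ F ∈ K⟦x,y⟧ ]
        S₂.dilate (N ℕ.* m) G B.≈ (y- S₁.dilate m Z) ^ l B.* F) → l ≤ k
      bound l (m , m≢0 , F , eq) = exactRoot-multiplicity e m {{m≢0}} l F (B.trans
        (AD.dilate-dilate m N {{m≢0}} {{N≢0}} {{ℕ.m*n≢0 m N {{m≢0}}}} G) (B.trans
        (B.reflexive (≡.cong (λ M → S₂.dilate M G) (ℕ.*-comm m N))) eq))

    level-N : K⟦t⟧ × ℕ → K^fra⟦x⟧ × ℕ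
    level-N (Z , k) = Z ⟨x^1/ N ⟩ , k

    splits⇒count : ∀ {d} → Splits (S₂.dilate N G) d →
      CountWithMultiplicity (IsPositiveRoot G) (IsPositiveRootMultiplicity G) d
    splits⇒count s = record
      { roots          = List.map level-N roots
      ; areRoots       = All.map⁺ (All.map isPositiveRoot exact)
      ; multiplicities = All.map⁺ (All.map multiplicity exact)
      ; distinct       = AllPairs.map⁺ (AllPairs.map (λ Z≉W p → Z≉W (KD.dilate-injective N p)) distinct)
      ; complete       = λ Y root → Any.map⁺ (found Y root)
      ; total          = ≡.trans (≡.cong ListAction.sum (≡.sym (map-∘ {g = proj₂} {f = level-N} roots))) total
      }
      where
      open Splits s
      -- For Y of denominator M, the series V is Y written at level M N, hence a root of G(x^N, y)
      -- at level M. The conclusion of `complete` is then literally equality of fractional series.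
      found : ∀ Y → IsPositiveRoot G Y → Any (λ (Z , _) → Y ≈ᶠ Z ⟨x^1/ N ⟩) roots
      found Y (Y₀ , root) = complete M {{den-nonZero Y}} V (K.trans (KD.dilate-head N (coeff Y)) Y₀) (A.trans
          (substituteᵗ-level M {{den-nonZero Y}} V (K.trans (KD.dilate-head N (coeff Y)) Y₀)) (A.trans
          (A.reflexive (≡.cong (λ L → substituteᵗ L V G) (ℕ.*-comm M N))) (A.trans
          (A.sym (dilate-substituteᵗ N M {{N≢0}} {{den-nonZero Y}} {{ℕ.m*n≢0 N M {{N≢0}} {{den-nonZero Y}}}} (coeff Y) Y₀ G)) (A.trans
          (KD.dilate-cong N {substituteᵗ M (coeff Y) G} {A.0#}
            (A.trans (A.reflexive (≡.sym (substitute⁺-def G Y))) root))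
          (KD.dilate-const N 0#)))))
        where
        M : ℕ
        M = den Y
        V : K⟦t⟧
        V = S₁.dilate N (coeff Y)

  positiveRootCount : ∀ G d → IsOrder (G 0) d →
    CountWithMultiplicity (IsPositiveRoot G) (IsPositiveRootMultiplicity G) d
  positiveRootCount G d order = splits⇒count G N {{N-nonZero}} splits
    where open SplitsAfterDilation (splitsAfterDilation d G order)

-- Roots with an arbitrary constant term

module Translation {c ℓ₁ ℓ₂} (K : HeytingField c ℓ₁ ℓ₂) where
  open Substitution K
  open Roots K using (const-cong)
  open FractionalSeries K hiding (_^_; module S₂; y-_)
  open FractionalRoots K
  open PowerSeries K-ring using (tail; X^-⊙-<; X^-⊙-+; X-⊙-head; X-⊙-suc; const-⊙)
  open RingExp A.semiring using (_^_)
  open PolynomialSum K-ring A-ring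
    using (polySum; polySum-suc; polySum-cong; polySum-bound; polySum-+; polySum-scale; VanishesFrom)
  module Kᴾ = PolynomialSum K-ring K-ring

  module _ (α : Carrier) where

    X-α X+α : K⟦t⟧
    X-α = S₁.X A.- S₁.const α
    X+α = S₁.X A.+ S₁.const α

    X-α-⊙ : ∀ f → X-α A.* f A.≈ S₁.X A.* f A.+ (λ j → - α * f j)
    X-α-⊙ f = A.trans (A.distribʳ f S₁.X (A.- S₁.const α)) (A.+-congˡ {S₁.X A.* f}
      (A.trans (A.*-congʳ {f} (A.sym (IsRingHomomorphism.-‿homo (const-isHom K-ring) α))) (const-⊙ (- α) f)))

    vanishes-X-α : ∀ {b} f → VanishesFrom b f → VanishesFrom (suc b) (X-α A.* f)
    vanishes-X-α f small (suc j) (s≤s b≤j) = K.trans (X-α-⊙ f (suc j)) (K.trans (K.+-cong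
      (K.trans (X-⊙-suc f j) (small j b≤j))
      (K.trans (K.*-congˡ (small (suc j) (ℕ.m≤n⇒m≤1+n b≤j))) (K.zeroʳ (- α)))) (K.+-identityˡ 0#))

    -- The point X + α may have a nonzero constant term, so the Horner homomorphisms do not cover
    -- it. The product is instead split as X f - α f: multiplication by X shifts the polynomial sum,
    -- and α scales it.
    evaluate-X-α : ∀ b f → VanishesFrom b f →
      polySum S₁.const (suc b) (X-α A.* f) X+α A.≈ S₁.X A.* polySum S₁.const b f X+α
    evaluate-X-α b f small = begin
      polySum S₁.const (suc b) (X-α A.* f) X+α
        ≈⟨ polySum-cong const-cong (suc b) (X-α-⊙ f) A.refl ⟩
      polySum S₁.const (suc b) (λ j → (S₁.X A.* f) j + - α * f j) X+α
        ≈⟨ polySum-+ (const-isHom K-ring) (suc b) (S₁.X A.* f) (λ j → - α * f j) X+α ⟩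
      polySum S₁.const (suc b) (S₁.X A.* f) X+α A.+ polySum S₁.const (suc b) (λ j → - α * f j) X+α
        ≈⟨ A.+-cong shifted scaled ⟩
      X+α A.* E A.+ A.- S₁.const α A.* E
        ≈⟨ A.distribʳ E X+α (A.- S₁.const α) ⟨
      (X+α A.- S₁.const α) A.* E
        ≈⟨ A.*-congʳ {E} (A.trans (A.+-assoc S₁.X (S₁.const α) (A.- S₁.const α))
             (A.trans (A.+-congˡ {S₁.X} (A.-‿inverseʳ (S₁.const α))) (A.+-identityʳ S₁.X))) ⟩
      S₁.X A.* E ∎
      where
      open SetoidReasoning A.setoid
      E : K⟦t⟧
      E = polySum S₁.const b f X+α
      shifted : polySum S₁.const (suc b) (S₁.X A.* f) X+α A.≈ X+α A.* E
      shifted = A.trans (polySum-suc S₁.const b (S₁.X A.* f) X+α) (A.trans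
        (A.+-cong (IsRingHomomorphism.⟦⟧-cong (const-isHom K-ring) (X-⊙-head f))
          (A.*-congˡ {X+α} (polySum-cong const-cong b (X-⊙-suc f) A.refl)))
        (A.+-identityˡ (X+α A.* E)))
      scaled : polySum S₁.const (suc b) (λ j → - α * f j) X+α A.≈ A.- S₁.const α A.* E
      scaled = A.trans (polySum-scale (const-isHom K-ring) (suc b) (- α) f X+α)
        (A.*-cong (IsRingHomomorphism.-‿homo (const-isHom K-ring) α)
          (polySum-bound (const-isHom K-ring) f X+α small (ℕ.n≤1+n b)))

    evaluate-[X-α]^ : ∀ d b q → VanishesFrom b q → VanishesFrom (d ℕ.+ b) (X-α ^ d A.* q) ×
      polySum S₁.const (d ℕ.+ b) (X-α ^ d A.* q) X+α A.≈ S₁.X ^ d A.* polySum S₁.const b q X+α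
    evaluate-[X-α]^ zero    b q small = (λ j b≤j → K.trans (A.*-identityˡ q j) (small j b≤j))
      , A.trans (polySum-cong const-cong b (A.*-identityˡ q) A.refl) (A.sym (A.*-identityˡ _))
    evaluate-[X-α]^ (suc d) b q small = let small′ , eq = evaluate-[X-α]^ d b q small in
        (λ j d+b≤j → K.trans (A.*-assoc X-α (X-α ^ d) q j) (vanishes-X-α (X-α ^ d A.* q) small′ j d+b≤j))
      , A.trans (polySum-cong const-cong (suc (d ℕ.+ b)) (A.*-assoc X-α (X-α ^ d) q) A.refl) (A.trans
          (evaluate-X-α (d ℕ.+ b) (X-α ^ d A.* q) small′) (A.trans
          (A.*-congˡ {S₁.X} eq) (A.sym (A.*-assoc S₁.X (S₁.X ^ d) (polySum S₁.const b q X+α)))))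

    -- Synthetic division of q by y - α: coefficient i is the sum of the q_(i+1+j) α^j. The single
    -- bound b is long enough for all tails.
    syntheticQuotient : ℕ → K⟦t⟧ → K⟦t⟧
    syntheticQuotient b q zero    = Kᴾ.polySum id b (tail q) α
    syntheticQuotient b q (suc i) = syntheticQuotient b (tail q) i

    vanishes-tail : ∀ {b q} → VanishesFrom b q → VanishesFrom b (tail q)
    vanishes-tail small j b≤j = small (suc j) (ℕ.m≤n⇒m≤1+n b≤j)

    syntheticQuotient-vanishes : ∀ b q i → VanishesFrom i q → syntheticQuotient b q i ≈ 0#
    syntheticQuotient-vanishes b q zero    small = Kᴾ.polySum-zero (id-isHom K-ring) b (tail q) α (λ j _ → small (suc j) z≤n)
    syntheticQuotient-vanishes b q (suc i) small = syntheticQuotient-vanishes b (tail q) i (λ j i≤j → small (suc j) (s≤s i≤j))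

    syntheticQuotient-suc : ∀ b q → VanishesFrom b q → ∀ i →
      q (suc i) ≈ syntheticQuotient b q i + - α * syntheticQuotient b q (suc i)
    syntheticQuotient-suc b q small zero    = subtract (Kᴾ.polySum-horner (id-isHom K-ring) b (tail q) α (vanishes-tail small))
      where
      open RingProperties K.ring using (-‿distribˡ-*)
      open GroupProperties K.+-group using (x≈z//y)
      subtract : ∀ {e x u} → e ≈ x + α * u → x ≈ e + - α * u
      subtract {e} {x} {u} p = K.trans (x≈z//y x (α * u) e (K.sym p)) (K.+-congˡ (-‿distribˡ-* α u))
    syntheticQuotient-suc b q small (suc i) = syntheticQuotient-suc b (tail q) (vanishes-tail small) i

    -- Above degree 0 the coefficients agree by the Horner recursion, whatever α is; the constant
    -- ones differ by q(α), and there the root enters.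
    root⇒X-α-divides : ∀ b q → VanishesFrom b q → Kᴾ.polySum id b q α ≈ 0# →
      q A.≈ X-α A.* syntheticQuotient b q
    root⇒X-α-divides b q small root zero = begin
      q 0
        ≈⟨ +-inverseˡ-unique (q 0) (α * q₁ 0) (K.trans (K.sym (Kᴾ.polySum-horner (id-isHom K-ring) b q α small)) root) ⟩
      - (α * q₁ 0)                         ≈⟨ -‿distribˡ-* α (q₁ 0) ⟩
      - α * q₁ 0                           ≈⟨ K.+-identityˡ _ ⟨
      0# + - α * q₁ 0                      ≈⟨ K.+-congʳ (X-⊙-head q₁) ⟨
      (S₁.X A.* q₁) 0 + - α * q₁ 0         ≈⟨ X-α-⊙ q₁ 0 ⟨
      (X-α A.* q₁) 0                       ∎
      where
      open SetoidReasoning K.setoid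
      open RingProperties K.ring using (-‿distribˡ-*; +-inverseˡ-unique)
      q₁ : K⟦t⟧
      q₁ = syntheticQuotient b q
    root⇒X-α-divides b q small root (suc i) = K.trans (syntheticQuotient-suc b q small i)
      (K.trans (K.+-congʳ (K.sym (X-⊙-suc q₁ i))) (K.sym (X-α-⊙ q₁ (suc i))))
      where
      q₁ : K⟦t⟧
      q₁ = syntheticQuotient b q

    head-polySum : ∀ b q → polySum S₁.const b q X+α 0 ≈ Kᴾ.polySum id b q α
    head-polySum b q = K.trans (polySum-hom {Q = K-ring} {R = A-ring} {S = K-ring} (head-isHom K-ring) S₁.const b q X+α)
      (Kᴾ.polySum-cong {id} {id} id b {q} {q} (λ _ → K.refl) (K.+-identityˡ α))

    -- From p = (y - α)^d q comes p(y + α) = y^d q(y + α), whose coefficient of degree d is q(α). If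
    -- that were 0, splitting off one more y - α from q would contradict maximality.
    translatedOrder : ∀ p b d → VanishesFrom b p →
      IsLargest (λ k → Σ[ q ∈ K⟦t⟧ ] IsPolynomial q × p A.≈ X-α ^ k A.* q) d →
      IsOrder (polySum S₁.const b p X+α) d
    translatedOrder p b d p-small ((q , (e , q-small) , p≈) , largest) =
        (λ p → q[α]≉0 (K.trans (K.sym (head-polySum e q)) (K.trans (K.sym leading) p)))
      , λ j j<d → K.trans (evaluated j) (X^-⊙-< d T j<d)
      where
      T : K⟦t⟧
      T = polySum S₁.const e q X+α
      evaluated : polySum S₁.const b p X+α A.≈ S₁.X ^ d A.* T
      evaluated = begin
        polySum S₁.const b p X+α
          ≈⟨ polySum-bound (const-isHom K-ring) p X+α p-small (ℕ.m≤m+n b (d ℕ.+ e)) ⟨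
        polySum S₁.const (b ℕ.+ (d ℕ.+ e)) p X+α
          ≈⟨ polySum-cong const-cong (b ℕ.+ (d ℕ.+ e)) p≈ A.refl ⟩
        polySum S₁.const (b ℕ.+ (d ℕ.+ e)) (X-α ^ d A.* q) X+α
          ≈⟨ polySum-bound (const-isHom K-ring) (X-α ^ d A.* q) X+α (proj₁ power) (ℕ.m≤n+m (d ℕ.+ e) b) ⟩
        polySum S₁.const (d ℕ.+ e) (X-α ^ d A.* q) X+α           ≈⟨ proj₂ power ⟩
        S₁.X ^ d A.* T                                           ∎
        where
        open SetoidReasoning A.setoid
        power : VanishesFrom (d ℕ.+ e) (X-α ^ d A.* q) ×
          polySum S₁.const (d ℕ.+ e) (X-α ^ d A.* q) X+α A.≈ S₁.X ^ d A.* polySum S₁.const e q X+α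
        power = evaluate-[X-α]^ d e q q-small
      leading : polySum S₁.const b p X+α d ≈ T 0
      leading = ≡.subst (λ n → polySum S₁.const b p X+α n ≈ T 0) (ℕ.+-identityʳ d)
        (K.trans (evaluated (d ℕ.+ 0)) (X^-⊙-+ d T 0))
      q[α]≉0 : Kᴾ.polySum id e q α ≉ 0#
      q[α]≉0 root = ℕ.1+n≰n (largest (suc d) (q₁
          , (e , λ i e≤i → syntheticQuotient-vanishes e q i (λ j i≤j → q-small j (ℕ.≤-trans e≤i i≤j)))
          , A.trans p≈ (A.trans (A.*-congˡ {X-α ^ d} (root⇒X-α-divides e q q-small root)) (A.trans
              (x∙yz≈y∙xz (X-α ^ d) X-α q₁) (A.sym (A.*-assoc X-α (X-α ^ d) q₁))))))
        where
        open CommutativeSemigroupProperties A.*-commutativeSemigroup using (x∙yz≈y∙xz)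
        q₁ : K⟦t⟧
        q₁ = syntheticQuotient e q

    -- Composition with s is a ring homomorphism that sends X + α to s + α = Y, and homomorphisms
    -- commute with polynomial sums. This links evaluation at any series to composition with a
    -- series of zero constant term.
    compose-translate : ∀ {Y s} → s 0 ≈ 0# → s A.+ S₁.const α A.≈ Y → ∀ b p →
      polySum S₁.const b p Y A.≈ compose (polySum S₁.const b p X+α) s
    compose-translate {Y} {s} s₀ s+α≈Y b p = A.sym (A.trans
      (polySum-hom {Q = K-ring} {R = A-ring} {S = A-ring} (compose-isHom s s₀) S₁.const b p X+α)
      (polySum-cong {λ x → compose (S₁.const x) s} {S₁.const}
        (λ {x} x≈y → A.trans (compose-const x) (const-cong x≈y)) b {p} {p} (λ _ → K.refl)
        (A.trans (+-homo S₁.X (S₁.const α)) (A.trans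
          (A.+-cong compose-X (compose-const α)) s+α≈Y))))
      where
      open IsRingHomomorphism (compose-isHom s s₀)
      compose-X : compose S₁.X s A.≈ s
      compose-X = Horner.horner-X {R = K-ring} {S = K-ring} {ι = S₁.const} (const-isHom K-ring) s₀ (compose-isHorner s s₀)
      compose-const : ∀ x → compose (S₁.const x) s A.≈ S₁.const x
      compose-const = Horner.horner-const {R = K-ring} {S = K-ring} {ι = S₁.const} (const-isHom K-ring) s₀ (compose-isHorner s s₀)

module TranslatedRootCount {c ℓ₁ ℓ₂} (K : HeytingField c ℓ₁ ℓ₂) where
  open Substitution K
  open Roots K using (substituteᵗ-cong)
  open FractionalSeries K hiding (_^_; module S₂; y-_)
  open FractionalRoots K
  open IsRingHomomorphism diagonal-isHom using () renaming (⟦⟧-cong to diagonal-cong)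

  infixl 6 _+ᶠ_
  _+ᶠ_ : K^fra⟦x⟧ → Carrier → K^fra⟦x⟧
  Z +ᶠ α = record Z { coeff = coeff Z A.+ S₁.const α }

  -α+α : ∀ α f → f A.- S₁.const α A.+ S₁.const α A.≈ f
  -α+α α f = A.trans (A.+-assoc f (A.- S₁.const α) (S₁.const α))
    (A.trans (A.+-congˡ {f} (A.-‿inverseˡ (S₁.const α))) (A.+-identityʳ f))

  +α-α : ∀ α f → f A.+ S₁.const α A.- S₁.const α A.≈ f
  +α-α α f = A.trans (A.+-assoc f (S₁.const α) (A.- S₁.const α))
    (A.trans (A.+-congˡ {f} (A.-‿inverseʳ (S₁.const α))) (A.+-identityʳ f))

  dilate-+α : ∀ N .{{_ : NonZero N}} α f → S₁.dilate N (f A.+ S₁.const α) A.≈ S₁.dilate N f A.+ S₁.const α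
  dilate-+α N α f = A.trans (+-homo f (S₁.const α)) (A.+-congˡ {S₁.dilate N f} (KD.dilate-const N α))
    where open IsRingHomomorphism (Dilation.dilate-isHom K-ring N)

  module _ (G : K⟦x,y⟧) (poly : IsPolynomialIn-y G) (α : Carrier) where

    substitute-translate : ∀ Y → (coeff Y A.- S₁.const α) 0 ≈ 0# →
      substitute G poly Y A.≈ substitute⁺ (translate G poly α) (Y -ᶠ α)
    substitute-translate Y Y₀ = A.trans (A.reflexive (substitute-def G poly Y)) (A.trans
      (diagonal-cong (AD.dilate-cong (den Y) {{den-nonZero Y}} λ i → A.trans
        (Translation.compose-translate K α Y₀ (-α+α α (coeff Y)) (proj₁ (poly i)) (G i))
        (A.reflexive (≡.cong (λ g → compose g (coeff Y A.- S₁.const α)) (≡.sym (translate-def G poly α i))))))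
      (A.reflexive (≡.sym (substitute⁺-diagonal (translate G poly α) (Y -ᶠ α)))))

    root⇒positiveRoot : ∀ Y → IsRootWithConstantTerm G poly α Y → IsPositiveRoot (translate G poly α) (Y -ᶠ α)
    root⇒positiveRoot Y (Y₀ , root) = Y-α₀ , A.trans (A.sym (substitute-translate Y Y-α₀)) root
      where
      Y-α₀ : (coeff Y A.- S₁.const α) 0 ≈ 0#
      Y-α₀ = K.trans (K.+-congʳ Y₀) (K.-‿inverseʳ α)

    positiveRoot⇒root : ∀ Z → IsPositiveRoot (translate G poly α) Z → IsRootWithConstantTerm G poly α (Z +ᶠ α)
    positiveRoot⇒root Z (Z₀ , root) = K.trans (K.+-congʳ Z₀) (K.+-identityˡ α)
      , A.trans (substitute-translate (Z +ᶠ α) Z+α-α₀) (A.trans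
          (A.reflexive (substitute⁺-def (translate G poly α) ((Z +ᶠ α) -ᶠ α))) (A.trans
          (substituteᵗ-cong (den Z) {{den-nonZero Z}} (coeff Z A.+ S₁.const α A.- S₁.const α) (coeff Z)
            Z+α-α₀ (+α-α α (coeff Z)) {translate G poly α} B.refl) (A.trans
          (A.reflexive (≡.sym (substitute⁺-def (translate G poly α) Z))) root)))
      where
      Z+α-α₀ : (coeff Z A.+ S₁.const α A.- S₁.const α) 0 ≈ 0#
      Z+α-α₀ = K.trans (+α-α α (coeff Z) 0) Z₀

    -- The series (Z + α) - α is Z only up to coefficientwise equality, so divisibility is
    -- transported along it, in one direction for the power k and in the other for maximality.
    multiplicity-+ᶠ : ∀ Z k → IsPositiveRootMultiplicity (translate G poly α) Z k →
      IsRootMultiplicity G poly α (Z +ᶠ α) k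
    multiplicity-+ᶠ Z k (power∣G , largest) =
        powerDivides-cong (translate G poly α) Z (coeff Z A.+ S₁.const α A.- S₁.const α) k (A.sym (+α-α α (coeff Z))) power∣G
      , λ l power∣G → largest l
          (powerDivides-cong (translate G poly α) ((Z +ᶠ α) -ᶠ α) (coeff Z) l (+α-α α (coeff Z)) power∣G)

    +ᶠ-injective : ∀ Z W → Z +ᶠ α ≈ᶠ W +ᶠ α → Z ≈ᶠ W
    +ᶠ-injective Z W eq = +-cancelʳ (S₁.const α) (S₁.dilate (den W) (coeff Z)) (S₁.dilate (den Z) (coeff W)) (A.trans
      (A.sym (dilate-+α (den W) {{den-nonZero W}} α (coeff Z))) (A.trans eq (dilate-+α (den Z) {{den-nonZero Z}} α (coeff W))))
      where open RingProperties A.ring using (+-cancelʳ)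

    -ᶠ-≈ᶠ : ∀ Y Z → Y -ᶠ α ≈ᶠ Z → Y ≈ᶠ Z +ᶠ α
    -ᶠ-≈ᶠ Y Z eq = A.trans
      (KD.dilate-cong (den Z) {{den-nonZero Z}} (A.sym (-α+α α (coeff Y)))) (A.trans
      (dilate-+α (den Z) {{den-nonZero Z}} α (coeff Y A.- S₁.const α)) (A.trans
      (A.+-congʳ eq) (A.sym (dilate-+α (den Y) {{den-nonZero Y}} α (coeff Z)))))

    translateCount : ∀ {d} →
      CountWithMultiplicity (IsPositiveRoot (translate G poly α)) (IsPositiveRootMultiplicity (translate G poly α)) d →
      CountWithMultiplicity (IsRootWithConstantTerm G poly α) (IsRootMultiplicity G poly α) d
    translateCount count = record
      { roots          = List.map shift roots
      ; areRoots       = All.map⁺ (All.map (λ {(Z , _)} → positiveRoot⇒root Z) areRoots)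
      ; multiplicities = All.map⁺ (All.map (λ {(Z , k)} → multiplicity-+ᶠ Z k) multiplicities)
      ; distinct       = AllPairs.map⁺ (AllPairs.map (λ {(Z , _)} {(W , _)} Z≉W eq → Z≉W (+ᶠ-injective Z W eq)) distinct)
      ; complete       = λ Y root → Any.map⁺ (Any.map (λ {(Z , _)} → -ᶠ-≈ᶠ Y Z) (complete (Y -ᶠ α) (root⇒positiveRoot Y root)))
      ; total          = ≡.trans (≡.cong ListAction.sum (≡.sym (map-∘ {g = proj₂} {f = shift} roots))) total
      }
      where
      open CountWithMultiplicity count
      shift : K^fra⟦x⟧ × ℕ → K^fra⟦x⟧ × ℕ
      shift (Z , k) = Z +ᶠ α , k

mainTheorem11 : ∀ {c ℓ₁ ℓ₂} → ExcludedMiddle (c ⊔ ℓ₁ ⊔ ℓ₂) →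
    (K : HeytingField c ℓ₁ ℓ₂) → let open FractionalSeries K in
    CharacteristicZero → AlgebraicallyClosed →
    (∀ (G : K⟦x,y⟧) d → IsOrder (G 0) d →
    CountWithMultiplicity (IsPositiveRoot G) (IsPositiveRootMultiplicity G) d)
    ×
    (∀ (G : K⟦x,y⟧) (poly : IsPolynomialIn-y G) α d →
    IsPolynomialRootMultiplicity (G 0) α d →
    CountWithMultiplicity (IsRootWithConstantTerm G poly α) (IsRootMultiplicity G poly α) d)
mainTheorem11 em K char0 closed = positiveRootCount , λ G poly α d multiplicity →
    translateCount G poly α (positiveRootCount (translate G poly α) d
      (≡.subst (λ g → IsOrder g d) (≡.sym (translate-def G poly α 0))
        (Translation.translatedOrder K α (G 0) (proj₁ (poly 0)) d (proj₂ (poly 0))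
          (≡.subst id (polynomialRootMultiplicity-def (G 0) α d) multiplicity))))
  where
  open FractionalSeries K using (translate; IsOrder)
  open FractionalRoots K using (translate-def; polynomialRootMultiplicity-def)
  open PositiveRootCount em K char0 closed using (positiveRootCount)
  open TranslatedRootCount K using (translateCount)
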